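{- Let $l\ge2$ be an integer and let $L_{rel}$ be a first-order language with relational vocabulary $\{R_1,\ldots,R_\rho\}$, $\rho>0$, where each $R_k$ has arity $r_k\ge2$. For every $I\subseteq\{1,\ldots,\rho\}$ the following hold: (i) There is an $L_{rel}$-formula $\xi(x,y)$ such that for almost all $\mathcal{M}\in\mathbf{C}^I$ the following holds: for every $l$-colouring $\gamma:M\to\{1,\ldots,l\}$ of $\mathcal{M}$ and all $a,b\in M$, $\gamma(a)=\gamma(b)$ if and only if $\mathcal{M}\models\xi(a,b)$. (ii) Almost all $\mathcal{M}\in\mathbf{C}^I$ are uniquely $l$-colourable. (iii) $\mathbf{C}^I$ has a zero-one law.
   Context: An $l$-colouring of an $L_{rel}$-structure $\mathcal{M}$ is a function $\gamma:M\to\{1,\ldots,l\}$ such that for every $k$ and every $(a_1,\ldots,a_{r_k})\in R_k^{\mathcal{M}}$ there are $i,j$ with $\gamma(a_i)\ne\gamma(a_j)$. $\mathcal{M}$ is $l$-colourable if it has an $l$-colouring, and uniquely $l$-colourable if it is $l$-colourable and for all $l$-colourings $\gamma,\gamma'$ of $\mathcal{M}$ and all $a,b\in M$, $\gamma(a)=\gamma(b)\Leftrightarrow\gamma'(a)=\gamma'(b)$. For $I\subseteq\{1,\ldots,\rho\}$, $\mathbf{C}^I_n$ is the set of $l$-colourable $L_{rel}$-structures $\mathcal{M}$ with universe $\{1,\ldots,n\}$ such that for every $k\in I$, $R_k^{\mathcal{M}}$ is irreflexive (all entries of each tuple in it are distinct) and symmetric (closed under permuting the entries of tuples). $\mathbf{C}^I=\bigcup_{n\geq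 1}\mathbf{C}^I_n$. "Almost all $\mathcal{M}\in\mathbf{C}^I$ have property $P$" means that the proportion of $\mathcal{M}\in\mathbf{C}^I_n$ with property $P$ approaches $1$ as $n\to\infty$. "$\mathbf{C}^I$ has a zero-one law" means that for every $L_{rel}$-sentence $\varphi$, either $\varphi$ or $\neg\varphi$ is satisfied by almost all $\mathcal{M}\in\mathbf{C}^I$. -}

module Defs where

open import Data.Bool.Base using (Bool; T)
open import Data.Fin.Base using (Fin; zero; suc)
open import Data.Fin.Subset using (Subset; _∈_)
open import Data.Integer.Base using (+_)
open import Data.List.Base using (List; length)
import Data.List.Membership.Setoid as Membership
open import Data.List.Relation.Binary.Permutation.Propositional using (_↭_)
import Data.List.Relation.Unary.Unique.Setoid as UniqueList
open import Data.Nat.Base using (ℕ; suc; NonZero; _≤_)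
open import Data.Product.Base using (Σ-syntax; ∃; ∃₂; ∃-syntax; _×_)
open import Data.Rational.Base as ℚ using (ℚ; 0ℚ; 1ℚ; ∣_∣; _/_; _-_)
open import Data.Sum.Base using (_⊎_)
open import Data.Vec.Base using (Vec; []; _∷_; lookup; map; toList)
import Data.Vec.Relation.Unary.Unique.Propositional as UniqueVec
open import Function.Bundles using (_⇔_)
open import Level using (0ℓ)
open import Relation.Binary.Bundles using (Setoid)
open import Relation.Binary.PropositionalEquality
  using (_≡_; _≢_; refl; sym; trans)
open import Relation.Nullary.Negation.Core using (¬_)

-- A relational vocabulary with ρ symbols is given by its arities
-- r : Fin ρ → ℕ.  The universe {1,…,n} is represented by Fin n.  Relations
-- on it are Bool-valued because they range over arbitrary subsets of a finite
-- set, which are to be counted.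

record Structure {ρ : ℕ} (r : Fin ρ → ℕ) (n : ℕ) : Set where
  constructor structure
  field
    rel : (k : Fin ρ) → Vec (Fin n) (r k) → Bool

open Structure public

Holds : ∀ {ρ} {r : Fin ρ → ℕ} {n} →
        Structure r n → (k : Fin ρ) → Vec (Fin n) (r k) → Set
Holds M k t = T (rel M k t)

-- Without function extensionality, "the same structure" has to mean having
-- the same relations pointwise; structures are counted up to this equality
-- (not up to isomorphism).

structureSetoid : ∀ {ρ} → (Fin ρ → ℕ) → ℕ → Setoid 0ℓ 0ℓ
structureSetoid r n = record
  { Carrier       = Structure r n
  ; _≈_           = λ M N → ∀ k t → rel M k t ≡ rel N k t
  ; isEquivalence = record
    { refl  = λ k t → refl
    ; sym   = λ e k t → sym (e k t)
    ; trans = λ e f k t → trans (e k t) (f k t)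
    }
  }

-- Formula r m: first-order formulas with equality whose free variables are
-- de Bruijn indices in Fin m; a quantifier binds index zero.

data Formula {ρ : ℕ} (r : Fin ρ → ℕ) (m : ℕ) : Set where
  _≐_       : Fin m → Fin m → Formula r m
  R         : (k : Fin ρ) → Vec (Fin m) (r k) → Formula r m
  ¬′_       : Formula r m → Formula r m
  _∧′_ _∨′_ _⇒′_ : Formula r m → Formula r m → Formula r m
  ∀′_ ∃′_   : Formula r (suc m) → Formula r m

Sentence : ∀ {ρ} → (Fin ρ → ℕ) → Set
Sentence r = Formula r 0

infix 4 _,_⊨_

_,_⊨_ : ∀ {ρ} {r : Fin ρ → ℕ} {n m} →
        Structure r n → Vec (Fin n) m → Formula r m → Set
M , e ⊨ (x ≐ y)  = lookup e x ≡ lookup e y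
M , e ⊨ R k xs   = Holds M k (map (lookup e) xs)
M , e ⊨ (¬′ φ)   = ¬ (M , e ⊨ φ)
M , e ⊨ (φ ∧′ ψ) = (M , e ⊨ φ) × (M , e ⊨ ψ)
M , e ⊨ (φ ∨′ ψ) = (M , e ⊨ φ) ⊎ (M , e ⊨ ψ)
M , e ⊨ (φ ⇒′ ψ) = (M , e ⊨ φ) → (M , e ⊨ ψ)
M , e ⊨ (∀′ φ)   = ∀ a → M , a ∷ e ⊨ φ
M , e ⊨ (∃′ φ)   = ∃[ a ] (M , a ∷ e ⊨ φ)

module _ {ρ : ℕ} {r : Fin ρ → ℕ} {n : ℕ} where

  IsColouring : (l : ℕ) → Structure r n → (Fin n → Fin l) → Set
  IsColouring l M γ =
    ∀ k t → Holds M k t → ∃₂ λ i j → γ (lookup t i) ≢ γ (lookup t j)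

  Colourable : ℕ → Structure r n → Set
  Colourable l M = ∃[ γ ] IsColouring l M γ

  UniquelyColourable : ℕ → Structure r n → Set
  UniquelyColourable l M =
    Colourable l M ×
    (∀ γ γ′ → IsColouring l M γ → IsColouring l M γ′ →
     ∀ a b → (γ a ≡ γ b) ⇔ (γ′ a ≡ γ′ b))

  Irreflexive : Structure r n → Fin ρ → Set
  Irreflexive M k = ∀ t → Holds M k t → UniqueVec.Unique t

  Symmetric : Structure r n → Fin ρ → Set
  Symmetric M k = ∀ t u → toList t ↭ toList u → Holds M k t → Holds M k u

  -- M ∈ 𝐂ᴵₙ
  InC : ℕ → Subset ρ → Structure r n → Set
  InC l I M =
    Colourable l M × (∀ k → k ∈ I → Irreflexive M k × Symmetric M k)

-- P has exactly m elements: they are listed, up to ≈, without repetition.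
-- Such an m is unique when it exists.

HasSize : (S : Setoid 0ℓ 0ℓ) → (Setoid.Carrier S → Set) → ℕ → Set
HasSize S P m =
  Σ[ xs ∈ List (Setoid.Carrier S) ]
    UniqueList.Unique S xs ×
    (∀ x → P x ⇔ Membership._∈_ S x xs) ×
    length xs ≡ m

module _ {ρ : ℕ} {r : Fin ρ → ℕ} where

  Property : Set₁
  Property = ∀ {n} → Structure r n → Set

  -- q = |{M ∈ 𝐂ᴵₙ : P M}| / |𝐂ᴵₙ|

  Proportion : ℕ → Subset ρ → Property → ℕ → ℚ → Set
  Proportion l I P n q =
    ∃₂ λ a b →
      HasSize (structureSetoid r n) (λ M → InC l I M × P M) a ×
      HasSize (structureSetoid r n) (InC l I) b ×
      Σ[ nz ∈ NonZero b ] q ≡ _/_ (+ a) b {{nz}}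

  AlmostAll : ℕ → Subset ρ → Property → Set
  AlmostAll l I P =
    ∀ ε → 0ℚ ℚ.< ε →
    ∃[ N ] ∀ n → N ≤ n → ∃[ q ] (Proportion l I P n q × ∣ q - 1ℚ ∣ ℚ.< ε)

ZeroOneLaw : ∀ {ρ} → (Fin ρ → ℕ) → ℕ → Subset ρ → Set
ZeroOneLaw r l I =
  (φ : Sentence r) →
  AlmostAll l I (λ (M : Structure r _) → M , [] ⊨ φ) ⊎
  AlmostAll l I (λ (M : Structure r _) → M , [] ⊨ (¬′ φ))

{-# OPTIONS --safe #-}
-- Count pairs (M , g) of a structure and a colouring of it. For almost all pairs every colour class
-- has more than (log₂ n)² elements: moving a vertex into a class that is smaller than its own does not
-- decrease the number of structures with the given colouring, there are about n such moves out of a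
-- colouring with a small class, and only a few of them lead to the same colouring. When all classes
-- are that large, a fixed one-point extension problem has a solution for almost all M, because the
-- possible solutions are independent.
-- In a structure with these extension properties, any two elements of the same colour lie in a
-- common class of a complete l-partite substructure. As such a substructure is uniquely colourable,
-- its positive diagram defines "same colour", independently of the colouring. Hence M occurs in
-- boundedly many good pairs, and almost all pairs can be replaced by almost all structures.
-- Finally, back-and-forth shows that any two good pairs satisfy the same sentences of bounded
-- quantifier depth, and whether φ is almost surely true is decided in any one of them.
module Submission where

open import Data.Bool.Base using (Bool; true; false; T; if_then_else_)
import Data.Bool.Properties as Bool
open import Data.Empty using (⊥-elim)
open import Data.Fin.Base as Fin using (Fin; zero; suc; toℕ; remQuot; combine)
open import Data.Fin.Permutation as Perm using (Permutation′; _⟨$⟩ʳ_; _⟨$⟩ˡ_)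
import Data.Fin.Permutation.Components as Components
import Data.Fin.Properties as Fin
open import Data.Fin.Subset using (Subset)
import Data.Fin.Subset as Subset
import Data.Fin.Subset.Properties as Subset
import Data.Integer.Base as ℤ
import Data.Integer.Properties as ℤ
open import Data.List.Base as List
  using (List; []; _∷_; length; filter; allFin; upTo; cartesianProduct; cartesianProductWith; deduplicate)
open import Data.List.Membership.Propositional using (_∈_; _∉_; find)
import Data.List.Membership.Propositional.Properties as ∈
import Data.List.Membership.Setoid as SetoidMembership
import Data.List.Membership.Setoid.Properties as SetoidMembershipProperties
import Data.List.Properties as List
open import Data.List.Relation.Binary.Permutation.Propositional using (_↭_; ↭-sym; ↭-trans; prep; ↭⇒↭ₛ)
import Data.List.Relation.Binary.Permutation.Propositional.Properties as ↭
import Data.List.Relation.Binary.Permutation.Setoid.Properties as SetoidPermutation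
open import Data.List.Relation.Unary.All as All using (All; []; _∷_)
import Data.List.Relation.Unary.All.Properties as All
open import Data.List.Relation.Unary.AllPairs as AllPairs using ([]; _∷_)
open import Data.List.Relation.Unary.Any as Any using (here; there)
import Data.List.Relation.Unary.Any.Properties as Any
import Data.List.Relation.Unary.Unique.DecSetoid.Properties as DecSetoidUnique
open import Data.List.Relation.Unary.Unique.Propositional using (Unique)
import Data.List.Relation.Unary.Unique.Propositional.Properties as Unique
import Data.List.Relation.Unary.Unique.Setoid as SetoidUnique
import Data.List.Relation.Unary.Unique.Setoid.Properties as SetoidUnique
open import Data.Nat.Base
open import Data.Nat.Properties hiding (_≟_)
import Data.Nat.Properties as ℕ using (_≟_)
open import Data.Nat.Tactic.RingSolver using (solve-∀)
open import Data.Product.Base using (Σ; Σ-syntax; ∃; ∃₂; ∃-syntax; _×_; _,_; proj₁; proj₂)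
open import Data.Rational.Base as ℚ using (mkℚ; 0ℚ; 1ℚ)
import Data.Rational.Properties as ℚ
import Data.Rational.Unnormalised.Base as ℚᵘ
import Data.Rational.Unnormalised.Properties as ℚᵘ
open import Data.Sum.Base using (_⊎_; inj₁; inj₂; [_,_]′)
open import Data.Unit.Base using (tt)
open import Data.Vec.Base as Vec using (Vec; []; _∷_; lookup; _[_]≔_)
import Data.Vec.Membership.Propositional.Properties as ∈ᵥ
import Data.Vec.Properties as Vec
open import Data.Vec.Relation.Unary.All as VecAll using ([]; _∷_)
import Data.Vec.Relation.Unary.All.Properties as VecAllProperties
open import Data.Vec.Relation.Unary.AllPairs as VecAllPairs using ([]; _∷_)
import Data.Vec.Relation.Unary.Unique.Propositional as VecUnique
import Data.Vec.Relation.Unary.Unique.Propositional.Properties as VecUnique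
open import Function.Base using (_∘_; id)
open import Function.Bundles using (_⇔_; mk⇔; module Equivalence)
open import Level using (0ℓ)
open import Relation.Binary.Bundles using (Setoid; DecSetoid)
open import Relation.Binary.Definitions using (DecidableEquality)
open import Relation.Binary.PropositionalEquality
  using (_≡_; _≢_; _≗_; refl; sym; trans; cong; cong₂; subst; subst₂; module ≡-Reasoning)
import Relation.Binary.PropositionalEquality.Properties as ≡
open import Relation.Nullary using (Dec; yes; no; does; ¬_; contradiction; ¬?; _×-dec_; _⊎-dec_; _→-dec_; map′; T?)
open import Relation.Nullary.Decidable using (decidable-stable; dec-true; dec-false)
open import Relation.Unary using (Decidable)
open import Defs

-- Pairs are counted because validity is local once the colouring is fixed: the relations on a few
-- points can be replaced without regard to the rest, whereas colourability is a global condition.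
-- The price is that a structure is weighted by its number of colourings, so rarity of bad pairs
-- says nothing about structures by itself. Two inequalities bridge the gap. An exceptional
-- structure has at least one colouring and all of its pairs are bad, so there are at most as many
-- exceptions as bad pairs. The good pairs number at most `l ^ l` times the members of the class, so
-- if bad pairs are rare among all pairs, they are also few in comparison with the members.
-- Probabilities appear only as inequalities of the form `K * bad ≤ total` between natural numbers,
-- for arbitrary `K`. Accordingly, independence takes the form of an overwriting map with a bounded
-- number of preimages, and injections are given by maps that undo them.

private
  variable
    A B Φ Ψ : Set

-- Indicators and sums over lists

𝟙 : Dec Φ → ℕ
𝟙 (yes _) = 1
𝟙 (no _)  = 0

𝟙-yes : (d : Dec Φ) → Φ → 𝟙 d ≡ 1
𝟙-yes (yes _) _ = refl
𝟙-yes (no ¬p) p = contradiction p ¬p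

𝟙-no : (d : Dec Φ) → ¬ Φ → 𝟙 d ≡ 0
𝟙-no (yes p) ¬p = contradiction p ¬p
𝟙-no (no _)  _  = refl

𝟙-mono : (d : Dec Φ) (e : Dec Ψ) → (Φ → Ψ) → 𝟙 d ≤ 𝟙 e
𝟙-mono (yes p) e f = ≤-reflexive (sym (𝟙-yes e (f p)))
𝟙-mono (no _)  e f = z≤n

𝟙-split : (d : Dec Φ) (e : Dec Ψ) (f : Dec (Φ × Ψ)) (g : Dec (Φ × ¬ Ψ)) → 𝟙 d ≡ 𝟙 f + 𝟙 g
𝟙-split (yes p) (yes q) f g = sym (cong₂ _+_ (𝟙-yes f (p , q)) (𝟙-no g (λ z → proj₂ z q)))
𝟙-split (yes p) (no ¬q) f g = sym (cong₂ _+_ (𝟙-no f (¬q ∘ proj₂)) (𝟙-yes g (p , ¬q)))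
𝟙-split (no ¬p) e       f g = sym (cong₂ _+_ (𝟙-no f (¬p ∘ proj₁)) (𝟙-no g (¬p ∘ proj₁)))

𝟙>0⇒ : (d : Dec Φ) → 0 < 𝟙 d → Φ
𝟙>0⇒ (yes p) _ = p

𝟙*-≤ : ∀ (d : Dec Φ) {m n} → (Φ → m ≤ n) → 𝟙 d * m ≤ n
𝟙*-≤ (yes p) {m} m≤n = ≤-trans (≤-reflexive (*-identityˡ m)) (m≤n p)
𝟙*-≤ (no _)      m≤n = z≤n

∑ : List A → (A → ℕ) → ℕ
∑ []       f = 0
∑ (x ∷ xs) f = f x + ∑ xs f

∑-mono-∈ : ∀ (xs : List A) {f g : A → ℕ} → (∀ {x} → x ∈ xs → f x ≤ g x) → ∑ xs f ≤ ∑ xs g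
∑-mono-∈ []       f≤g = z≤n
∑-mono-∈ (x ∷ xs) f≤g = +-mono-≤ (f≤g (here refl)) (∑-mono-∈ xs (f≤g ∘ there))

∑-mono : ∀ (xs : List A) {f g : A → ℕ} → (∀ x → f x ≤ g x) → ∑ xs f ≤ ∑ xs g
∑-mono xs f≤g = ∑-mono-∈ xs (λ {x} _ → f≤g x)

∑-cong : ∀ (xs : List A) {f g : A → ℕ} → (∀ x → f x ≡ g x) → ∑ xs f ≡ ∑ xs g
∑-cong []       f≡g = refl
∑-cong (x ∷ xs) f≡g = cong₂ _+_ (f≡g x) (∑-cong xs f≡g)

∑-+ : ∀ (xs : List A) (f g : A → ℕ) → ∑ xs (λ x → f x + g x) ≡ ∑ xs f + ∑ xs g
∑-+ []       f g = refl
∑-+ (x ∷ xs) f g = trans (cong (f x + g x +_) (∑-+ xs f g)) (lemma (f x) (g x) (∑ xs f) (∑ xs g))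
  where
  lemma : ∀ a b c d → a + b + (c + d) ≡ a + c + (b + d)
  lemma = solve-∀

∑-*ˡ : ∀ (xs : List A) c (f : A → ℕ) → ∑ xs (λ x → c * f x) ≡ c * ∑ xs f
∑-*ˡ []       c f = sym (*-zeroʳ c)
∑-*ˡ (x ∷ xs) c f = trans (cong (c * f x +_) (∑-*ˡ xs c f)) (sym (*-distribˡ-+ c (f x) (∑ xs f)))

∑-*ʳ : ∀ (xs : List A) c (f : A → ℕ) → ∑ xs (λ x → f x * c) ≡ ∑ xs f * c
∑-*ʳ []       c f = refl
∑-*ʳ (x ∷ xs) c f = trans (cong (f x * c +_) (∑-*ʳ xs c f)) (sym (*-distribʳ-+ c (f x) (∑ xs f)))

∑-const : ∀ (xs : List A) c → ∑ xs (λ _ → c) ≡ length xs * c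
∑-const []       c = refl
∑-const (x ∷ xs) c = cong (c +_) (∑-const xs c)

∑-≤const : ∀ (xs : List A) {f : A → ℕ} {c} → (∀ x → f x ≤ c) → ∑ xs f ≤ length xs * c
∑-≤const xs f≤c = ≤-trans (∑-mono xs f≤c) (≤-reflexive (∑-const xs _))

∑-zero : ∀ (xs : List A) → ∑ xs (λ _ → 0) ≡ 0
∑-zero xs = trans (∑-const xs 0) (*-zeroʳ (length xs))

∑-swap : ∀ (xs : List A) (ys : List B) (f : A → B → ℕ) →
         ∑ xs (λ x → ∑ ys (f x)) ≡ ∑ ys (λ y → ∑ xs (λ x → f x y))
∑-swap []       ys f = sym (∑-zero ys)
∑-swap (x ∷ xs) ys f =
  trans (cong (∑ ys (f x) +_) (∑-swap xs ys f)) (sym (∑-+ ys (f x) (λ y → ∑ xs (λ x → f x y))))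

∑-++ : ∀ (xs ys : List A) (f : A → ℕ) → ∑ (xs List.++ ys) f ≡ ∑ xs f + ∑ ys f
∑-++ []       ys f = refl
∑-++ (x ∷ xs) ys f = trans (cong (f x +_) (∑-++ xs ys f)) (sym (+-assoc (f x) _ _))

∑-map : ∀ (xs : List A) (h : A → B) (f : B → ℕ) → ∑ (List.map h xs) f ≡ ∑ xs (f ∘ h)
∑-map []       h f = refl
∑-map (x ∷ xs) h f = cong (f (h x) +_) (∑-map xs h f)

∑-cartesianProduct : ∀ (xs : List A) (ys : List B) (f : A × B → ℕ) →
  ∑ (cartesianProduct xs ys) f ≡ ∑ xs (λ x → ∑ ys (λ y → f (x , y)))
∑-cartesianProduct []       ys f = refl
∑-cartesianProduct (x ∷ xs) ys f =
  trans (∑-++ (List.map (x ,_) ys) _ f) (cong₂ _+_ (∑-map ys (x ,_) f) (∑-cartesianProduct xs ys f))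

term≤∑ : ∀ {xs : List A} {x} (f : A → ℕ) → x ∈ xs → f x ≤ ∑ xs f
term≤∑ {xs = _ ∷ xs} f (here refl) = m≤m+n _ (∑ xs f)
term≤∑ {xs = y ∷ _}  f (there x∈)  = ≤-trans (term≤∑ f x∈) (m≤n+m _ (f y))

nonempty : ∀ {xs : List A} {x} → x ∈ xs → ∃[ q ] suc q ≡ length xs
nonempty {xs = _ ∷ xs} _ = length xs , refl

∑>0⇒∃ : ∀ (xs : List A) (f : A → ℕ) → 0 < ∑ xs f → ∃[ x ] x ∈ xs × 0 < f x
∑>0⇒∃ (x ∷ xs) f pos with 0 <? f x
... | yes fx>0 = x , here refl , fx>0
... | no  fx≯0 with y , y∈xs , fy>0 ← ∑>0⇒∃ xs f
                     (subst (λ m → 0 < m + ∑ xs f) (n≤0⇒n≡0 (≮⇒≥ fx≯0)) pos)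
               = y , there y∈xs , fy>0

length-filter≡∑ : ∀ {P : A → Set} (P? : Decidable P) xs → length (filter P? xs) ≡ ∑ xs (λ x → 𝟙 (P? x))
length-filter≡∑ P? []       = refl
length-filter≡∑ P? (x ∷ xs) with P? x
... | yes _ = cong suc (length-filter≡∑ P? xs)
... | no  _ = length-filter≡∑ P? xs

-- A union bound without division, used wherever a rarity estimate is summed over colours, sizes or
-- extension problems.
∑-average : ∀ (xs : List A) (f : A → ℕ) V → (∀ {x} → x ∈ xs → length xs * f x ≤ V) → ∑ xs f ≤ V
∑-average []           f V _ = z≤n
∑-average xs@(_ ∷ _) f V h = *-cancelˡ-≤ (length xs) (begin
  length xs * ∑ xs f                  ≡⟨ ∑-*ˡ xs (length xs) f ⟨
  ∑ xs (λ x → length xs * f x)        ≤⟨ ∑-mono-∈ xs h ⟩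
  ∑ xs (λ _ → V)                      ≡⟨ ∑-const xs V ⟩
  length xs * V                       ∎)
  where open ≤-Reasoning

module _ (S : DecSetoid 0ℓ 0ℓ) where
  open DecSetoid S renaming (Carrier to C; refl to ≈-refl; sym to ≈-sym; trans to ≈-trans)

  ∑-unique≤1 : ∀ {xs : List C} → SetoidUnique.Unique setoid xs → ∀ z → ∑ xs (λ x → 𝟙 (x ≟ z)) ≤ 1
  ∑-unique≤1 [] z = z≤n
  ∑-unique≤1 {x ∷ xs} (x∉xs ∷ xs!) z with x ≟ z
  ... | no  _   = ∑-unique≤1 xs! z
  ... | yes x≈z = s≤s (≤-trans (∑-mono-∈ xs {g = λ _ → 0} absent) (≤-reflexive (∑-zero xs)))
    where
    absent : ∀ {y} → y ∈ xs → 𝟙 (y ≟ z) ≤ 0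
    absent {y} y∈xs = ≤-reflexive (𝟙-no (y ≟ z)
      (λ y≈z → All.lookup x∉xs y∈xs (≈-trans x≈z (≈-sym y≈z))))

  -- Since `xs` has no repetition, each `y` pays for at most one `x`. The map `h` reconstructs `x`
  -- from `y`, so an undo map takes the place of an injectivity proof. Moves of a vertex,
  -- overwriting of a pattern and factoring of a colouring are all counted in this way.
  ∑-cover : ∀ {xs : List C} → SetoidUnique.Unique setoid xs → (ys : List B) (h : B → C) {f : C → ℕ} {g : B → ℕ} →
            (∀ x → 0 < f x → ∃[ y ] y ∈ ys × x ≈ h y × f x ≤ g y) → ∑ xs f ≤ ∑ ys g
  ∑-cover {xs = xs} xs! ys h {f} {g} cover = begin
    ∑ xs f                                          ≤⟨ ∑-mono xs covered ⟩
    ∑ xs (λ x → ∑ ys (λ y → 𝟙 (x ≟ h y) * g y))     ≡⟨ ∑-swap xs ys _ ⟩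
    ∑ ys (λ y → ∑ xs (λ x → 𝟙 (x ≟ h y) * g y))     ≡⟨ ∑-cong ys (λ y → ∑-*ʳ xs (g y) _) ⟩
    ∑ ys (λ y → ∑ xs (λ x → 𝟙 (x ≟ h y)) * g y)     ≤⟨ ∑-mono ys (λ y → *-monoˡ-≤ (g y) (∑-unique≤1 xs! (h y))) ⟩
    ∑ ys (λ y → 1 * g y)                            ≡⟨ ∑-cong ys (λ y → *-identityˡ (g y)) ⟩
    ∑ ys g                                          ∎
    where
    open ≤-Reasoning
    covered : ∀ x → f x ≤ ∑ ys (λ y → 𝟙 (x ≟ h y) * g y)
    covered x with 0 <? f x
    ... | no  fx≯0 = ≤-trans (≮⇒≥ fx≯0) z≤n
    ... | yes fx>0 with y , y∈ys , x≈hy , fx≤gy ← cover x fx>0 = begin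
      f x                  ≤⟨ fx≤gy ⟩
      g y                  ≡⟨ *-identityˡ (g y) ⟨
      1 * g y              ≡⟨ cong (_* g y) (𝟙-yes (x ≟ h y) x≈hy) ⟨
      𝟙 (x ≟ h y) * g y    ≤⟨ term≤∑ (λ y → 𝟙 (x ≟ h y) * g y) y∈ys ⟩
      ∑ ys (λ y → 𝟙 (x ≟ h y) * g y) ∎

-- Exhaustive lists of vectors and of structures

vecs : List A → ∀ n → List (Vec A n)
vecs xs zero    = [] ∷ []
vecs xs (suc n) = cartesianProductWith _∷_ xs (vecs xs n)

∈-vecs : ∀ {xs : List A} → (∀ x → x ∈ xs) → ∀ {n} (v : Vec A n) → v ∈ vecs xs n
∈-vecs all∈ []      = here refl
∈-vecs all∈ (x ∷ v) = ∈.∈-cartesianProductWith⁺ _∷_ (all∈ x) (∈-vecs all∈ v)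

vecs-unique : ∀ {xs : List A} → Unique xs → ∀ n → Unique (vecs xs n)
vecs-unique xs! zero    = [] ∷ []
vecs-unique xs! (suc n) = Unique.cartesianProductWith⁺ _∷_ Vec.∷-injective xs! (vecs-unique xs! n)

length-cartesianProductWith : ∀ {A B C : Set} (f : A → B → C) xs ys →
  length (cartesianProductWith f xs ys) ≡ length xs * length ys
length-cartesianProductWith f []       ys = refl
length-cartesianProductWith f (x ∷ xs) ys = trans (List.length-++ (List.map (f x) ys))
  (cong₂ _+_ (List.length-map (f x) ys) (length-cartesianProductWith f xs ys))

length-vecs : ∀ (xs : List A) n → length (vecs xs n) ≡ length xs ^ n
length-vecs xs zero    = refl
length-vecs xs (suc n) =
  trans (length-cartesianProductWith _∷_ xs (vecs xs n)) (cong (length xs *_) (length-vecs xs n))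

∈-allFin : ∀ {n} (i : Fin n) → i ∈ allFin n
∈-allFin = ∈.∈-allFin

maps : ∀ l n → List (Vec (Fin l) n)
maps l n = vecs (allFin l) n

∈-maps : ∀ {l n} (g : Vec (Fin l) n) → g ∈ maps l n
∈-maps = ∈-vecs ∈-allFin

maps-unique : ∀ l n → Unique (maps l n)
maps-unique l n = vecs-unique (Unique.allFin⁺ l) n

mapDecSetoid : ℕ → ℕ → DecSetoid 0ℓ 0ℓ
mapDecSetoid l n = ≡.decSetoid {A = Vec (Fin l) n} (Vec.≡-dec Fin._≟_)

all-maps? : ∀ {l n} {P : Vec (Fin l) n → Set} → Decidable P → Dec (∀ g → P g)
all-maps? {l} {n} P? = map′ (λ all g → All.lookup all (∈-maps g)) (λ h → All.tabulate (λ {g} _ → h g))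
                            (All.all? P? (maps l n))

any-map? : ∀ {l n} {P : Vec (Fin l) n → Set} → Decidable P → Dec (∃ P)
any-map? {l} {n} P? = map′ (λ any → let g , _ , Pg = find any in g , Pg)
                           (λ (g , Pg) → Any.map (λ { refl → Pg }) (∈-maps g))
                           (Any.any? P? (maps l n))

-- Functions are replaced by their tables; invariance under `≗` makes up for the lack of
-- extensionality.
all-functions? : ∀ {l n} {P : (Fin n → Fin l) → Set} → (∀ {f g} → f ≗ g → P f → P g) →
                 Decidable P → Dec (∀ f → P f)
all-functions? resp P? =
  map′ (λ h f → resp (Vec.lookup∘tabulate f) (h (Vec.tabulate f))) (λ h g → h (lookup g))
       (all-maps? (P? ∘ lookup))

module _ {ρ : ℕ} (r : Fin ρ → ℕ) where

  positions : ∀ n → List (Σ (Fin ρ) (λ k → Vec (Fin n) (r k)))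
  positions n = List.concatMap (λ k → List.map (k ,_) (maps n (r k))) (allFin ρ)

  ∈-positions : ∀ {n} k (t : Vec (Fin n) (r k)) → (k , t) ∈ positions n
  ∈-positions k t = ∈.∈-concatMap⁺ _ (Any.map (λ { refl → ∈.∈-map⁺ (k ,_) (∈-maps t) }) (∈-allFin k))

  all-positions? : ∀ {n} {P : ∀ k → Vec (Fin n) (r k) → Set} → (∀ k t → Dec (P k t)) → Dec (∀ k t → P k t)
  all-positions? P? = Fin.all? (λ k → all-maps? (P? k))

module _ {ρ : ℕ} {r : Fin ρ → ℕ} {n : ℕ} where

  infix 4 _≈_ _≈?_

  _≈_ : Structure r n → Structure r n → Set
  _≈_ = Setoid._≈_ (structureSetoid r n)

  ≈-sym : {M N : Structure r n} → M ≈ N → N ≈ M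
  ≈-sym M≈N k t = sym (M≈N k t)

  ≈-trans : {M N O : Structure r n} → M ≈ N → N ≈ O → M ≈ O
  ≈-trans M≈N N≈O k t = trans (M≈N k t) (N≈O k t)

  opaque

    _≈?_ : (M N : Structure r n) → Dec (M ≈ N)
    M ≈? N = all-positions? r (λ k t → rel M k t Bool.≟ rel N k t)

module _ {ρ : ℕ} (r : Fin ρ → ℕ) (n : ℕ) where

  structureDecSetoid : DecSetoid 0ℓ 0ℓ
  structureDecSetoid = record
    { isDecEquivalence = record
      { isEquivalence = Setoid.isEquivalence (structureSetoid r n) ; _≟_ = _≈?_ } }

  decode : Vec Bool (length (positions r n)) → Structure r n
  decode v = structure (λ k t → lookup v (Any.index (∈-positions r k t)))

  allBools : List Bool
  allBools = false ∷ true ∷ []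

  ∈-allBools : ∀ b → b ∈ allBools
  ∈-allBools false = here refl
  ∈-allBools true  = there (here refl)

  open SetoidMembership (structureSetoid r n) using () renaming (_∈_ to _∈ₛ_)

  opaque

    -- Different codes are not shown to decode to different structures, so repetitions up to `≈` are
    -- removed afterwards.
    structures : List (Structure r n)
    structures = deduplicate _≈?_ (List.map decode (vecs allBools (length (positions r n))))

    structures-unique : SetoidUnique.Unique (structureSetoid r n) structures
    structures-unique = DecSetoidUnique.deduplicate-! structureDecSetoid _

    ∈-structures : ∀ M → M ∈ₛ structures
    ∈-structures M = SetoidMembershipProperties.∈-deduplicate⁺ (structureSetoid r n) _≈?_
      (λ N≈N′ M≈N k t → trans (M≈N k t) (sym (N≈N′ k t)))
      (Any.map (λ { refl → λ k t → sym (decode-code k t) })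
               (∈.∈-map⁺ decode (∈-vecs ∈-allBools code)))
      where
      code : Vec Bool (length (positions r n))
      code = Vec.tabulate (λ i → let k , t = List.lookup (positions r n) i in rel M k t)
      decode-code : ∀ k t → rel (decode code) k t ≡ rel M k t
      decode-code k t = trans (Vec.lookup∘tabulate _ (Any.index (∈-positions r k t)))
        (cong (λ (k , t) → rel M k t) (sym (Any.lookup-index (∈-positions r k t))))

  represent : ∀ M → ∃[ N ] N ∈ structures × M ≈ N
  represent M = find (∈-structures M)

-- Vectors and permutations of tuples

map-injective : ∀ {A B : Set} {f : A → B} → (∀ {x y} → f x ≡ f y → x ≡ y) →
                ∀ {m} (u v : Vec A m) → Vec.map f u ≡ Vec.map f v → u ≡ v
map-injective f-inj []      []      _  = refl
map-injective f-inj (x ∷ u) (y ∷ v) eq with fx≡fy , eq′ ← Vec.∷-injective eq =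
  cong₂ _∷_ (f-inj fx≡fy) (map-injective f-inj u v eq′)

unique-map⁻ : ∀ {A B : Set} {f : A → B} {m} (u : Vec A m) →
              VecUnique.Unique (Vec.map f u) → VecUnique.Unique u
unique-map⁻ []      _                          = []
unique-map⁻ {f = f} (x ∷ u) (x∉ ∷ u!) =
  VecAll.map (λ fx≢fy x≡y → fx≢fy (cong f x≡y)) (VecAllProperties.map⁻ x∉) ∷ unique-map⁻ u u!

vec-ext : ∀ {A : Set} {m} (u v : Vec A m) → (∀ i → lookup u i ≡ lookup v i) → u ≡ v
vec-ext []      []      _ = refl
vec-ext (x ∷ u) (y ∷ v) h = cong₂ _∷_ (h zero) (vec-ext u v (h ∘ suc))

toList-map⁻ : ∀ {A B : Set} {f : A → B} {m} (u : Vec B m) {xs} → Vec.toList u ≡ List.map f xs →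
              ∃[ v ] u ≡ Vec.map f v × Vec.toList v ≡ xs
toList-map⁻ []      {[]}     refl = [] , refl , refl
toList-map⁻ (y ∷ u) {x ∷ xs} eq
  with y≡fx , eq′ ← List.∷-injective eq
  with v , u≡ , v≡ ← toList-map⁻ u eq′ = x ∷ v , cong₂ _∷_ y≡fx u≡ , cong (x ∷_) v≡

map-↭⁺ : ∀ {A B : Set} (f : A → B) {m} (u v : Vec A m) → Vec.toList u ↭ Vec.toList v →
         Vec.toList (Vec.map f u) ↭ Vec.toList (Vec.map f v)
map-↭⁺ f u v u↭v =
  subst₂ _↭_ (sym (Vec.toList-map f u)) (sym (Vec.toList-map f v)) (↭.map⁺ f u↭v)

map-↭⁻ : ∀ {A B : Set} (f : A → B) {m} (u : Vec A m) (t : Vec B m) →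
         Vec.toList (Vec.map f u) ↭ Vec.toList t → ∃[ v ] t ≡ Vec.map f v × Vec.toList u ↭ Vec.toList v
map-↭⁻ f u t p
  with xs , t≡ , u↭xs ← ↭.↭-map-inv f (subst (_↭ Vec.toList t) (Vec.toList-map f u) p)
  with v , t≡fv , v≡xs ← toList-map⁻ t t≡ = v , t≡fv , subst (Vec.toList u ↭_) (sym v≡xs) u↭xs

module _ {n : ℕ} where

  infix 4 _≡ᵛ?_ _↭?_

  _≡ᵛ?_ : ∀ {m} → DecidableEquality (Vec (Fin n) m)
  _≡ᵛ?_ = Vec.≡-dec Fin._≟_

  unique? : ∀ {m} (t : Vec (Fin n) m) → Dec (VecUnique.Unique t)
  unique? = VecAllPairs.allPairs? (λ x y → ¬? (x Fin.≟ y))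

  _↭?_ : (xs ys : List (Fin n)) → Dec (xs ↭ ys)
  []       ↭? []       = yes _↭_.refl
  []       ↭? (y ∷ ys) = no (λ p → contradiction (↭.↭-length p) λ ())
  (x ∷ xs) ↭? ys with Any.any? (x Fin.≟_) ys
  ... | no  x∉ys = no (λ p → x∉ys (↭.∈-resp-↭ p (here refl)))
  ... | yes x∈ys with as , bs , refl ← ∈.∈-∃++ x∈ys =
    map′ (λ p → ↭-trans (prep x p) (↭-sym (↭.shift x as bs))) (↭.drop-mid [] as) (xs ↭? as List.++ bs)

  preimage? : ∀ {j m} (w : Vec (Fin n) j) (t : Vec (Fin n) m) → Dec (∃[ u ] Vec.map (lookup w) u ≡ t)
  preimage? w t = any-map? (λ u → Vec.map (lookup w) u ≡ᵛ? t)

  NonConstant : ∀ {m l} → (Fin n → Fin l) → Vec (Fin n) m → Set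
  NonConstant γ t = ∃₂ λ i j → γ (lookup t i) ≢ γ (lookup t j)

  nonConstant? : ∀ {m l} (γ : Fin n → Fin l) (t : Vec (Fin n) m) → Dec (NonConstant γ t)
  nonConstant? γ t = Fin.any? (λ i → Fin.any? (λ j → ¬? (γ (lookup t i) Fin.≟ γ (lookup t j))))

nonConstant-map : ∀ {n p m l} (γ : Fin n → Fin l) (δ : Fin p → Fin l) (f : Fin p → Fin n) (u : Vec (Fin p) m) →
                  (∀ x → γ (f x) ≡ δ x) → NonConstant γ (Vec.map f u) ⇔ NonConstant δ u
nonConstant-map γ δ f u eq = mk⇔
  (λ (i , j , ≢) → i , j , λ e → ≢ (trans (at i) (trans e (sym (at j)))))
  (λ (i , j , ≢) → i , j , λ e → ≢ (trans (sym (at i)) (trans e (at j))))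
  where
  at : ∀ i → γ (lookup (Vec.map f u) i) ≡ δ (lookup u i)
  at i = trans (cong γ (Vec.lookup-map i f u)) (eq (lookup u i))

lower : ∀ {j m} (u : Vec (Fin (suc j)) m) → (∀ i → lookup u i ≢ zero) → ∃[ v ] u ≡ Vec.map suc v
lower []          h = [] , refl
lower (zero ∷ u)  h = contradiction refl (h zero)
lower (suc x ∷ u) h with v , refl ← lower u (h ∘ suc) = x ∷ v , refl

-- Induced structures and overwriting

module _ {ρ : ℕ} {r : Fin ρ → ℕ} where

  holds-resp-≈ : ∀ {n} {M N : Structure r n} → M ≈ N → ∀ {k t} → Holds M k t → Holds N k t
  holds-resp-≈ M≈N {k} {t} = subst T (M≈N k t)

  pull : ∀ {n j} → Structure r n → Vec (Fin n) j → Structure r j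
  pull M w = structure (λ k u → rel M k (Vec.map (lookup w) u))

  tailStructure : ∀ {j} → Structure r (suc j) → Structure r j
  tailStructure D = structure (λ k u → rel D k (Vec.map suc u))

  tail-pull : ∀ {n j} (M : Structure r n) y (a : Vec (Fin n) j) → tailStructure (pull M (y ∷ a)) ≈ pull M a
  tail-pull M y a k u = cong (rel M k) (sym (Vec.map-∘ (lookup (y ∷ a)) suc u))

  overwriteAt : ∀ {n j} → Structure r n → (w : Vec (Fin n) j) → Structure r j →
                ∀ k (t : Vec (Fin n) (r k)) → Dec (∃[ u ] Vec.map (lookup w) u ≡ t) → Bool
  overwriteAt M w D k t (yes (u , _)) = rel D k u
  overwriteAt M w D k t (no _)        = rel M k t

  overwrite : ∀ {n j} → Structure r n → Vec (Fin n) j → Structure r j → Structure r n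
  overwrite M w D = structure (λ k t → overwriteAt M w D k t (preimage? w t))

  overwrite-cong : ∀ {n j} {M N : Structure r n} (w : Vec (Fin n) j) {D E} →
                   M ≈ N → D ≈ E → overwrite M w D ≈ overwrite N w E
  overwrite-cong w M≈N D≈E k t with preimage? w t
  ... | yes (u , _) = D≈E k u
  ... | no _        = M≈N k t

  -- The induced structure `pull M w` is all that overwriting destroys, so at most as many `M` as
  -- there are patterns on `w` become the same structure.
  overwrite-restore : ∀ {n j} (M : Structure r n) (w : Vec (Fin n) j) D →
                      overwrite (overwrite M w D) w (pull M w) ≈ M
  overwrite-restore M w D k t with preimage? w t in eq
  ... | yes (u , refl) = refl
  ... | no _ rewrite eq = refl

  module _ {n j} (w : Vec (Fin n) j) (w! : VecUnique.Unique w) where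

    lookup-w-injective : ∀ {x y} → lookup w x ≡ lookup w y → x ≡ y
    lookup-w-injective = VecUnique.lookup-injective w! _ _

    pull-overwrite : ∀ M D → pull (overwrite M w D) w ≈ D
    pull-overwrite M D k u with preimage? w (Vec.map (lookup w) u)
    ... | yes (v , eq) = cong (rel D k) (map-injective lookup-w-injective v u eq)
    ... | no  ∄u       = contradiction (u , refl) ∄u

  -- An overwritten tuple with entries in `y′ ∷ a` cannot contain `y′`, so it is a tuple over `a`,
  -- and there `D` agrees with `M` already. This is the independence of different candidates.
  pull-overwrite-other : ∀ {n j} M (y y′ : Fin n) (a : Vec (Fin n) j) D →
    VecUnique.Unique (y ∷ a) → VecUnique.Unique (y′ ∷ a) → y′ ≢ y → pull M a ≈ tailStructure D →
    pull (overwrite M (y ∷ a) D) (y′ ∷ a) ≈ pull M (y′ ∷ a)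
  pull-overwrite-other M y y′ a D ya! (y′∉a ∷ _) y′≢y M≈D k u
    with preimage? (y ∷ a) (Vec.map (lookup (y′ ∷ a)) u)
  ... | no _ = refl
  ... | yes (u′ , eq) = begin
    rel D k u′                            ≡⟨ cong (rel D k) u′≡ ⟩
    rel D k (Vec.map suc v)               ≡⟨ M≈D k v ⟨
    rel M k (Vec.map (lookup a) v)        ≡⟨ cong (rel M k) a∘v≡ ⟩
    rel M k (Vec.map (lookup (y′ ∷ a)) u) ∎
    where
    open ≡-Reasoning
    y′∉ : ∀ x → lookup (y ∷ a) x ≢ y′
    y′∉ zero    e = y′≢y (sym e)
    y′∉ (suc x) e = VecAllProperties.lookup⁺ y′∉a x (sym e)
    u≢0 : ∀ i → lookup u i ≢ zero
    u≢0 i ui≡0 = y′∉ (lookup u′ i) (begin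
      lookup (y ∷ a) (lookup u′ i)               ≡⟨ Vec.lookup-map i (lookup (y ∷ a)) u′ ⟨
      lookup (Vec.map (lookup (y ∷ a)) u′) i     ≡⟨ cong (λ t → lookup t i) eq ⟩
      lookup (Vec.map (lookup (y′ ∷ a)) u) i     ≡⟨ Vec.lookup-map i (lookup (y′ ∷ a)) u ⟩
      lookup (y′ ∷ a) (lookup u i)               ≡⟨ cong (lookup (y′ ∷ a)) ui≡0 ⟩
      y′                                         ∎)
    v = proj₁ (lower u u≢0)
    a∘v≡ : Vec.map (lookup a) v ≡ Vec.map (lookup (y′ ∷ a)) u
    a∘v≡ = trans (Vec.map-∘ (lookup (y′ ∷ a)) suc v)
                 (cong (Vec.map (lookup (y′ ∷ a))) (sym (proj₂ (lower u u≢0))))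
    u′≡ : u′ ≡ Vec.map suc v
    u′≡ = map-injective (lookup-w-injective (y ∷ a) ya!) u′ (Vec.map suc v)
      (trans eq (trans (sym a∘v≡) (Vec.map-∘ (lookup (y ∷ a)) suc v)))

  -- The class 𝐂ᴵ with a distinguished colouring

  module _ (I : Subset ρ) where

    ObeysI : ∀ {n} → Structure r n → Set
    ObeysI M = ∀ k → k Subset.∈ I → Irreflexive M k × Symmetric M k

    -- The colouring is a vector, so that pairs can be listed and compared.
    Valid : ∀ {n l} → Structure r n → Vec (Fin l) n → Set
    Valid {l = l} M g = ObeysI M × IsColouring l M (lookup g)

    colouring-resp : ∀ {n l} {M N : Structure r n} (γ δ : Fin n → Fin l) →
                     M ≈ N → γ ≗ δ → IsColouring l M γ → IsColouring l N δ
    colouring-resp {M = M} {N} γ δ M≈N γ≗δ col k t Nt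
      with i , j , ≢ ← col k t (holds-resp-≈ {M = N} {M} (≈-sym {M = M} {N} M≈N) Nt) =
      i , j , λ e → ≢ (trans (γ≗δ _) (trans e (sym (γ≗δ _))))

    obeysI-resp-≈ : ∀ {n} {M N : Structure r n} → M ≈ N → ObeysI M → ObeysI N
    obeysI-resp-≈ {M = M} {N} M≈N obeys k k∈I =
      (λ t Nt → proj₁ (obeys k k∈I) t (from Nt)) ,
      (λ t u t↭u Nt → holds-resp-≈ {M = M} {N} M≈N (proj₂ (obeys k k∈I) t u t↭u (from Nt)))
      where
      from : ∀ {t} → Holds N k t → Holds M k t
      from = holds-resp-≈ {M = N} {M} (≈-sym {M = M} {N} M≈N)

    valid-resp-≈ : ∀ {n l} {M N : Structure r n} {g : Vec (Fin l) n} → M ≈ N → Valid M g → Valid N g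
    valid-resp-≈ {M = M} {N} {g} M≈N (ob , col) =
      obeysI-resp-≈ {M = M} {N} M≈N ob , colouring-resp {M = M} {N} (lookup g) (lookup g) M≈N (λ _ → refl) col

    inC-resp-≈ : ∀ {n l} {M N : Structure r n} → M ≈ N → InC l I M → InC l I N
    inC-resp-≈ {M = M} {N} M≈N ((γ , col) , ob) =
      (γ , colouring-resp {M = M} {N} γ γ M≈N (λ _ → refl) col) , obeysI-resp-≈ {M = M} {N} M≈N ob

    opaque

      obeysI? : ∀ {n} (M : Structure r n) → Dec (ObeysI M)
      obeysI? M = Fin.all? (λ k → (k Subset.∈? I) →-dec
        (all-maps? (λ t → T? (rel M k t) →-dec unique? t) ×-dec
         all-maps? (λ t → all-maps? (λ u → (Vec.toList t ↭? Vec.toList u) →-dec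
           (T? (rel M k t) →-dec T? (rel M k u))))))

      isColouring? : ∀ {n l} (M : Structure r n) (γ : Fin n → Fin l) → Dec (IsColouring l M γ)
      isColouring? M γ = all-positions? r (λ k t → T? (rel M k t) →-dec nonConstant? γ t)

      valid? : ∀ {n l} (M : Structure r n) (g : Vec (Fin l) n) → Dec (Valid M g)
      valid? M g = obeysI? M ×-dec isColouring? M (lookup g)

    inC⇒valid : ∀ {n l} {M : Structure r n} → InC l I M → ∃ (Valid {l = l} M)
    inC⇒valid {M = M} ((γ , col) , ob) =
      Vec.tabulate γ , ob , colouring-resp {M = M} {M} γ _ (λ _ _ → refl) (λ x → sym (Vec.lookup∘tabulate γ x)) col

    valid⇒inC : ∀ {n l} {M : Structure r n} {g : Vec (Fin l) n} → Valid M g → InC l I M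
    valid⇒inC {g = g} (ob , col) = (lookup g , col) , ob

    opaque

      inC? : ∀ {n} l (M : Structure r n) → Dec (InC l I M)
      inC? l M = map′ (λ (g , v) → valid⇒inC {M = M} {g} v) (inC⇒valid {M = M}) (any-map? (valid? M))

    module _ {n j l} (w : Vec (Fin n) j) (w! : VecUnique.Unique w) (g : Vec (Fin l) n) where

      private
        colour : ∀ x → lookup g (lookup w x) ≡ lookup (Vec.map (lookup g) w) x
        colour x = sym (Vec.lookup-map x (lookup g) w)

      pull-valid : ∀ {M} → Valid M g → Valid (pull M w) (Vec.map (lookup g) w)
      pull-valid (ob , col) =
        (λ k k∈I → (λ u Mu → unique-map⁻ u (proj₁ (ob k k∈I) _ Mu)) ,
                   (λ u v u↭v → proj₂ (ob k k∈I) _ _ (map-↭⁺ (lookup w) u v u↭v))) ,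
        (λ k u Mu → Equivalence.to (nonConstant-map (lookup g) (lookup (Vec.map (lookup g) w)) (lookup w) u colour) (col k _ Mu))

      -- Irreflexivity and the colouring condition concern single tuples, and symmetry compares only
      -- tuples with the same entries, which lie all inside or all outside the range of `w`. So the
      -- pattern on `w` can be exchanged freely.
      overwrite-valid : ∀ {M D} → Valid M g → Valid D (Vec.map (lookup g) w) → Valid (overwrite M w D) g
      overwrite-valid {M} {D} (Mob , Mcol) (Dob , Dcol) = (λ k k∈I → irr k k∈I , symm k k∈I) , col
        where
        irr : ∀ k → k Subset.∈ I → Irreflexive (overwrite M w D) k
        irr k k∈I t Ot with preimage? w t
        ... | yes (u , refl) = VecUnique.map⁺ (lookup-w-injective w w!) (proj₁ (Dob k k∈I) u Ot)
        ... | no  _          = proj₁ (Mob k k∈I) t Ot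

        symm : ∀ k → k Subset.∈ I → Symmetric (overwrite M w D) k
        symm k k∈I s t s↭t Os with preimage? w s | preimage? w t
        ... | yes (u , refl) | no ∄v with v , refl , _ ← map-↭⁻ (lookup w) u t s↭t = contradiction (v , refl) ∄v
        ... | no ∄u | yes (v , refl) with u , refl , _ ← map-↭⁻ (lookup w) v s (↭-sym s↭t) = contradiction (u , refl) ∄u
        ... | no _  | no _ = proj₂ (Mob k k∈I) s t s↭t Os
        ... | yes (u , refl) | yes (v , refl)
          with v′ , eq , u↭v′ ← map-↭⁻ (lookup w) u (Vec.map (lookup w) v) s↭t
          with refl ← map-injective (lookup-w-injective w w!) v v′ eq = proj₂ (Dob k k∈I) u v u↭v′ Os

        col : IsColouring l (overwrite M w D) (lookup g)
        col k t Ot with preimage? w t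
        ... | yes (u , refl) = Equivalence.from (nonConstant-map (lookup g) (lookup (Vec.map (lookup g) w)) (lookup w) u colour) (Dcol k u Ot)
        ... | no  _          = Mcol k t Ot

-- Moving a vertex to a smaller colour class

transpose-left : ∀ {n} (x y : Fin n) → Components.transpose x y x ≡ y
transpose-left x y rewrite dec-true (x Fin.≟ x) refl = refl

transpose-fix : ∀ {n} {x y z : Fin n} → z ≢ x → z ≢ y → Components.transpose x y z ≡ z
transpose-fix {x = x} {y} {z} z≢x z≢y rewrite dec-false (z Fin.≟ x) z≢x | dec-false (z Fin.≟ y) z≢y = refl

-- A product of transpositions that pair `xs` with part of `ys`; disjointness keeps them from
-- interfering. A permutation rather than an injection is wanted because `twist` has to be undone.
embedding-permutation : ∀ {n} {xs ys : List (Fin n)} → Unique xs → Unique ys → (∀ {x} → x ∈ xs → x ∉ ys) →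
  length xs ≤ length ys →
  Σ[ π ∈ Permutation′ n ] (∀ {x} → x ∈ xs → π ⟨$⟩ʳ x ∈ ys) × (∀ {x} → x ∉ xs → x ∉ ys → π ⟨$⟩ʳ x ≡ x)
embedding-permutation []  ys! disjoint len = Perm.id , (λ ()) , (λ _ _ → refl)
embedding-permutation {xs = x ∷ xs} {y ∷ ys} (x∉xs ∷ xs!) (y∉ys ∷ ys!) disjoint (s≤s len)
  with π , into , fixes ← embedding-permutation xs! ys! (λ x∈ x∈′ → disjoint (there x∈) (there x∈′)) len =
  π Perm.∘ₚ Perm.transpose x y , into′ , fixes′
  where
  into′ : ∀ {z} → z ∈ x ∷ xs → Components.transpose x y (π ⟨$⟩ʳ z) ∈ y ∷ ys
  into′ (here refl) = here (trans
    (cong (Components.transpose x y) (fixes (λ x∈xs → All.lookup x∉xs x∈xs refl) (disjoint (here refl) ∘ there)))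
    (transpose-left x y))
  into′ {z} (there z∈xs) = subst (_∈ y ∷ ys) (sym (transpose-fix
    (λ πz≡x → disjoint (here refl) (subst (_∈ y ∷ ys) πz≡x (there (into z∈xs))))
    (λ πz≡y → All.lookup y∉ys (into z∈xs) (sym πz≡y)))) (there (into z∈xs))
  fixes′ : ∀ {z} → z ∉ x ∷ xs → z ∉ y ∷ ys → Components.transpose x y (π ⟨$⟩ʳ z) ≡ z
  fixes′ z∉xs z∉ys = trans (cong (Components.transpose x y) (fixes (z∉xs ∘ there) (z∉ys ∘ there)))
                           (transpose-fix (z∉xs ∘ here) (z∉ys ∘ here))

classSize : ∀ {l n} → Vec (Fin l) n → Fin l → ℕ
classSize {n = n} g c = ∑ (allFin n) (λ x → 𝟙 (lookup g x Fin.≟ c))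

∑-allFin≤1 : ∀ {n} (z : Fin n) → ∑ (allFin n) (λ x → 𝟙 (x Fin.≟ z)) ≤ 1
∑-allFin≤1 {n} = ∑-unique≤1 (≡.decSetoid Fin._≟_) (Unique.allFin⁺ n)

length-allFin : ∀ n → length (allFin n) ≡ n
length-allFin n = List.length-tabulate id

classSize-update : ∀ {l n} (g : Vec (Fin l) n) v c → classSize (g [ v ]≔ c) c ≤ suc (classSize g c)
classSize-update {n = n} g v c = begin
  classSize (g [ v ]≔ c) c                                            ≤⟨ ∑-mono (allFin n) pointwise ⟩
  ∑ (allFin n) (λ x → 𝟙 (x Fin.≟ v) + 𝟙 (lookup g x Fin.≟ c))        ≡⟨ ∑-+ (allFin n) _ _ ⟩
  ∑ (allFin n) (λ x → 𝟙 (x Fin.≟ v)) + classSize g c                  ≤⟨ +-monoˡ-≤ _ (∑-allFin≤1 v) ⟩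
  suc (classSize g c)                                                 ∎
  where
  open ≤-Reasoning
  pointwise : ∀ x → 𝟙 (lookup (g [ v ]≔ c) x Fin.≟ c) ≤ 𝟙 (x Fin.≟ v) + 𝟙 (lookup g x Fin.≟ c)
  pointwise x with x Fin.≟ v
  ... | yes _   = ≤-trans (𝟙-mono _ (yes tt) (λ _ → tt)) (m≤m+n 1 _)
  ... | no  x≢v = 𝟙-mono _ (lookup g x Fin.≟ c) (trans (sym (Vec.lookup∘update′ x≢v g c)))

-- The vertices left out lie in at most `l` classes with at most `s` elements each.
most-classes-larger : ∀ {l n} (g : Vec (Fin l) n) s →
  n ≤ ∑ (allFin n) (λ v → 𝟙 (s <? classSize g (lookup g v))) + l * s
most-classes-larger {l} {n} g s = begin
  n                                                 ≡⟨ length-allFin n ⟨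
  length (allFin n)                                 ≡⟨ *-identityʳ _ ⟨
  length (allFin n) * 1                             ≡⟨ ∑-const (allFin n) 1 ⟨
  ∑ (allFin n) (λ _ → 1)                            ≤⟨ ∑-mono (allFin n) dichotomy ⟩
  ∑ (allFin n) (λ v → large v + ∑ (allFin l) (small v)) ≡⟨ ∑-+ (allFin n) large _ ⟩
  ∑ (allFin n) large + ∑ (allFin n) (λ v → ∑ (allFin l) (small v))
    ≡⟨ cong (∑ (allFin n) large +_) (∑-swap (allFin n) (allFin l) small) ⟩
  ∑ (allFin n) large + ∑ (allFin l) (λ c → ∑ (allFin n) (λ v → small v c))
    ≤⟨ +-monoʳ-≤ (∑ (allFin n) large) (∑-mono (allFin l) smallClass) ⟩
  ∑ (allFin n) large + ∑ (allFin l) (λ _ → s)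
    ≡⟨ cong (∑ (allFin n) large +_) (trans (∑-const (allFin l) s) (cong (_* s) (length-allFin l))) ⟩
  ∑ (allFin n) large + l * s                        ∎
  where
  open ≤-Reasoning
  large : Fin n → ℕ
  large v = 𝟙 (s <? classSize g (lookup g v))
  small : Fin n → Fin l → ℕ
  small v c = 𝟙 (lookup g v Fin.≟ c) * 𝟙 (classSize g c ≤? s)
  dichotomy : ∀ v → 1 ≤ large v + ∑ (allFin l) (small v)
  dichotomy v with s <? classSize g (lookup g v)
  ... | yes _  = s≤s z≤n
  ... | no s≮c = ≤-trans
    (≤-reflexive (sym (cong₂ _*_ (𝟙-yes (lookup g v Fin.≟ lookup g v) refl)
                                 (𝟙-yes (classSize g (lookup g v) ≤? s) (≮⇒≥ s≮c)))))
    (term≤∑ (small v) (∈-allFin (lookup g v)))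
  smallClass : ∀ c → ∑ (allFin n) (λ v → small v c) ≤ s
  smallClass c = begin
    ∑ (allFin n) (λ v → small v c)               ≡⟨ ∑-*ʳ (allFin n) (𝟙 (classSize g c ≤? s)) _ ⟩
    classSize g c * 𝟙 (classSize g c ≤? s)       ≡⟨ *-comm (classSize g c) _ ⟩
    𝟙 (classSize g c ≤? s) * classSize g c       ≤⟨ 𝟙*-≤ (classSize g c ≤? s) id ⟩
    s                                            ∎

module _ {n : ℕ} where

  _∈ᵗ?_ : ∀ {m} (v : Fin n) (t : Vec (Fin n) m) → Dec (v ∈ Vec.toList t)
  v ∈ᵗ? t = Any.any? (v Fin.≟_) (Vec.toList t)

  lookup∈toList : ∀ {m} (t : Vec (Fin n) m) i → lookup t i ∈ Vec.toList t
  lookup∈toList t i = ∈ᵥ.∈-toList⁺ (∈ᵥ.∈-lookup i t)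

  toList∈⇒lookup : ∀ {m v} (t : Vec (Fin n) m) → v ∈ Vec.toList t → ∃[ i ] lookup t i ≡ v
  toList∈⇒lookup (x ∷ t) (here refl) = zero , refl
  toList∈⇒lookup (x ∷ t) (there v∈t) with i , eq ← toList∈⇒lookup t v∈t = suc i , eq

  ∈-map-fixed : ∀ {m} {v} (f : Fin n → Fin n) → f v ≡ v → (t : Vec (Fin n) m) →
                v ∈ Vec.toList t → v ∈ Vec.toList (Vec.map f t)
  ∈-map-fixed {v = v} f fv≡v t v∈t =
    subst₂ _∈_ fv≡v (sym (Vec.toList-map f t)) (∈.∈-map⁺ f v∈t)

module _ {ρ : ℕ} {r : Fin ρ → ℕ} where

  module _ {n : ℕ} where

    -- For a permutation f fixing v and sending the class of c into the class of v, this turns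
    -- structures coloured by g into structures coloured by g [ v ]≔ c, without loss of information.
    twist : (Fin n → Fin n) → Fin n → Structure r n → Structure r n
    twist f v M = structure (λ k t → if does (v ∈ᵗ? t) then rel M k (Vec.map f t) else rel M k t)

    twist-cong : ∀ f v {M N} → M ≈ N → twist f v M ≈ twist f v N
    twist-cong f v M≈N k t with does (v ∈ᵗ? t)
    ... | true  = M≈N k _
    ... | false = M≈N k t

    -- Since `f⁻` fixes `v`, it maps tuples containing `v` to tuples containing `v`, so both twists
    -- take the same branch.
    twist-restore : ∀ {f f⁻} v M → f⁻ v ≡ v → (∀ x → f (f⁻ x) ≡ x) → twist f⁻ v (twist f v M) ≈ M
    twist-restore {f} {f⁻} v M f⁻v≡v inv k t with v ∈ᵗ? t
    ... | no  _   = refl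
    ... | yes v∈t
      rewrite dec-true (v ∈ᵗ? Vec.map f⁻ t) (∈-map-fixed f⁻ f⁻v≡v t v∈t) =
      cong (rel M k) (trans (sym (Vec.map-∘ f f⁻ t)) (trans (Vec.map-cong inv t) (Vec.map-id t)))

    module _ (I : Subset ρ) {l} (g : Vec (Fin l) n) (v : Fin n) (c : Fin l) where

      -- If a tuple containing `v` is monochromatic after the move, its entries other than `v` had
      -- colour `c` before. Then `f` sends all its entries into the old class of `v`, and `M`
      -- excludes this image. The colours in a tuple without `v` do not change.
      twist-valid : ∀ {f} M → f v ≡ v → (∀ {x} → lookup g x ≡ c → lookup g (f x) ≡ lookup g v) →
                    Valid I M g → Valid I (twist f v M) (g [ v ]≔ c)
      twist-valid {f} M fv≡v f-class (ob , col) = (λ k k∈I → irr k k∈I , symm k k∈I) , col′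
        where
        irr : ∀ k → k Subset.∈ I → Irreflexive (twist f v M) k
        irr k k∈I t h with v ∈ᵗ? t
        ... | yes _ = unique-map⁻ t (proj₁ (ob k k∈I) _ h)
        ... | no  _ = proj₁ (ob k k∈I) t h

        symm : ∀ k → k Subset.∈ I → Symmetric (twist f v M) k
        symm k k∈I t u t↭u h with v ∈ᵗ? t | v ∈ᵗ? u
        ... | yes _   | yes _   = proj₂ (ob k k∈I) _ _ (map-↭⁺ f t u t↭u) h
        ... | no _    | no _    = proj₂ (ob k k∈I) t u t↭u h
        ... | yes v∈t | no v∉u  = contradiction (↭.∈-resp-↭ t↭u v∈t) v∉u
        ... | no v∉t  | yes v∈u = contradiction (↭.∈-resp-↭ (↭-sym t↭u) v∈u) v∉t

        moved : Vec (Fin l) n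
        moved = g [ v ]≔ c

        col′ : IsColouring l (twist f v M) (lookup moved)
        col′ k t h with v ∈ᵗ? t
        ... | no v∉t with i , j , ≢ ← col k t h =
          i , j , λ e → ≢ (trans (sym (same i)) (trans e (same j)))
          where
          same : ∀ i → lookup moved (lookup t i) ≡ lookup g (lookup t i)
          same i = Vec.lookup∘update′ (λ { refl → v∉t (lookup∈toList t i) }) g c
        ... | yes v∈t = decidable-stable (nonConstant? (lookup moved) t) (λ constant →
          let i , j , ≢ = col k (Vec.map f t) h
          in ≢ (trans (toClassOfV constant i) (sym (toClassOfV constant j))))
          where
          toClassOfV : ¬ NonConstant (lookup moved) t → ∀ i →
                       lookup g (lookup (Vec.map f t) i) ≡ lookup g v
          toClassOfV constant i rewrite Vec.lookup-map i f t with lookup t i Fin.≟ v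
          ... | yes ti≡v rewrite ti≡v = cong (lookup g) fv≡v
          ... | no  ti≢v = f-class (begin
            lookup g (lookup t i)      ≡⟨ Vec.lookup∘update′ ti≢v g c ⟨
            lookup moved (lookup t i)  ≡⟨ decidable-stable (_ Fin.≟ _) (λ ≢ → constant (i , a , ≢)) ⟩
            lookup moved (lookup t a)  ≡⟨ cong (lookup moved) ta≡v ⟩
            lookup moved v             ≡⟨ Vec.lookup∘update v g c ⟩
            c                          ∎)
            where
            open ≡-Reasoning
            a = proj₁ (toList∈⇒lookup t v∈t)
            ta≡v = proj₂ (toList∈⇒lookup t v∈t)

  module _ (I : Subset ρ) where

    validCount : ∀ {n l} → Vec (Fin l) n → ℕ
    validCount {n} g = ∑ (structures r n) (λ M → 𝟙 (valid? I M g))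

    -- The smaller class `c` fits into the class of `v` with `v` removed, and a permutation
    -- realising this gives an invertible twist.
    validCount-move : ∀ {n l} (g : Vec (Fin l) n) v c → classSize g c < classSize g (lookup g v) →
                      validCount g ≤ validCount (g [ v ]≔ c)
    validCount-move {n} g v c smaller =
      ∑-cover (structureDecSetoid r n) (structures-unique r n) (structures r n) (twist (π ⟨$⟩ˡ_) v) cover
      where
      inClass? = λ x → lookup g x Fin.≟ c
      inV? = λ x → (lookup g x Fin.≟ lookup g v) ×-dec ¬? (x Fin.≟ v)
      xs = filter inClass? (allFin n)
      ys = filter inV? (allFin n)

      ∈xs⇒ : ∀ {x} → x ∈ xs → lookup g x ≡ c
      ∈xs⇒ x∈ = proj₂ (∈.∈-filter⁻ inClass? {xs = allFin n} x∈)
      ∈ys⇒ : ∀ {x} → x ∈ ys → lookup g x ≡ lookup g v × x ≢ v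
      ∈ys⇒ x∈ = proj₂ (∈.∈-filter⁻ inV? {xs = allFin n} x∈)
      gv≢c : lookup g v ≢ c
      gv≢c e = <⇒≢ smaller (cong (classSize g) (sym e))

      open ≤-Reasoning
      -- The strictness of `smaller` pays for the removal of `v` from its own class.
      lengths : length xs ≤ length ys
      lengths = s≤s⁻¹ (begin
        suc (length xs)              ≡⟨ cong suc (length-filter≡∑ inClass? (allFin n)) ⟩
        suc (classSize g c)          ≤⟨ smaller ⟩
        classSize g (lookup g v)     ≤⟨ ∑-mono (allFin n) pointwise ⟩
        ∑ (allFin n) (λ x → 𝟙 (x Fin.≟ v) + 𝟙 (inV? x))                    ≡⟨ ∑-+ (allFin n) _ _ ⟩
        ∑ (allFin n) (λ x → 𝟙 (x Fin.≟ v)) + ∑ (allFin n) (λ x → 𝟙 (inV? x)) ≤⟨ +-monoˡ-≤ _ (∑-allFin≤1 v) ⟩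
        suc (∑ (allFin n) (λ x → 𝟙 (inV? x)))  ≡⟨ cong suc (length-filter≡∑ inV? (allFin n)) ⟨
        suc (length ys)              ∎)
        where
        pointwise : ∀ x → 𝟙 (lookup g x Fin.≟ lookup g v) ≤ 𝟙 (x Fin.≟ v) + 𝟙 (inV? x)
        pointwise x with x Fin.≟ v
        ... | yes _   = ≤-trans (𝟙-mono (lookup g x Fin.≟ lookup g v) (yes tt) (λ _ → tt)) (m≤m+n 1 _)
        ... | no  x≢v = 𝟙-mono (lookup g x Fin.≟ lookup g v) ((lookup g x Fin.≟ lookup g v) ×-dec (yes x≢v)) (_, x≢v)

      permutation = embedding-permutation (Unique.filter⁺ inClass? (Unique.allFin⁺ n)) (Unique.filter⁺ inV? (Unique.allFin⁺ n))
        (λ x∈xs x∈ys → gv≢c (trans (sym (proj₁ (∈ys⇒ x∈ys))) (∈xs⇒ x∈xs))) lengths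
      π = proj₁ permutation
      into : ∀ {x} → lookup g x ≡ c → lookup g (π ⟨$⟩ʳ x) ≡ lookup g v
      into gx≡c = proj₁ (∈ys⇒ (proj₁ (proj₂ permutation) (∈.∈-filter⁺ inClass? (∈-allFin _) gx≡c)))
      πv≡v : π ⟨$⟩ʳ v ≡ v
      πv≡v = proj₂ (proj₂ permutation) (gv≢c ∘ ∈xs⇒) (λ v∈ys → proj₂ (∈ys⇒ v∈ys) refl)
      π⁻v≡v : π ⟨$⟩ˡ v ≡ v
      π⁻v≡v = trans (cong (π ⟨$⟩ˡ_) (sym πv≡v)) (Perm.inverseˡ π)

      cover : ∀ M → 0 < 𝟙 (valid? I M g) → ∃[ N ] N ∈ structures r n ×
              M ≈ twist (π ⟨$⟩ˡ_) v N × 𝟙 (valid? I M g) ≤ 𝟙 (valid? I N (g [ v ]≔ c))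
      cover M pos with N , N∈ , M′≈N ← represent r n (twist (π ⟨$⟩ʳ_) v M) =
        N , N∈ ,
        (λ k t → trans (sym (twist-restore v M π⁻v≡v (λ _ → Perm.inverseʳ π) k t))
                       (twist-cong (π ⟨$⟩ˡ_) v {twist (π ⟨$⟩ʳ_) v M} {N} M′≈N k t)) ,
        𝟙-mono (valid? I M g) (valid? I N (g [ v ]≔ c))
          (λ valid → valid-resp-≈ I {M = twist (π ⟨$⟩ʳ_) v M} {N} {g [ v ]≔ c} M′≈N
                       (twist-valid I g v c M πv≡v into valid))

    totalCount : ℕ → ℕ → ℕ
    totalCount l n = ∑ (maps l n) validCount

    smallClassCount : ∀ {l} → ℕ → ℕ → Fin l → ℕ
    smallClassCount {l} n s c = ∑ (maps l n) (λ g → 𝟙 (classSize g c ≤? s) * validCount g)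

    -- Double counting of the moves of a vertex `v` into class `c`. At least `n ∸ l * s` vertices
    -- lie in a larger class. A resulting colouring arises at most `l * suc s` times, as `v` is one
    -- of the at most `suc s` elements of the enlarged class and had one of `l` colours before.
    few-small-classes : ∀ {l} n s (c : Fin l) →
      (n ∸ l * s) * smallClassCount n s c ≤ l * suc s * totalCount l n
    few-small-classes {l} n s c = begin
      (n ∸ l * s) * smallClassCount n s c                       ≡⟨ ∑-*ˡ (maps l n) (n ∸ l * s) _ ⟨
      ∑ (maps l n) (λ g → (n ∸ l * s) * (𝟙 (classSize g c ≤? s) * validCount g))
                                                                ≤⟨ ∑-mono (maps l n) moves ⟩
      ∑ (maps l n) (λ g → ∑ (allFin n) (before g))              ≡⟨ ∑-swap (maps l n) (allFin n) before ⟩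
      ∑ (allFin n) (λ v → ∑ (maps l n) (λ g → before g v))      ≤⟨ ∑-mono (allFin n) moveVertex ⟩
      ∑ (allFin n) (λ v → ∑ (maps l n) (λ g → l * after g v))   ≡⟨ ∑-swap (allFin n) (maps l n) _ ⟩
      ∑ (maps l n) (λ g → ∑ (allFin n) (λ v → l * after g v))   ≤⟨ ∑-mono (maps l n) fewVertices ⟩
      ∑ (maps l n) (λ g → l * suc s * validCount g)             ≡⟨ ∑-*ˡ (maps l n) (l * suc s) validCount ⟩
      l * suc s * totalCount l n                                ∎
      where
      open ≤-Reasoning
      before after : Vec (Fin l) n → Fin n → ℕ
      before g v = 𝟙 (classSize g c ≤? s) * (𝟙 (classSize g c <? classSize g (lookup g v)) * validCount g)
      after g v = 𝟙 (lookup g v Fin.≟ c) * (𝟙 (classSize g c ≤? suc s) * validCount g)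

      moves : ∀ g → (n ∸ l * s) * (𝟙 (classSize g c ≤? s) * validCount g) ≤ ∑ (allFin n) (before g)
      moves g = begin
        (n ∸ l * s) * (small * validCount g)   ≡⟨ reorder (n ∸ l * s) small (validCount g) ⟩
        small * ((n ∸ l * s) * validCount g)   ≤⟨ *-monoʳ-≤′ (classSize g c ≤? s) (λ size≤s → *-monoˡ-≤ (validCount g) (bound size≤s)) ⟩
        small * (∑ (allFin n) large * validCount g) ≡⟨ cong (small *_) (∑-*ʳ (allFin n) (validCount g) large) ⟨
        small * ∑ (allFin n) (λ v → large v * validCount g) ≡⟨ ∑-*ˡ (allFin n) small _ ⟨
        ∑ (allFin n) (before g)                ∎
        where
        small = 𝟙 (classSize g c ≤? s)
        large : Fin n → ℕ
        large v = 𝟙 (classSize g c <? classSize g (lookup g v))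
        reorder : ∀ a b c → a * (b * c) ≡ b * (a * c)
        reorder = solve-∀
        *-monoʳ-≤′ : ∀ {P : Set} (d : Dec P) {x y} → (P → x ≤ y) → 𝟙 d * x ≤ 𝟙 d * y
        *-monoʳ-≤′ (yes p) x≤y = *-monoʳ-≤ 1 (x≤y p)
        *-monoʳ-≤′ (no _)  _   = z≤n
        -- The threshold is the size of class `c` itself, not `s`, because a move has to start in a
        -- class strictly larger than `c`.
        bound : classSize g c ≤ s → n ∸ l * s ≤ ∑ (allFin n) large
        bound size≤s = begin
          n ∸ l * s                 ≤⟨ ∸-monoʳ-≤ n (*-monoʳ-≤ l size≤s) ⟩
          n ∸ l * classSize g c     ≤⟨ m≤n+o⇒m∸n≤o n (l * classSize g c)
                                        (≤-trans (most-classes-larger g (classSize g c)) (≤-reflexive (+-comm _ (l * classSize g c)))) ⟩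
          ∑ (allFin n) large        ∎

      moveVertex : ∀ v → ∑ (maps l n) (λ g → before g v) ≤ ∑ (maps l n) (λ g → l * after g v)
      moveVertex v = begin
        ∑ (maps l n) (λ g → before g v)
          ≤⟨ ∑-cover (mapDecSetoid l n) (maps-unique l n) (cartesianProduct (maps l n) (allFin l))
               (λ (g , d) → g [ v ]≔ d) cover ⟩
        ∑ (cartesianProduct (maps l n) (allFin l)) (λ (g , d) → after g v)
          ≡⟨ ∑-cartesianProduct (maps l n) (allFin l) _ ⟩
        ∑ (maps l n) (λ g → ∑ (allFin l) (λ _ → after g v))
          ≡⟨ ∑-cong (maps l n) (λ g → trans (∑-const (allFin l) (after g v)) (cong (_* after g v) (length-allFin l))) ⟩
        ∑ (maps l n) (λ g → l * after g v) ∎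
        where
        cover : ∀ g → 0 < before g v → ∃[ y ] y ∈ cartesianProduct (maps l n) (allFin l) ×
                g ≡ proj₁ y [ v ]≔ proj₂ y × before g v ≤ after (proj₁ y) v
        cover g pos =
          -- The new colouring together with the former colour of `v` determines `g`.
          (g [ v ]≔ c , lookup g v) , ∈.∈-cartesianProduct⁺ (∈-maps _) (∈-allFin _) ,
          sym (trans (Vec.[]≔-idempotent g v) (Vec.[]≔-lookup g v)) ,
          𝟙*-≤ (classSize g c ≤? s) (λ size≤s →
            𝟙*-≤ (classSize g c <? classSize g (lookup g v)) (λ smaller → begin
              validCount g               ≤⟨ validCount-move g v c smaller ⟩
              validCount (g [ v ]≔ c)    ≡⟨ trans (*-identityˡ _) (*-identityˡ _) ⟨
              1 * (1 * validCount (g [ v ]≔ c))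
                ≡⟨ cong₂ (λ a b → a * (b * validCount (g [ v ]≔ c)))
                     (𝟙-yes (lookup (g [ v ]≔ c) v Fin.≟ c) (Vec.lookup∘update v g c))
                     (𝟙-yes (classSize (g [ v ]≔ c) c ≤? suc s) (≤-trans (classSize-update g v c) (s≤s size≤s))) ⟨
              after (g [ v ]≔ c) v       ∎))

      fewVertices : ∀ g → ∑ (allFin n) (λ v → l * after g v) ≤ l * suc s * validCount g
      fewVertices g = begin
        ∑ (allFin n) (λ v → l * after g v)        ≡⟨ ∑-*ˡ (allFin n) l (after g) ⟩
        l * ∑ (allFin n) (after g)                ≡⟨ cong (l *_) (∑-*ʳ (allFin n) _ _) ⟩
        l * (classSize g c * (𝟙 (classSize g c ≤? suc s) * validCount g))
          ≡⟨ cong (l *_) (reorder (classSize g c) (𝟙 (classSize g c ≤? suc s)) (validCount g)) ⟩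
        l * (𝟙 (classSize g c ≤? suc s) * (classSize g c * validCount g))
          ≤⟨ *-monoʳ-≤ l (𝟙*-≤ (classSize g c ≤? suc s) (*-monoˡ-≤ (validCount g))) ⟩
        l * (suc s * validCount g)                ≡⟨ *-assoc l (suc s) (validCount g) ⟨
        l * suc s * validCount g                  ∎
        where
        reorder : ∀ a b c → a * (b * c) ≡ b * (a * c)
        reorder = solve-∀

-- Failures of one-point extension

-- The integer form of `(1 - 1/(q+1))^(q+1) ≤ 1/2`, from the first two terms of the binomial
-- expansion of `(q+1)^(q+1)`.
2*^-decay : ∀ q → 2 * q ^ suc q ≤ suc q ^ suc q
2*^-decay q = ≤-trans (≤-reflexive (lemma (q ^ suc q)))
  (≤-trans (+-monoʳ-≤ (q ^ suc q) (m≤n+m (q ^ suc q) (q ^ q))) (bernoulli (suc q) q))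
  where
  lemma : ∀ a → 2 * a ≡ a + a
  lemma = solve-∀
  bernoulli : ∀ c q → q ^ c + c * q ^ pred c ≤ suc q ^ c
  bernoulli zero    q = ≤-refl
  bernoulli (suc c) q = begin
    q * q ^ c + (q ^ c + c * q ^ c)             ≤⟨ +-monoʳ-≤ (q * q ^ c) (+-monoʳ-≤ (q ^ c) (step c)) ⟩
    q * q ^ c + (q ^ c + q * (c * q ^ pred c))  ≤⟨ +-monoʳ-≤ (q * q ^ c) (+-monoʳ-≤ (q ^ c) (m≤n+m _ (c * q ^ pred c))) ⟩
    q * q ^ c + (q ^ c + (c * q ^ pred c + q * (c * q ^ pred c)))
                                                ≡⟨ rearrange q (q ^ c) (c * q ^ pred c) ⟩
    suc q * (q ^ c + c * q ^ pred c)            ≤⟨ *-monoʳ-≤ (suc q) (bernoulli c q) ⟩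
    suc q * suc q ^ c                           ∎
    where
    open ≤-Reasoning
    rearrange : ∀ q a b → q * a + (a + (b + q * b)) ≡ suc q * (a + b)
    rearrange = solve-∀
    swapped : ∀ c q a → (1 + c) * (q * a) ≡ q * ((1 + c) * a)
    swapped = solve-∀
    step : ∀ c → c * q ^ c ≤ q * (c * q ^ pred c)
    step zero    = z≤n
    step (suc c) = ≤-reflexive (swapped c q (q ^ c))

-- Every block of `suc q` factors halves the ratio, so `S` blocks outweigh `K`; the remaining `u`
-- factors do no harm.
geometric-decay : ∀ q S t K → K ≤ 2 ^ S → suc q * S ≤ t → K * q ^ t ≤ suc q ^ t
geometric-decay q S t K K≤2^S S≤t with u , refl ← m≤n⇒∃[o]m+o≡n S≤t = begin
  K * q ^ (suc q * S + u)                   ≡⟨ cong (K *_) (^-distribˡ-+-* q (suc q * S) u) ⟩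
  K * (q ^ (suc q * S) * q ^ u)             ≤⟨ *-monoˡ-≤ (q ^ (suc q * S) * q ^ u) K≤2^S ⟩
  2 ^ S * (q ^ (suc q * S) * q ^ u)         ≡⟨ *-assoc (2 ^ S) _ _ ⟨
  2 ^ S * q ^ (suc q * S) * q ^ u           ≤⟨ *-mono-≤ (halving S) (^-monoˡ-≤ u (n≤1+n q)) ⟩
  suc q ^ (suc q * S) * suc q ^ u           ≡⟨ ^-distribˡ-+-* (suc q) (suc q * S) u ⟨
  suc q ^ (suc q * S + u)                   ∎
  where
  open ≤-Reasoning
  rearrange : ∀ a b c → 2 * a * (b * c) ≡ (2 * b) * (a * c)
  rearrange = solve-∀
  halving : ∀ S → 2 ^ S * q ^ (suc q * S) ≤ suc q ^ (suc q * S)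
  halving zero    rewrite *-zeroʳ q = ≤-refl
  halving (suc S) = begin
    2 * 2 ^ S * q ^ (suc q * suc S)              ≡⟨ cong (λ e → 2 * 2 ^ S * q ^ e) (*-suc (suc q) S) ⟩
    2 * 2 ^ S * q ^ (suc q + suc q * S)          ≡⟨ cong (2 * 2 ^ S *_) (^-distribˡ-+-* q (suc q) (suc q * S)) ⟩
    2 * 2 ^ S * (q ^ suc q * q ^ (suc q * S))    ≡⟨ rearrange (2 ^ S) (q ^ suc q) (q ^ (suc q * S)) ⟩
    2 * q ^ suc q * (2 ^ S * q ^ (suc q * S))    ≤⟨ *-mono-≤ (2*^-decay q) (halving S) ⟩
    suc q ^ suc q * suc q ^ (suc q * S)          ≡⟨ ^-distribˡ-+-* (suc q) (suc q) (suc q * S) ⟨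
    suc q ^ (suc q + suc q * S)                  ≡⟨ cong (suc q ^_) (*-suc (suc q) S) ⟨
    suc q ^ (suc q * suc S)                      ∎

module _ {ρ : ℕ} {r : Fin ρ → ℕ} (I : Subset ρ) where

  module _ {n l j} (M : Structure r n) (g : Vec (Fin l) n) (D : Structure r (suc j)) (c : Fin l)
           (a : Vec (Fin n) j) where

    -- A one-point extension problem: `D` prescribes the relations between `a` and a new point of
    -- colour `c`, which has index zero. The three conditions say that the problem is consistent
    -- with `M` and `g`.
    Extendible : Set
    Extendible = Valid I D (c ∷ Vec.map (lookup g) a) × VecUnique.Unique a × pull M a ≈ tailStructure D

    Candidate : Fin n → Set
    Candidate y = lookup g y ≡ c × VecAll.All (y ≢_) a

    Witness : Fin n → Set
    Witness y = Candidate y × pull M (y ∷ a) ≈ D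

    Fails : Set
    Fails = Extendible × ¬ ∃ Witness

    candidate? : ∀ y → Dec (Candidate y)
    candidate? y = (lookup g y Fin.≟ c) ×-dec VecAll.all? (λ x → ¬? (y Fin.≟ x)) a

    witness? : ∀ y → Dec (Witness y)
    witness? y = candidate? y ×-dec (pull M (y ∷ a) ≈? D)

    opaque

      fails? : Dec Fails
      fails? = (valid? I D (c ∷ Vec.map (lookup g) a) ×-dec unique? a ×-dec (pull M a ≈? tailStructure D))
               ×-dec ¬? (Fin.any? witness?)

  module _ {n l j} (g : Vec (Fin l) n) (D : Structure r (suc j)) (c : Fin l) (a : Vec (Fin n) j)
           (D-valid : Valid I D (c ∷ Vec.map (lookup g) a)) (a! : VecUnique.Unique a) where

    -- Failure relative to a list of candidates, so that the candidates can be taken into account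
    -- one by one.
    Avoids : List (Fin n) → Structure r n → Set
    Avoids Y M = Valid I M g × pull M a ≈ tailStructure D × All (λ y → ¬ (pull M (y ∷ a) ≈ D)) Y

    opaque

      avoids? : ∀ Y M → Dec (Avoids Y M)
      avoids? Y M = valid? I M g ×-dec (pull M a ≈? tailStructure D) ×-dec All.all? (λ y → ¬? (pull M (y ∷ a) ≈? D)) Y

    avoids-resp-≈ : ∀ Y {M N} → M ≈ N → Avoids Y M → Avoids Y N
    avoids-resp-≈ Y {M} {N} M≈N (valid , M≈D , avoid) =
      valid-resp-≈ I {M = M} {N} {g} M≈N valid ,
      (λ k u → trans (sym (M≈N k _)) (M≈D k u)) ,
      All.map (λ {y} ≉ N≈D → ≉ (λ k u → trans (M≈N k _) (N≈D k u))) avoid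

    avoidCount : List (Fin n) → ℕ
    avoidCount Y = ∑ (structures r n) (λ M → 𝟙 (avoids? Y M))

    patternCount : ℕ
    patternCount = length (structures r (suc j))

    -- Overwriting M by D along y ∷ a does not affect the other elements of Y and is undone by
    -- the induced structure pull M (y ∷ a), so y is a witness for at least 1 / patternCount of all M.
    avoidCount-step : ∀ y Y → lookup g y ≡ c → VecAll.All (y ≢_) a → All (y ≢_) Y →
      All (λ y′ → VecAll.All (y′ ≢_) a) Y → patternCount * avoidCount (y ∷ Y) + avoidCount Y ≤ patternCount * avoidCount Y
    avoidCount-step y Y gy≡c y∉a y∉Y Y∉a = begin
      patternCount * avoidCount (y ∷ Y) + avoidCount Y    ≤⟨ +-monoʳ-≤ (patternCount * avoidCount (y ∷ Y)) many ⟩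
      patternCount * avoidCount (y ∷ Y) + patternCount * hits        ≡⟨ *-distribˡ-+ patternCount (avoidCount (y ∷ Y)) hits ⟨
      patternCount * (avoidCount (y ∷ Y) + hits)          ≡⟨ cong (patternCount *_) split ⟨
      patternCount * avoidCount Y                         ∎
      where
      open ≤-Reasoning
      ya! : VecUnique.Unique (y ∷ a)
      ya! = y∉a ∷ a!
      Hit : Structure r n → Set
      Hit M = Avoids Y M × pull M (y ∷ a) ≈ D
      hit? : ∀ M → Dec (Hit M)
      hit? M = avoids? Y M ×-dec (pull M (y ∷ a) ≈? D)
      hits : ℕ
      hits = ∑ (structures r n) (λ M → 𝟙 (hit? M))

      split : avoidCount Y ≡ avoidCount (y ∷ Y) + hits
      split = trans (∑-cong (structures r n) (λ M →
          trans (𝟙-split (avoids? Y M) (pull M (y ∷ a) ≈? D) (hit? M) (avoids? Y M ×-dec ¬? (pull M (y ∷ a) ≈? D)))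
         (trans (+-comm (𝟙 (hit? M)) _)
                (cong (_+ 𝟙 (hit? M)) (≤-antisym
                  (𝟙-mono (avoids? Y M ×-dec ¬? (pull M (y ∷ a) ≈? D)) (avoids? (y ∷ Y) M)
                          (λ ((v , t , avoid) , miss) → v , t , miss ∷ avoid))
                  (𝟙-mono (avoids? (y ∷ Y) M) (avoids? Y M ×-dec ¬? (pull M (y ∷ a) ≈? D))
                          (λ { (v , t , miss ∷ avoid) → (v , t , avoid) , miss })))))))
        (∑-+ (structures r n) _ _)

      overwritten : ∀ {M} → Avoids Y M → Hit (overwrite M (y ∷ a) D)
      overwritten {M} (valid , M≈D , avoid) =
        ( overwrite-valid I (y ∷ a) ya! g {M} {D} valid
            (subst (λ d → Valid I D (d ∷ Vec.map (lookup g) a)) (sym gy≡c) D-valid)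
        , (λ k u → trans (sym (tail-pull (overwrite M (y ∷ a) D) y a k u)) (hit k (Vec.map suc u)))
        , All.tabulate (λ {y′} y′∈Y O≈D → All.lookup avoid y′∈Y (λ k u →
            trans (sym (pull-overwrite-other M y y′ a D ya! (All.lookup Y∉a y′∈Y ∷ a!)
                          (λ y′≡y → All.lookup y∉Y y′∈Y (sym y′≡y)) M≈D k u))
                  (O≈D k u)))
        ) , hit
        where
        hit : pull (overwrite M (y ∷ a) D) (y ∷ a) ≈ D
        hit = pull-overwrite (y ∷ a) ya! M D

      many : avoidCount Y ≤ patternCount * hits
      many = begin
        avoidCount Y
          ≤⟨ ∑-cover (structureDecSetoid r n) (structures-unique r n)
               (cartesianProduct (structures r (suc j)) (structures r n)) (λ (E , N) → overwrite N (y ∷ a) E) cover ⟩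
        ∑ (cartesianProduct (structures r (suc j)) (structures r n)) (λ (E , N) → 𝟙 (hit? N))
          ≡⟨ ∑-cartesianProduct (structures r (suc j)) (structures r n) _ ⟩
        ∑ (structures r (suc j)) (λ _ → hits)   ≡⟨ ∑-const (structures r (suc j)) hits ⟩
        patternCount * hits                                ∎
        where
        cover : ∀ M → 0 < 𝟙 (avoids? Y M) → ∃[ z ] z ∈ cartesianProduct (structures r (suc j)) (structures r n) ×
                M ≈ overwrite (proj₂ z) (y ∷ a) (proj₁ z) × 𝟙 (avoids? Y M) ≤ 𝟙 (hit? (proj₂ z))
        cover M pos
          with E , E∈ , M≈E ← represent r (suc j) (pull M (y ∷ a))
          with N , N∈ , O≈N ← represent r n (overwrite M (y ∷ a) D) =
          (E , N) , ∈.∈-cartesianProduct⁺ E∈ N∈ ,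
          (λ k t → trans (sym (overwrite-restore M (y ∷ a) D k t))
                         (overwrite-cong {M = overwrite M (y ∷ a) D} {N} (y ∷ a) O≈N M≈E k t)) ,
          𝟙-mono (avoids? Y M) (hit? N) (λ avoid →
            let avoid′ , hit = overwritten avoid in
            avoids-resp-≈ Y {overwrite M (y ∷ a) D} {N} O≈N avoid′ ,
            (λ k u → trans (sym (O≈N k _)) (hit k u)))

    -- Each further candidate contributes a factor of at most `1 - 1 / patternCount`, whatever the
    -- relations at the other candidates are.
    avoidCount-decay : ∀ Y → Unique Y → All (λ y → lookup g y ≡ c × VecAll.All (y ≢_) a) Y →
      patternCount ^ length Y * avoidCount Y ≤ pred patternCount ^ length Y * validCount {r = r} I g
    avoidCount-decay []      _            _ = *-monoʳ-≤ 1 (∑-mono (structures r n)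
      (λ M → 𝟙-mono (avoids? [] M) (valid? I M g) proj₁))
    avoidCount-decay (y ∷ Y) (y∉Y ∷ Y!) ((gy≡c , y∉a) ∷ Ys) = begin
      patternCount * patternCount ^ t * avoidCount (y ∷ Y)           ≡⟨ reorder patternCount (patternCount ^ t) (avoidCount (y ∷ Y)) ⟩
      patternCount ^ t * (patternCount * avoidCount (y ∷ Y))         ≤⟨ *-monoʳ-≤ (patternCount ^ t) (cancel patternCount (avoidCount-step y Y gy≡c y∉a y∉Y (All.map proj₂ Ys))) ⟩
      patternCount ^ t * (pred patternCount * avoidCount Y)          ≡⟨ reorder′ (patternCount ^ t) (pred patternCount) (avoidCount Y) ⟩
      pred patternCount * (patternCount ^ t * avoidCount Y)          ≤⟨ *-monoʳ-≤ (pred patternCount) (avoidCount-decay Y Y! Ys) ⟩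
      pred patternCount * (pred patternCount ^ t * validCount {r = r} I g)   ≡⟨ *-assoc (pred patternCount) _ _ ⟨
      pred patternCount * pred patternCount ^ t * validCount {r = r} I g     ∎
      where
      open ≤-Reasoning
      t = length Y
      reorder : ∀ a b c → a * b * c ≡ b * (a * c)
      reorder = solve-∀
      reorder′ : ∀ a b c → a * (b * c) ≡ b * (a * c)
      reorder′ = solve-∀
      cancel : ∀ C {x z} → C * x + z ≤ C * z → C * x ≤ pred C * z
      cancel zero    _ = z≤n
      cancel (suc q) {x} {z} h = +-cancelʳ-≤ z _ _ (≤-trans h (≤-reflexive (+-comm z (q * z))))

  module _ {n l j : ℕ} (g : Vec (Fin l) n) where

    failCount : Structure r (suc j) → Fin l → Vec (Fin n) j → ℕ
    failCount D c a = ∑ (structures r n) (λ M → 𝟙 (valid? I M g) * 𝟙 (fails? M g D c a))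

    -- The class loses at most the `j` entries of `a`.
    candidates≥ : ∀ (D : Structure r (suc j)) c (a : Vec (Fin n) j) M →
                  classSize g c ≤ length (filter (candidate? M g D c a) (allFin n)) + j
    candidates≥ D c a M = begin
      classSize g c
        ≤⟨ ∑-mono (allFin n) pointwise ⟩
      ∑ (allFin n) (λ y → 𝟙 (cand? y) + ∑ (allFin j) (λ i → 𝟙 (y Fin.≟ lookup a i)))
        ≡⟨ ∑-+ (allFin n) _ _ ⟩
      ∑ (allFin n) (𝟙 ∘ cand?) + ∑ (allFin n) (λ y → ∑ (allFin j) (λ i → 𝟙 (y Fin.≟ lookup a i)))
        ≡⟨ cong₂ _+_ (sym (length-filter≡∑ cand? (allFin n))) (∑-swap (allFin n) (allFin j) _) ⟩
      length (filter cand? (allFin n)) + ∑ (allFin j) (λ i → ∑ (allFin n) (λ y → 𝟙 (y Fin.≟ lookup a i)))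
        ≤⟨ +-monoʳ-≤ (length (filter cand? (allFin n))) (∑-≤const (allFin j) (λ i → ∑-allFin≤1 (lookup a i))) ⟩
      length (filter cand? (allFin n)) + length (allFin j) * 1
        ≡⟨ cong (length (filter cand? (allFin n)) +_) (trans (*-identityʳ _) (length-allFin j)) ⟩
      length (filter cand? (allFin n)) + j ∎
      where
      open ≤-Reasoning
      cand? = candidate? M g D c a
      pointwise : ∀ y → 𝟙 (lookup g y Fin.≟ c) ≤ 𝟙 (cand? y) + ∑ (allFin j) (λ i → 𝟙 (y Fin.≟ lookup a i))
      pointwise y with Fin.any? (λ i → y Fin.≟ lookup a i)
      ... | no  y∉a = ≤-trans (𝟙-mono (lookup g y Fin.≟ c) (cand? y)
                        (λ gy≡c → gy≡c , VecAllProperties.lookup⁻ (λ i e → y∉a (i , e)))) (m≤m+n _ _)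
      ... | yes (i , y≡ai) = begin
        𝟙 (lookup g y Fin.≟ c)                     ≤⟨ 𝟙-mono (lookup g y Fin.≟ c) (y Fin.≟ lookup a i) (λ _ → y≡ai) ⟩
        𝟙 (y Fin.≟ lookup a i)                     ≤⟨ term≤∑ (λ i → 𝟙 (y Fin.≟ lookup a i)) (∈-allFin i) ⟩
        ∑ (allFin j) (λ i → 𝟙 (y Fin.≟ lookup a i)) ≤⟨ m≤n+m _ (𝟙 (cand? y)) ⟩
        𝟙 (cand? y) + ∑ (allFin j) (λ i → 𝟙 (y Fin.≟ lookup a i)) ∎

    failCount-bound : ∀ D c a S K → K ≤ 2 ^ S → length (structures r (suc j)) * S + j ≤ classSize g c →
                      K * failCount D c a ≤ validCount {r = r} I g
    failCount-bound D c a S K K≤2^S large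
      with valid? I D (c ∷ Vec.map (lookup g) a) ×-dec unique? a
    ... | no ¬extendible = ≤-trans (≤-reflexive (trans (cong (K *_) none) (*-zeroʳ K))) z≤n
      where
      none : failCount D c a ≡ 0
      none = trans (∑-cong (structures r n) (λ M → trans (cong (𝟙 (valid? I M g) *_)
          (𝟙-no (fails? M g D c a) (λ ((v , a! , _) , _) → ¬extendible (v , a!)))) (*-zeroʳ (𝟙 (valid? I M g)))))
        (∑-zero (structures r n))
    ... | yes (D-valid , a!) = *-cancelˡ-≤ (suc q ^ t) {{m^n≢0 (suc q) t}} (begin
      suc q ^ t * (K * failCount D c a)      ≡⟨ reorder (suc q ^ t) K (failCount D c a) ⟩
      K * (suc q ^ t * failCount D c a)      ≤⟨ *-monoʳ-≤ K (*-monoʳ-≤ (suc q ^ t) (∑-mono (structures r n) avoid)) ⟩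
      K * (suc q ^ t * avoidCount g D c a D-valid a! Y)
        ≤⟨ *-monoʳ-≤ K (subst (λ C → C ^ t * avoidCount g D c a D-valid a! Y ≤ pred C ^ t * validCount {r = r} I g) (sym C≡) decay) ⟩
      K * (q ^ t * validCount {r = r} I g)           ≡⟨ *-assoc K (q ^ t) _ ⟨
      K * q ^ t * validCount {r = r} I g             ≤⟨ *-monoˡ-≤ (validCount {r = r} I g) (geometric-decay q S t K K≤2^S S≤t) ⟩
      suc q ^ t * validCount {r = r} I g             ∎)
      where
      open ≤-Reasoning
      C>0 : ∃[ q ] suc q ≡ length (structures r (suc j))
      C>0 = nonempty (proj₁ (proj₂ (represent r (suc j) D)))
      q = proj₁ C>0
      C≡ = proj₂ C>0
      -- Being a candidate depends on `g`, `c` and `a` alone, so one list `Y` serves for all `M`;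
      -- the empty structure is a placeholder.
      cand? = candidate? {n} {l} {j} (structure (λ _ _ → false)) g D c a
      Y = filter cand? (allFin n)
      t = length Y
      decay = avoidCount-decay g D c a D-valid a! Y (Unique.filter⁺ cand? (Unique.allFin⁺ n)) (All.all-filter cand? (allFin n))
      S≤t : suc q * S ≤ t
      S≤t = +-cancelʳ-≤ j _ _ (≤-trans (subst (λ C → C * S + j ≤ classSize g c) (sym C≡) large)
                                       (candidates≥ D c a (structure (λ _ _ → false))))
      reorder : ∀ a b c → a * (b * c) ≡ b * (a * c)
      reorder = solve-∀
      avoid : ∀ M → 𝟙 (valid? I M g) * 𝟙 (fails? M g D c a) ≤ 𝟙 (avoids? g D c a D-valid a! Y M)
      avoid M = 𝟙*-≤ (valid? I M g) (λ valid → 𝟙-mono (fails? M g D c a) (avoids? g D c a D-valid a! Y M)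
        (λ ((_ , _ , M≈D) , none) → valid , M≈D , All.tabulate (λ {y} y∈Y hit →
          none (y , proj₂ (∈.∈-filter⁻ cand? {xs = allFin n} y∈Y) , hit))))

  extensions : ∀ l n j → List (Structure r (suc j) × (Fin l × Vec (Fin n) j))
  extensions l n j = cartesianProduct (structures r (suc j)) (cartesianProduct (allFin l) (maps n j))

  length-extensions : ∀ l n j → length (extensions l n j) ≡ length (structures r (suc j)) * (l * n ^ j)
  length-extensions l n j =
    trans (length-cartesianProductWith _,_ (structures r (suc j)) (cartesianProduct (allFin l) (maps n j)))
      (cong (length (structures r (suc j)) *_)
        (trans (length-cartesianProductWith _,_ (allFin l) (maps n j))
          (cong₂ _*_ (length-allFin l) (trans (length-vecs (allFin n) j) (cong (_^ j) (length-allFin n))))))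

  failures : ∀ {n l} → Structure r n → Vec (Fin l) n → ℕ → ℕ
  failures {n} {l} M g j = ∑ (extensions l n j) (λ (D , c , a) → 𝟙 (fails? M g D c a))

  -- A union bound over all extension problems with a base of `j` points: their number times `K`
  -- must not exceed the gain `2 ^ S`.
  few-failures : ∀ {n l} (g : Vec (Fin l) n) j S K →
    length (structures r (suc j)) * (l * n ^ j) * K ≤ 2 ^ S →
    (∀ c → length (structures r (suc j)) * S + j ≤ classSize g c) →
    K * ∑ (structures r n) (λ M → 𝟙 (valid? I M g) * failures M g j) ≤ validCount {r = r} I g
  few-failures {n} {l} g j S K K≤2^S large = begin
    K * ∑ (structures r n) (λ M → 𝟙 (valid? I M g) * failures M g j)
      ≡⟨ cong (K *_) (∑-cong (structures r n) (λ M → ∑-*ˡ (extensions l n j) (𝟙 (valid? I M g)) _)) ⟨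
    K * ∑ (structures r n) (λ M → ∑ (extensions l n j) (λ (D , c , a) → 𝟙 (valid? I M g) * 𝟙 (fails? M g D c a)))
      ≡⟨ cong (K *_) (∑-swap (structures r n) (extensions l n j) _) ⟩
    K * ∑ (extensions l n j) (λ (D , c , a) → failCount g D c a)
      ≡⟨ ∑-*ˡ (extensions l n j) K _ ⟨
    ∑ (extensions l n j) (λ (D , c , a) → K * failCount g D c a)
      ≤⟨ ∑-average (extensions l n j) _ (validCount {r = r} I g) (λ { {D , c , a} _ → begin
           length (extensions l n j) * (K * failCount g D c a)
             ≡⟨ *-assoc (length (extensions l n j)) K _ ⟨
           length (extensions l n j) * K * failCount g D c a
             ≤⟨ failCount-bound g D c a S _ (subst (λ e → e * K ≤ 2 ^ S) (sym (length-extensions l n j)) K≤2^S) (large c) ⟩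
           validCount {r = r} I g ∎ }) ⟩
    validCount {r = r} I g ∎
    where open ≤-Reasoning

-- Growth rates

suc≤2^ : ∀ q → suc q ≤ 2 ^ q
suc≤2^ zero    = ≤-refl
suc≤2^ (suc q) = begin
  suc (suc q)          ≡⟨ cong suc (+-comm 1 q) ⟩
  suc q + 1            ≤⟨ +-mono-≤ (suc≤2^ q) (m^n>0 2 q) ⟩
  2 ^ q + 2 ^ q        ≡⟨ cong (2 ^ q +_) (+-identityʳ (2 ^ q)) ⟨
  2 ^ suc q            ∎
  where open ≤-Reasoning

halve : ∀ q → ∃[ h ] h + h ≤ q × q ≤ suc (h + h)
halve zero          = 0 , z≤n , z≤n
halve (suc zero)    = 0 , z≤n , ≤-refl
halve (suc (suc q)) with h , h+h≤q , q≤ ← halve q =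
  suc h , s≤s (≤-trans (≤-reflexive (+-suc h h)) (s≤s h+h≤q)) ,
  s≤s (s≤s (≤-trans q≤ (≤-reflexive (sym (+-suc h h)))))

halve-≥ : ∀ {X q h} → X + X ≤ q → q ≤ suc (h + h) → X ≤ h
halve-≥ {X} {q} {h} X+X≤q q≤ = ≮⇒≥ λ h<X → 1+n≰n (begin
  suc (suc (h + h))   ≡⟨ cong suc (+-suc h h) ⟨
  suc h + suc h       ≤⟨ +-mono-≤ h<X h<X ⟩
  X + X               ≤⟨ X+X≤q ⟩
  q                   ≤⟨ q≤ ⟩
  suc (h + h)         ∎)
  where open ≤-Reasoning

square-of-half : ∀ {h q} → h + h ≤ q → 2 ^ h * 2 ^ h ≤ 2 ^ q
square-of-half {h} {q} h+h≤q =
  ≤-trans (≤-reflexive (sym (^-distribˡ-+-* 2 h h))) (^-monoʳ-≤ 2 h+h≤q)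

-- With `h` half of `q`, both factors of `2 ^ h * 2 ^ h` are at least `suc h`; one absorbs the
-- constant and the other the linear term.
linear≤2^ : ∀ X → ∃[ q₀ ] ∀ q → q₀ ≤ q → X * suc q ≤ 2 ^ q
linear≤2^ X = X + X + (X + X) , λ q large →
  let h , h+h≤q , q≤ = halve q
      open ≤-Reasoning in begin
  X * suc q                ≤⟨ *-monoʳ-≤ X (s≤s q≤) ⟩
  X * suc (suc (h + h))    ≡⟨ lemma X h ⟩
  (X + X) * suc h          ≤⟨ *-monoˡ-≤ (suc h) (≤-trans (halve-≥ {X + X} large q≤) (n≤1+n h)) ⟩
  suc h * suc h            ≤⟨ *-mono-≤ (suc≤2^ h) (suc≤2^ h) ⟩
  2 ^ h * 2 ^ h            ≤⟨ square-of-half {h} h+h≤q ⟩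
  2 ^ q                    ∎
  where
  lemma : ∀ X h → X * (2 + (h + h)) ≡ (X + X) * (1 + h)
  lemma = solve-∀

quadratic≤2^ : ∀ X → ∃[ p₀ ] ∀ p → p₀ ≤ p → X * suc (p * p) ≤ 2 ^ p
quadratic≤2^ X = q₀ + q₀ , λ p large →
  let h , h+h≤p , p≤ = halve p
      h-large = linear h (halve-≥ large p≤)
      open ≤-Reasoning in begin
  X * suc (p * p)                        ≤⟨ *-monoʳ-≤ X (s≤s (*-mono-≤ p≤ p≤)) ⟩
  -- The added terms complete the second factor to `4 * (suc h * suc h)`.
  X * suc (suc (h + h) * suc (h + h))    ≤⟨ *-monoʳ-≤ X (m≤m+n _ (2 + (h + h) + (h + h))) ⟩
  X * (suc (suc (h + h) * suc (h + h)) + (2 + (h + h) + (h + h)))  ≡⟨ lemma X h ⟩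
  4 * X * (suc h * suc h)                ≤⟨ *-monoˡ-≤ (suc h * suc h) (m≤m*m (4 * X)) ⟩
  4 * X * (4 * X) * (suc h * suc h)      ≡⟨ lemma′ (4 * X) (suc h) ⟩
  (4 * X * suc h) * (4 * X * suc h)      ≤⟨ *-mono-≤ h-large h-large ⟩
  2 ^ h * 2 ^ h                          ≤⟨ square-of-half {h} h+h≤p ⟩
  2 ^ p                                  ∎
  where
  q₀ = proj₁ (linear≤2^ (4 * X))
  linear = proj₂ (linear≤2^ (4 * X))
  m≤m*m : ∀ m → m ≤ m * m
  m≤m*m zero    = z≤n
  m≤m*m (suc m) = m≤m*n (suc m) (suc m)
  lemma : ∀ X h → X * ((1 + ((1 + (h + h)) * (1 + (h + h)))) + (2 + (h + h) + (h + h))) ≡ 4 * X * ((1 + h) * (1 + h))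
  lemma = solve-∀
  lemma′ : ∀ a b → a * a * (b * b) ≡ (a * b) * (a * b)
  lemma′ = solve-∀

log₂ : ∀ n → 0 < n → ∃[ p ] 2 ^ p ≤ n × n < 2 ^ suc p
log₂ (suc zero)    _ = 0 , ≤-refl , ≤-refl
log₂ (suc (suc n)) _ with p , 2^p≤ , n<2^ ← log₂ (suc n) z<s with suc (suc n) <? 2 ^ suc p
... | yes small = p , ≤-trans 2^p≤ (n≤1+n _) , small
... | no  large = suc p , ≮⇒≥ large , ≤-<-trans n<2^ (^-monoʳ-< 2 ≤-refl (n<1+n (suc p)))

log₂-large : ∀ {P p n} → 2 ^ P ≤ n → n < 2 ^ suc p → P ≤ p
log₂-large {P} {p} 2^P≤n n<2^ = ≮⇒≥ λ p<P →
  <⇒≱ n<2^ (≤-trans (^-monoʳ-≤ 2 p<P) 2^P≤n)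

-- Bad pairs of a structure and a colouring are rare

smallClasses : ∀ {n l} → ℕ → Vec (Fin l) n → ℕ
smallClasses {l = l} s g = ∑ (allFin l) (λ c → 𝟙 (classSize g c ≤? s))

module _ {ρ : ℕ} {r : Fin ρ → ℕ} (I : Subset ρ) where

  opaque

    -- A number of defects rather than a truth value, so that union bounds become sums. Failed
    -- extensions count only when no class is small, since only then are they known to be rare.
    badness : ∀ {n l} → ℕ → ℕ → Structure r n → Vec (Fin l) n → ℕ
    badness m s M g = smallClasses s g + 𝟙 (smallClasses s g ℕ.≟ 0) * ∑ (upTo m) (failures I M g)

    badCount : ℕ → ℕ → ℕ → ℕ → ℕ
    badCount l m s n = ∑ (maps l n) (λ g → ∑ (structures r n) (λ M → 𝟙 (valid? I M g) * badness m s M g))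

  private
    total : ℕ → ℕ → ℕ
    total = totalCount {r = r} I

    V : ∀ {n l} → Vec (Fin l) n → ℕ
    V = validCount {r = r} I

    failingCount : ∀ {n l} → Vec (Fin l) n → ℕ → ℕ
    failingCount {n} g j = ∑ (structures r n) (λ M → 𝟙 (valid? I M g) * failures I M g j)

  opaque
    unfolding badness badCount

    -- Each of the two kinds of defects gets half of the allowance, hence `2 * K`; the factors `l`
    -- and `m` pay for the sums over classes and over sizes of the base.
    badCount-bound : ∀ l m s n K →
      (∀ (c : Fin l) → l * (2 * K) * smallClassCount {r = r} I n s c ≤ total l n) →
      (∀ {j} → j < m → (g : Vec (Fin l) n) → (∀ c → s < classSize g c) → m * (2 * K) * failingCount g j ≤ V g) →
      K * badCount l m s n ≤ total l n
    badCount-bound l m s n K small-rare fail-rare = *-cancelˡ-≤ 2 (begin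
      2 * (K * badCount l m s n)          ≡⟨ *-assoc 2 K _ ⟨
      2 * K * badCount l m s n            ≡⟨ cong (2 * K *_) separate ⟩
      2 * K * (smalls + fails)            ≡⟨ *-distribˡ-+ (2 * K) smalls fails ⟩
      2 * K * smalls + 2 * K * fails      ≤⟨ +-mono-≤ smalls-rare fails-rare ⟩
      total l n + total l n               ≡⟨ cong (total l n +_) (+-identityʳ _) ⟨
      2 * total l n                       ∎)
      where
      open ≤-Reasoning
      balanced : Vec (Fin l) n → ℕ
      balanced g = 𝟙 (smallClasses s g ℕ.≟ 0)
      fail : Vec (Fin l) n → ℕ
      fail g = ∑ (structures r n) (λ M → 𝟙 (valid? I M g) * ∑ (upTo m) (failures I M g))
      smalls fails : ℕ
      smalls = ∑ (maps l n) (λ g → smallClasses s g * V g)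
      fails = ∑ (maps l n) (λ g → balanced g * fail g)

      separate : badCount l m s n ≡ smalls + fails
      separate = trans (∑-cong (maps l n) (λ g → begin-equality
        ∑ (structures r n) (λ M → 𝟙 (valid? I M g) * badness m s M g)
          ≡⟨ ∑-cong (structures r n) (λ M → rearrange (𝟙 (valid? I M g)) (smallClasses s g) (balanced g) _) ⟩
        ∑ (structures r n) (λ M → smallClasses s g * 𝟙 (valid? I M g) + balanced g * (𝟙 (valid? I M g) * ∑ (upTo m) (failures I M g)))
          ≡⟨ ∑-+ (structures r n) _ _ ⟩
        ∑ (structures r n) (λ M → smallClasses s g * 𝟙 (valid? I M g)) + ∑ (structures r n) (λ M → balanced g * (𝟙 (valid? I M g) * ∑ (upTo m) (failures I M g)))
          ≡⟨ cong₂ _+_ (∑-*ˡ (structures r n) (smallClasses s g) _) (∑-*ˡ (structures r n) (balanced g) _) ⟩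
        smallClasses s g * V g + balanced g * fail g ∎)) (∑-+ (maps l n) _ _)
        where
        rearrange : ∀ v a b c → v * (a + b * c) ≡ a * v + b * (v * c)
        rearrange = solve-∀

      smalls-rare : 2 * K * smalls ≤ total l n
      smalls-rare = begin
        2 * K * smalls
          ≡⟨ cong (2 * K *_) (∑-cong (maps l n) (λ g → ∑-*ʳ (allFin l) (V g) _)) ⟨
        2 * K * ∑ (maps l n) (λ g → ∑ (allFin l) (λ c → 𝟙 (classSize g c ≤? s) * V g))
          ≡⟨ cong (2 * K *_) (∑-swap (maps l n) (allFin l) _) ⟩
        2 * K * ∑ (allFin l) (smallClassCount {r = r} I n s)
          ≡⟨ ∑-*ˡ (allFin l) (2 * K) _ ⟨
        ∑ (allFin l) (λ c → 2 * K * smallClassCount {r = r} I n s c)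
          ≤⟨ ∑-average (allFin l) _ (total l n) (λ {c} _ → ≤-trans (≤-reflexive
               (trans (cong (_* (2 * K * smallClassCount {r = r} I n s c)) (length-allFin l)) (sym (*-assoc l (2 * K) _)))) (small-rare c)) ⟩
        total l n ∎

      classes-large : ∀ (g : Vec (Fin l) n) → smallClasses s g ≡ 0 → ∀ c → s < classSize g c
      classes-large g none c = ≰⇒> λ size≤s → 1+n≰n (begin
        1                              ≡⟨ 𝟙-yes (classSize g c ≤? s) size≤s ⟨
        𝟙 (classSize g c ≤? s)         ≤⟨ term≤∑ (λ c → 𝟙 (classSize g c ≤? s)) (∈-allFin c) ⟩
        smallClasses s g               ≡⟨ none ⟩
        0                              ∎)

      fail-bound : ∀ g → 2 * K * (balanced g * fail g) ≤ V g
      fail-bound g = begin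
        2 * K * (balanced g * fail g)      ≡⟨ reorder (2 * K) (balanced g) (fail g) ⟩
        balanced g * (2 * K * fail g)      ≤⟨ 𝟙*-≤ (smallClasses s g ℕ.≟ 0) (λ none → begin
          2 * K * fail g
            ≡⟨ cong (2 * K *_) (∑-cong (structures r n) (λ M → ∑-*ˡ (upTo m) (𝟙 (valid? I M g)) _)) ⟨
          2 * K * ∑ (structures r n) (λ M → ∑ (upTo m) (λ j → 𝟙 (valid? I M g) * failures I M g j))
            ≡⟨ cong (2 * K *_) (∑-swap (structures r n) (upTo m) _) ⟩
          2 * K * ∑ (upTo m) (failingCount g)
            ≡⟨ ∑-*ˡ (upTo m) (2 * K) _ ⟨
          ∑ (upTo m) (λ j → 2 * K * failingCount g j)
            ≤⟨ ∑-average (upTo m) _ (V g) (λ {j} j∈ → ≤-trans (≤-reflexive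
                 (trans (cong (_* (2 * K * failingCount g j)) (List.length-upTo m)) (sym (*-assoc m (2 * K) _))))
                 (fail-rare (∈.∈-upTo⁻ j∈) g (classes-large g none))) ⟩
          V g ∎) ⟩
        V g ∎
        where
        reorder : ∀ a b c → a * (b * c) ≡ b * (a * c)
        reorder = solve-∀

      fails-rare : 2 * K * fails ≤ total l n
      fails-rare = begin
        2 * K * fails                                            ≡⟨ ∑-*ˡ (maps l n) (2 * K) _ ⟨
        ∑ (maps l n) (λ g → 2 * K * (balanced g * fail g))       ≤⟨ ∑-mono (maps l n) fail-bound ⟩
        total l n                                                ∎

  opaque

    -- The threshold for small classes is (log₂ n)², which lies between log₂ n (so that failures of
    -- extension are exponentially rarer than the polynomially many extension problems) and n.
    bad-rare : ∀ l m K → ∃[ N ] ∀ n → N ≤ n → ∃[ s ] K * badCount l m s n ≤ total l n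
    bad-rare l m K = 2 ^ P , λ n N≤n →
      let p , 2^p≤n , n<2^ = log₂ n (≤-trans (m^n>0 2 P) N≤n)
          P≤p = log₂-large {P} N≤n n<2^
      in p * p , badCount-bound l m (p * p) n K
           (smallBound n p (≤-trans (m≤m+n p₀ _) P≤p) 2^p≤n)
           (failBound n p (≤-trans (≤-trans (m≤n+m _ p₀) (n≤1+n _)) (≤-trans (≤-reflexive (sym (+-suc p₀ _))) P≤p))
                      (≤-trans (≤-trans (s≤s z≤n) (≤-reflexive (sym (+-suc p₀ _)))) P≤p) n<2^)
      where
      open ≤-Reasoning
      -- `Q j * n ^ j` is the number of extension problems times the demanded factor. As
      -- `n < 2 ^ suc p`, it is at most `2 ^ S` with `S = Q j + suc p * j`, which is linear in `p`.
      -- The class size that this requires is at most `Rate j * p`, hence at most `p * p` once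
      -- `Rate j ≤ p`.
      C Q Rate : ℕ → ℕ
      C j = length (structures r (suc j))
      Q j = C j * (l * (m * (2 * K)))
      Rate j = C j * (Q j + 2 * j) + j
      -- From `X * suc s ≤ n`, the summand `l` of `X` pays for the subtraction of `l * s`. The other
      -- summand combines the demanded factor `l * (2 * K)` with the `l` of `few-small-classes`. The
      -- successor in `P` secures `1 ≤ p`.
      X p₀ P : ℕ
      X = l + l * (2 * K) * l
      p₀ = proj₁ (quadratic≤2^ X)
      P = p₀ + suc (∑ (upTo m) Rate)

      smallBound : ∀ n p → p₀ ≤ p → 2 ^ p ≤ n →
                   ∀ (c : Fin l) → l * (2 * K) * smallClassCount {r = r} I n (p * p) c ≤ total l n
      smallBound n p p₀≤p 2^p≤n c = *-cancelˡ-≤ (l * suc s) {{l*suc-s≢0 c}} (begin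
        l * suc s * (l * (2 * K) * S)         ≡⟨ reorder l (suc s) (l * (2 * K)) S ⟩
        l * (2 * K) * l * suc s * S           ≤⟨ *-monoˡ-≤ S enough ⟩
        (n ∸ l * s) * S                       ≤⟨ few-small-classes I n s c ⟩
        l * suc s * total l n                 ∎)
        where
        s S : ℕ
        s = p * p
        S = smallClassCount {r = r} I n s c
        l*suc-s≢0 : ∀ {l} → Fin l → NonZero (l * suc s)
        l*suc-s≢0 {suc l} _ = _
        reorder : ∀ a b c d → a * b * (c * d) ≡ c * a * b * d
        reorder = solve-∀
        enough : l * (2 * K) * l * suc s ≤ n ∸ l * s
        enough = m+n≤o⇒m≤o∸n (l * (2 * K) * l * suc s) (begin
          l * (2 * K) * l * suc s + l * s     ≤⟨ +-monoʳ-≤ (l * (2 * K) * l * suc s) (*-monoʳ-≤ l (n≤1+n s)) ⟩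
          l * (2 * K) * l * suc s + l * suc s ≡⟨ +-comm _ (l * suc s) ⟩
          l * suc s + l * (2 * K) * l * suc s ≡⟨ *-distribʳ-+ (suc s) l _ ⟨
          X * suc s                           ≤⟨ proj₂ (quadratic≤2^ X) p p₀≤p ⟩
          2 ^ p                               ≤⟨ 2^p≤n ⟩
          n                                   ∎)

      failBound : ∀ n p → ∑ (upTo m) Rate ≤ p → 1 ≤ p → n < 2 ^ suc p → ∀ {j} → j < m → (g : Vec (Fin l) n) →
                  (∀ c → p * p < classSize g c) → m * (2 * K) * failingCount g j ≤ V g
      failBound n p R≤p 1≤p n<2^ {j} j<m g large =
        few-failures I g j S (m * (2 * K)) items≤2^S (λ c → ≤-trans S≤p² (<⇒≤ (large c)))
        where
        S : ℕ
        S = Q j + suc p * j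
        items≤2^S : C j * (l * n ^ j) * (m * (2 * K)) ≤ 2 ^ S
        items≤2^S = begin
          C j * (l * n ^ j) * (m * (2 * K))    ≡⟨ reorder (C j) l (n ^ j) (m * (2 * K)) ⟩
          Q j * n ^ j                          ≤⟨ *-mono-≤ (≤-trans (n≤1+n (Q j)) (suc≤2^ (Q j))) (^-monoˡ-≤ j (<⇒≤ n<2^)) ⟩
          2 ^ Q j * (2 ^ suc p) ^ j            ≡⟨ cong (2 ^ Q j *_) (^-*-assoc 2 (suc p) j) ⟩
          2 ^ Q j * 2 ^ (suc p * j)            ≡⟨ ^-distribˡ-+-* 2 (Q j) (suc p * j) ⟨
          2 ^ S                                ∎
          where
          reorder : ∀ a b c d → a * (b * c) * d ≡ a * (b * d) * c
          reorder = solve-∀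
        S≤p² : C j * S + j ≤ p * p
        S≤p² = begin
          C j * (Q j + suc p * j) + j          ≤⟨ +-mono-≤ (*-monoʳ-≤ (C j) (+-mono-≤ (m≤m*p (Q j)) (*-monoˡ-≤ j (+-monoˡ-≤ p 1≤p)))) (m≤m*p j) ⟩
          C j * (Q j * p + (p + p) * j) + j * p ≡⟨ collect (C j) (Q j) p j ⟩
          Rate j * p                              ≤⟨ *-monoˡ-≤ p (≤-trans (term≤∑ Rate (∈.∈-upTo⁺ j<m)) R≤p) ⟩
          p * p                                ∎
          where
          m≤m*p : ∀ m → m ≤ m * p
          m≤m*p m = ≤-trans (≤-reflexive (sym (*-identityʳ m))) (*-monoʳ-≤ m 1≤p)
          collect : ∀ c q p j → c * (q * p + (p + p) * j) + j * p ≡ (c * (q + 2 * j) + j) * p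
          collect = solve-∀

-- Structures and colourings with the extension property

module _ {ρ : ℕ} {r : Fin ρ → ℕ} (I : Subset ρ) where

  ExtensionProperty : ∀ {n l} → ℕ → Structure r n → Vec (Fin l) n → Set
  ExtensionProperty {n} {l} m M g =
    ∀ {j} → j < m → (D : Structure r (suc j)) (c : Fin l) (a : Vec (Fin n) j) →
    Extendible I M g D c a → ∃ (Witness I M g D c a)

  opaque
    unfolding badness

    badness≡0⇒extension : ∀ {n l} m s (M : Structure r n) (g : Vec (Fin l) n) →
                          badness I m s M g ≡ 0 → ExtensionProperty m M g
    badness≡0⇒extension {n} {l} m s M g bad≡0 {j} j<m D c a (D-valid , a! , M≈D)
      -- `failures` runs over listed structures only, so `D` is replaced by its representative.
      with D′ , D′∈ , D≈D′ ← represent r (suc j) D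
      with Fin.any? (witness? I M g D c a)
    ... | yes witness = witness
    ... | no  none    = contradiction (begin
      1                                 ≡⟨ 𝟙-yes (fails? I M g D′ c a) failsD′ ⟨
      𝟙 (fails? I M g D′ c a)           ≤⟨ term≤∑ (λ (D , c , a) → 𝟙 (fails? I M g D c a)) extension∈ ⟩
      failures I M g j                  ≤⟨ term≤∑ (failures I M g) (∈.∈-upTo⁺ j<m) ⟩
      ∑ (upTo m) (failures I M g)       ≡⟨ *-identityˡ _ ⟨
      1 * ∑ (upTo m) (failures I M g)   ≡⟨ cong (_* ∑ (upTo m) (failures I M g)) (𝟙-yes (smallClasses s g ℕ.≟ 0) small≡0) ⟨
      𝟙 (smallClasses s g ℕ.≟ 0) * ∑ (upTo m) (failures I M g)  ≡⟨ m+n≡0⇒n≡0 (smallClasses s g) bad≡0 ⟩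
      0                                 ∎) 1+n≰n
      where
      open ≤-Reasoning
      small≡0 : smallClasses s g ≡ 0
      small≡0 = m+n≡0⇒m≡0 (smallClasses s g) bad≡0
      extension∈ : (D′ , c , a) ∈ extensions I l n j
      extension∈ = ∈.∈-cartesianProduct⁺ D′∈ (∈.∈-cartesianProduct⁺ (∈-allFin c) (∈-maps a))
      failsD′ : Fails I M g D′ c a
      failsD′ = (valid-resp-≈ I {M = D} {D′} {c ∷ Vec.map (lookup g) a} D≈D′ D-valid , a! ,
                 (λ k u → trans (M≈D k u) (D≈D′ k _))) ,
                (λ (y , cand , hit) → none (y , cand , λ k u → trans (hit k u) (sym (D≈D′ k u))))

  private
    emptyStructure : ∀ n → Structure r n
    emptyStructure n = structure (λ _ _ → false)

    emptyStructure-valid : ∀ {n l} (g : Vec (Fin l) n) → Valid I (emptyStructure n) g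
    emptyStructure-valid g = (λ k k∈I → (λ t ()) , (λ t u t↭u ())) , (λ k t ())

  module _ (l n : ℕ) where

    memberCount : ℕ
    memberCount = ∑ (structures r n) (λ M → 𝟙 (inC? I l M))

    goodPairs : ℕ → ℕ → ℕ
    goodPairs m s = ∑ (maps l n) (λ g → ∑ (structures r n) (λ M → 𝟙 (valid? I M g) * 𝟙 (badness I m s M g ℕ.≟ 0)))

    opaque
      unfolding badCount

      total≤bad+good : ∀ m s → totalCount {r = r} I l n ≤ badCount {r = r} I l m s n + goodPairs m s
      total≤bad+good m s = begin
        ∑ (maps l n) (λ g → ∑ (structures r n) (λ M → 𝟙 (valid? I M g)))
          ≤⟨ ∑-mono (maps l n) (λ g → ∑-mono (structures r n) (λ M → begin
               𝟙 (valid? I M g)                             ≡⟨ *-identityʳ _ ⟨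
               𝟙 (valid? I M g) * 1                         ≤⟨ *-monoʳ-≤ (𝟙 (valid? I M g)) (zero-or-positive (badness I m s M g)) ⟩
               𝟙 (valid? I M g) * (badness I m s M g + 𝟙 (badness I m s M g ℕ.≟ 0))
                                                            ≡⟨ *-distribˡ-+ (𝟙 (valid? I M g)) (badness I m s M g) _ ⟩
               𝟙 (valid? I M g) * badness I m s M g + 𝟙 (valid? I M g) * 𝟙 (badness I m s M g ℕ.≟ 0) ∎)) ⟩
        ∑ (maps l n) (λ g → ∑ (structures r n) (λ M →
          𝟙 (valid? I M g) * badness I m s M g + 𝟙 (valid? I M g) * 𝟙 (badness I m s M g ℕ.≟ 0)))
          ≡⟨ ∑-cong (maps l n) (λ g → ∑-+ (structures r n) _ _) ⟩
        ∑ (maps l n) (λ g → ∑ (structures r n) (λ M → 𝟙 (valid? I M g) * badness I m s M g) +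
                            ∑ (structures r n) (λ M → 𝟙 (valid? I M g) * 𝟙 (badness I m s M g ℕ.≟ 0)))
          ≡⟨ ∑-+ (maps l n) _ _ ⟩
        badCount {r = r} I l m s n + goodPairs m s ∎
        where
        open ≤-Reasoning
        zero-or-positive : ∀ b → 1 ≤ b + 𝟙 (b ℕ.≟ 0)
        zero-or-positive zero    = ≤-refl
        zero-or-positive (suc b) = s≤s z≤n

    module _ (c : Fin l) where

      0<memberCount : 0 < memberCount
      0<memberCount with M , M∈ , ∅≈M ← represent r n (emptyStructure n) = begin
        1                    ≡⟨ 𝟙-yes (inC? I l M) (valid⇒inC I {M = M} {g} (valid-resp-≈ I {M = emptyStructure n} {M} {g} ∅≈M (emptyStructure-valid g))) ⟨
        𝟙 (inC? I l M)       ≤⟨ term≤∑ (λ M → 𝟙 (inC? I l M)) M∈ ⟩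
        memberCount          ∎
        where
        open ≤-Reasoning
        g = Vec.replicate n c

      memberCount≤total : memberCount ≤ totalCount {r = r} I l n
      memberCount≤total = begin
        memberCount   ≤⟨ ∑-mono (structures r n) colouring ⟩
        ∑ (structures r n) (λ M → ∑ (maps l n) (λ g → 𝟙 (valid? I M g)))  ≡⟨ ∑-swap (structures r n) (maps l n) _ ⟩
        totalCount {r = r} I l n ∎
        where
        open ≤-Reasoning
        colouring : ∀ M → 𝟙 (inC? I l M) ≤ ∑ (maps l n) (λ g → 𝟙 (valid? I M g))
        colouring M with inC? I l M
        ... | no  _ = z≤n
        ... | yes inC with g , valid ← inC⇒valid I {M = M} inC = begin
          1                    ≡⟨ 𝟙-yes (valid? I M g) valid ⟨
          𝟙 (valid? I M g)     ≤⟨ term≤∑ (λ g → 𝟙 (valid? I M g)) (∈-maps g) ⟩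
          ∑ (maps l n) (λ g → 𝟙 (valid? I M g)) ∎

  -- The interface between counting and definability; `sameColour-iff` provides it for `m` at least
  -- `N₀ + 2`.
  RefinesKernels : ℕ → ℕ → Set
  RefinesKernels l m = ∀ {n} (M : Structure r n) (g g′ : Vec (Fin l) n) →
    Valid I M g → ExtensionProperty m M g → IsColouring l M (lookup g′) →
    ∀ x y → lookup g x ≡ lookup g y → lookup g′ x ≡ lookup g′ y

  module _ {l m : ℕ} (refines : RefinesKernels l m) where

    -- A colouring whose kernel contains that of g is π ∘ g for some π, so a structure occurs
    -- in a bounded number of good pairs.
    goodPairs-bound : ∀ n s → goodPairs l n m s ≤ length (maps l l) * memberCount l n
    goodPairs-bound n s = begin
      goodPairs l n m s                                              ≡⟨ ∑-swap (maps l n) (structures r n) _ ⟩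
      ∑ (structures r n) (λ M → ∑ (maps l n) (good M))               ≤⟨ ∑-mono (structures r n) bounded ⟩
      ∑ (structures r n) (λ M → length (maps l l) * 𝟙 (inC? I l M))  ≡⟨ ∑-*ˡ (structures r n) (length (maps l l)) _ ⟩
      length (maps l l) * memberCount l n                            ∎
      where
      open ≤-Reasoning
      good : Structure r n → Vec (Fin l) n → ℕ
      good M g = 𝟙 (valid? I M g) * 𝟙 (badness I m s M g ℕ.≟ 0)
      good>0⇒ : ∀ M g → 0 < good M g → Valid I M g × badness I m s M g ≡ 0
      good>0⇒ M g pos with valid? I M g | badness I m s M g ℕ.≟ 0
      ... | yes valid | yes bad≡0 = valid , bad≡0
      bounded : ∀ M → ∑ (maps l n) (good M) ≤ length (maps l l) * 𝟙 (inC? I l M)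
      bounded M with 0 <? ∑ (maps l n) (good M)
      ... | no  none = ≤-trans (≮⇒≥ none) z≤n
      ... | yes some
        with g , _ , g-pos ← ∑>0⇒∃ (maps l n) (good M) some
        with g-valid , bad≡0 ← good>0⇒ M g g-pos = begin
        ∑ (maps l n) (good M)
          ≤⟨ ∑-cover (mapDecSetoid l n) (maps-unique l n) (maps l l) (λ π → Vec.map (lookup π) g) (factor g-valid bad≡0) ⟩
        ∑ (maps l l) (λ _ → 1)                   ≡⟨ ∑-const (maps l l) 1 ⟩
        length (maps l l) * 1                    ≡⟨ cong (length (maps l l) *_) (𝟙-yes (inC? I l M) (valid⇒inC I {M = M} {g} g-valid)) ⟨
        length (maps l l) * 𝟙 (inC? I l M)       ∎
        where
        factor : ∀ {g} → Valid I M g → badness I m s M g ≡ 0 → ∀ g′ → 0 < good M g′ →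
                 ∃[ π ] π ∈ maps l l × g′ ≡ Vec.map (lookup π) g × good M g′ ≤ 1
        factor {g} g-valid bad≡0 g′ g′-pos =
          π , ∈-maps π , vec-ext g′ _ (λ x → sym (agrees x)) , *-mono-≤ (𝟙≤1 (valid? I M g′)) (𝟙≤1 (_ ℕ.≟ 0))
          where
          𝟙≤1 : ∀ {P : Set} (d : Dec P) → 𝟙 d ≤ 1
          𝟙≤1 d = 𝟙-mono d (yes tt) (λ _ → tt)
          value : ∀ c → Dec (∃[ x ] lookup g x ≡ c) → Fin l
          value c (yes (x , _)) = lookup g′ x
          -- A colour that `g` does not take may be sent anywhere.
          value c (no _)        = c
          π : Vec (Fin l) l
          π = Vec.tabulate (λ c → value c (Fin.any? (λ x → lookup g x Fin.≟ c)))
          value-agrees : ∀ x d → value (lookup g x) d ≡ lookup g′ x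
          value-agrees x (yes (y , gy≡gx)) = refines M g g′ g-valid (badness≡0⇒extension m s M g bad≡0)
            (proj₂ (proj₁ (good>0⇒ M g′ g′-pos))) y x gy≡gx
          value-agrees x (no none) = contradiction (x , refl) none
          agrees : ∀ x → lookup (Vec.map (lookup π) g) x ≡ lookup g′ x
          agrees x = trans (Vec.lookup-map x (lookup π) g)
                    (trans (Vec.lookup∘tabulate _ (lookup g x)) (value-agrees x (Fin.any? (λ y → lookup g y Fin.≟ lookup g x))))

    module _ {P : ∀ {n} → Structure r n → Set} (P? : ∀ {n} (M : Structure r n) → Dec (P M))
             (good⇒P : ∀ {n} (M : Structure r n) (g : Vec (Fin l) n) → Valid I M g → ExtensionProperty m M g → P M)
             where

      exceptionCount : ℕ → ℕ
      exceptionCount n = ∑ (structures r n) (λ M → 𝟙 (inC? I l M ×-dec ¬? (P? M)))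

      opaque
        unfolding badCount

        -- By `good⇒P`, every colouring of an exception forms a bad pair with it, and membership
        -- provides a colouring.
        exceptionCount≤badCount : ∀ n s → exceptionCount n ≤ badCount {r = r} I l m s n
        exceptionCount≤badCount n s = begin
          exceptionCount n  ≤⟨ ∑-mono (structures r n) bad ⟩
          ∑ (structures r n) (λ M → ∑ (maps l n) (λ g → 𝟙 (valid? I M g) * badness I m s M g))  ≡⟨ ∑-swap (structures r n) (maps l n) _ ⟩
          badCount {r = r} I l m s n ∎
          where
          open ≤-Reasoning
          bad : ∀ M → 𝟙 (inC? I l M ×-dec ¬? (P? M)) ≤ ∑ (maps l n) (λ g → 𝟙 (valid? I M g) * badness I m s M g)
          bad M with inC? I l M ×-dec ¬? (P? M)
          ... | no _ = z≤n
          ... | yes (inC , ¬P) with g , valid ← inC⇒valid I {M = M} inC = begin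
            1                                        ≤⟨ n≢0⇒n>0 (λ bad≡0 → ¬P (good⇒P M g valid (badness≡0⇒extension m s M g bad≡0))) ⟩
            badness I m s M g                        ≡⟨ *-identityˡ _ ⟨
            1 * badness I m s M g                    ≡⟨ cong (_* badness I m s M g) (𝟙-yes (valid? I M g) valid) ⟨
            𝟙 (valid? I M g) * badness I m s M g     ≤⟨ term≤∑ (λ g → 𝟙 (valid? I M g) * badness I m s M g) (∈-maps g) ⟩
            ∑ (maps l n) (λ g → 𝟙 (valid? I M g) * badness I m s M g) ∎

      opaque

        -- With `b` for `badCount`, subtracting one `b` from `suc (suc L * suc K) * b ≤ total ≤ b +
        -- L * members` leaves `suc L * suc K * b ≤ L * members`, hence `suc K * b ≤
        -- members`. Strictness comes from the spare `b`, or from the existence of a member if `b`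
        -- is zero.
        exceptions-rare : Fin l → ∀ K → ∃[ N ] ∀ n → N ≤ n → K * exceptionCount n < memberCount l n
        exceptions-rare c K = proj₁ rare , λ n N≤n → bounded n (proj₂ rare n N≤n)
          where
          open ≤-Reasoning
          L : ℕ
          L = length (maps l l)
          rare : ∃[ N ] ∀ n → N ≤ n → ∃[ s ] suc (suc L * suc K) * badCount {r = r} I l m s n ≤ totalCount {r = r} I l n
          rare = bad-rare {r = r} I l m (suc (suc L * suc K))
          cancelled : ∀ n s → suc (suc L * suc K) * badCount {r = r} I l m s n ≤ totalCount {r = r} I l n →
                      suc K * badCount {r = r} I l m s n ≤ memberCount l n
          cancelled n s few = *-cancelˡ-≤ (suc L) (begin
            suc L * (suc K * badCount {r = r} I l m s n)   ≡⟨ *-assoc (suc L) (suc K) _ ⟨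
            suc L * suc K * badCount {r = r} I l m s n     ≤⟨ +-cancelˡ-≤ (badCount {r = r} I l m s n) _ _
                                                       (≤-trans few (≤-trans (total≤bad+good l n m s) (+-monoʳ-≤ _ (goodPairs-bound n s)))) ⟩
            L * memberCount l n                    ≤⟨ *-monoˡ-≤ (memberCount l n) (n≤1+n L) ⟩
            suc L * memberCount l n                ∎)
          strictly : ∀ {b c} → 0 < c → suc K * b ≤ c → K * b < c
          strictly {zero} {c} 0<c _ = subst (_< c) (sym (*-zeroʳ K)) 0<c
          strictly {suc b} _   h = <-≤-trans (m<n+m (K * suc b) z<s) h
          bounded : ∀ n → ∃[ s ] suc (suc L * suc K) * badCount {r = r} I l m s n ≤ totalCount {r = r} I l n →
                    K * exceptionCount n < memberCount l n
          bounded n (s , few) = begin-strict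
            K * exceptionCount n         ≤⟨ *-monoʳ-≤ K (exceptionCount≤badCount n s) ⟩
            K * badCount {r = r} I l m s n       <⟨ strictly (0<memberCount l n c) (cancelled n s few) ⟩
            memberCount l n              ∎

  -- Without good pairs, `2 * bad ≤ total ≤ bad` would leave no pairs at all, but the empty
  -- structure belongs to one.
  goodPair-exists : ∀ l m → Fin l → ∃[ n ] Σ[ M ∈ Structure r n ] Σ[ g ∈ Vec (Fin l) n ] Valid I M g × ExtensionProperty m M g
  goodPair-exists l m c =
    let g , _ , g-pos = ∑>0⇒∃ (maps l n) _ goodPairs>0
        M , _ , M-pos = ∑>0⇒∃ (structures r n) _ g-pos
    in n , M , g , good M g M-pos
    where
    open ≤-Reasoning
    rare = bad-rare {r = r} I l m 2
    n = proj₁ rare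
    s = proj₁ (proj₂ rare n ≤-refl)
    goodPairs>0 : 0 < goodPairs l n m s
    goodPairs>0 = ≰⇒> λ none → 1+n≰n {badCount {r = r} I l m s n} (begin-strict
      badCount {r = r} I l m s n            <⟨ positive (badCount {r = r} I l m s n) (begin-strict
        0                           <⟨ 0<memberCount l n c ⟩
        memberCount l n             ≤⟨ memberCount≤total l n c ⟩
        totalCount {r = r} I l n    ≤⟨ total≤bad none ⟩
        badCount {r = r} I l m s n          ∎) ⟩
      2 * badCount {r = r} I l m s n        ≤⟨ proj₂ (proj₂ rare n ≤-refl) ⟩
      totalCount {r = r} I l n      ≤⟨ total≤bad none ⟩
      badCount {r = r} I l m s n            ∎)
      where
      total≤bad : goodPairs l n m s ≤ 0 → totalCount {r = r} I l n ≤ badCount {r = r} I l m s n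
      total≤bad none = ≤-trans (total≤bad+good l n m s)
        (≤-reflexive (trans (cong (badCount {r = r} I l m s n +_) (n≤0⇒n≡0 none)) (+-identityʳ _)))
      positive : ∀ b → 0 < b → b < 2 * b
      positive (suc b) _ = m<m+n (suc b) z<s
    good : ∀ M g → 0 < 𝟙 (valid? I M g) * 𝟙 (badness I m s M g ℕ.≟ 0) → Valid I M g × ExtensionProperty m M g
    good M g pos with valid? I M g | badness I m s M g ℕ.≟ 0
    ... | yes valid | yes bad≡0 = valid , badness≡0⇒extension m s M g bad≡0

-- Proportions

-- The distance is `c / b`, and `K` is the denominator of `ε`, whose reciprocal is at most `ε`.
ratio-close : ∀ ε → 0ℚ ℚ.< ε → ∃[ K ] ∀ a c b (b≢0 : NonZero b) → a + c ≡ b → K * c < b →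
              ℚ.∣ ℚ._/_ (ℤ.+ a) b {{b≢0}} ℚ.- 1ℚ ∣ ℚ.< ε
ratio-close (mkℚ (ℤ.+ zero)  d _) (ℚ.*<* 0<0) = contradiction 0<0 (ℤ.<-irrefl refl)
ratio-close (mkℚ ℤ.-[1+ p ]  d _) (ℚ.*<* ())
ratio-close ε@(mkℚ ℤ.+[1+ p ] d _) _ = suc d , close
  where
  close : ∀ a c b (b≢0 : NonZero b) → a + c ≡ b → suc d * c < b → ℚ.∣ ℚ._/_ (ℤ.+ a) b {{b≢0}} ℚ.- 1ℚ ∣ ℚ.< ε
  close a c (suc b) _ a+c≡b small = ℚ.toℚᵘ-cancel-< (ℚᵘ.<-respˡ-≃ (ℚᵘ.≃-sym unnormalised) (ℚᵘ.*<* (begin-strict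
    ℤ.+ ℤ.∣ ℤ.+ a ℤ.* ℤ.1ℤ ℤ.+ ℤ.-1ℤ ℤ.* ℤ.+ suc b ∣ ℤ.* ℤ.+ suc d
      ≡⟨ cong (λ z → ℤ.+ z ℤ.* ℤ.+ suc d) distance ⟩
    ℤ.+ c ℤ.* ℤ.+ suc d              ≡⟨ ℤ.pos-* c (suc d) ⟨
    ℤ.+ (c * suc d)                  ≡⟨ cong ℤ.+_ (*-comm c (suc d)) ⟩
    ℤ.+ (suc d * c)                  <⟨ ℤ.+<+ (<-≤-trans small (≤-trans (≤-reflexive (sym (*-identityʳ (suc b)))) (m≤m+n (suc b * 1) (p * (suc b * 1))))) ⟩
    ℤ.+ (suc p * (suc b * 1))        ≡⟨ ℤ.pos-* (suc p) (suc b * 1) ⟩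
    ℤ.+ suc p ℤ.* ℤ.+ (suc b * 1)    ∎)))
    where
    open ℤ.≤-Reasoning
    unnormalised : ℚ.toℚᵘ ℚ.∣ (ℤ.+ a ℚ./ suc b) ℚ.- 1ℚ ∣ ℚᵘ.≃ ℚᵘ.∣ ℚᵘ.mkℚᵘ (ℤ.+ a) b ℚᵘ.+ ℚᵘ.mkℚᵘ ℤ.-1ℤ 0 ∣
    unnormalised = ℚᵘ.≃-trans (ℚ.toℚᵘ-homo-∣-∣ ((ℤ.+ a ℚ./ suc b) ℚ.- 1ℚ))
      (ℚᵘ.∣-∣-cong (ℚᵘ.≃-trans (ℚ.toℚᵘ-homo-+ (ℤ.+ a ℚ./ suc b) (ℚ.- 1ℚ))
        (ℚᵘ.+-congˡ (ℚᵘ.mkℚᵘ ℤ.-1ℤ 0) (ℚ.toℚᵘ-fromℚᵘ (ℚᵘ.mkℚᵘ (ℤ.+ a) b)))))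
    distance : ℤ.∣ ℤ.+ a ℤ.* ℤ.1ℤ ℤ.+ ℤ.-1ℤ ℤ.* ℤ.+ suc b ∣ ≡ c
    distance = trans
      (cong ℤ.∣_∣ (trans (cong₂ ℤ._+_ (ℤ.*-identityʳ (ℤ.+ a)) (ℤ.-1*i≡-i (ℤ.+ suc b))) (ℤ.m-n≡m⊖n a (suc b))))
      (trans (ℤ.∣⊖∣-≤ (subst (a ≤_) a+c≡b (m≤m+n a c))) (trans (cong (_∸ a) (sym a+c≡b)) (m+n∸m≡n a c)))

module _ {ρ : ℕ} {r : Fin ρ → ℕ} where

  hasSize : ∀ {n} {P : Structure r n → Set} (P? : Decidable P) → (∀ {M N} → M ≈ N → P M → P N) →
            HasSize (structureSetoid r n) P (length (filter P? (structures r n)))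
  hasSize {n} P? resp =
    filter P? (structures r n) , SetoidUnique.filter⁺ (structureSetoid r n) P? (structures-unique r n) ,
    (λ M → mk⇔ (SetoidMembershipProperties.∈-filter⁺ (structureSetoid r n) P? resp′ (∈-structures r n M))
               (λ M∈ → proj₂ (SetoidMembershipProperties.∈-filter⁻ (structureSetoid r n) P? resp′ {xs = structures r n} M∈))) ,
    refl
    where
    resp′ : ∀ {M N} → M ≈ N → _ → _
    resp′ {M} {N} = resp {M} {N}

  almostAll : ∀ {I : Subset ρ} {l m} → RefinesKernels {r = r} I l m → Fin l →
    {P : ∀ {n} → Structure r n → Set} → (∀ {n} (M : Structure r n) → Dec (P M)) →
    (∀ {n} {M N : Structure r n} → M ≈ N → P M → P N) →
    (∀ {n} (M : Structure r n) (g : Vec (Fin l) n) → Valid I M g → ExtensionProperty I m M g → P M) →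
    AlmostAll l I P
  almostAll {I} {l} {m} refines c {P} P? resp good⇒P ε 0<ε = proj₁ rare , λ n N≤n →
    let b≢0 = >-nonZero (<-≤-trans (0<memberCount {r = r} I l n c) (≤-reflexive (sym (length-filter≡∑ (inC? I l) (structures r n)))))
    in ℚ._/_ (ℤ.+ good n) (all n) {{b≢0}} ,
       (good n , all n ,
        hasSize (λ M → inC? I l M ×-dec P? M) (λ {M} {N} M≈N (inC , PM) → inC-resp-≈ I {M = M} {N} M≈N inC , resp {_} {M} {N} M≈N PM) ,
        hasSize (inC? I l) (λ {M} {N} → inC-resp-≈ I {M = M} {N}) ,
        b≢0 , refl) ,
       proj₂ (ratio-close ε 0<ε) (good n) (exceptionCount I refines {P} P? good⇒P n) (all n) b≢0 (split n)
         (<-≤-trans (proj₂ rare n N≤n) (≤-reflexive (sym (length-filter≡∑ (inC? I l) (structures r n)))))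
    where
    rare = exceptions-rare I refines {P} P? good⇒P c (proj₁ (ratio-close ε 0<ε))
    good all : ℕ → ℕ
    good n = length (filter (λ M → inC? I l M ×-dec P? M) (structures r n))
    all n = length (filter (inC? I l) (structures r n))
    split : ∀ n → good n + exceptionCount I refines {P} P? good⇒P n ≡ all n
    split n = trans (cong (_+ exceptionCount I refines {P} P? good⇒P n) (length-filter≡∑ _ (structures r n)))
      (trans (sym (∑-+ (structures r n) _ _))
      (trans (∑-cong (structures r n) (λ M → sym (𝟙-split (inC? I l M) (P? M) (inC? I l M ×-dec P? M) (inC? I l M ×-dec ¬? (P? M)))))
             (sym (length-filter≡∑ (inC? I l) (structures r n)))))

-- Complete l-partite structures

T-does⁻ : ∀ {P : Set} (d : Dec P) → T (does d) → P
T-does⁻ (yes p) _ = p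

T-does⁺ : ∀ {P : Set} (d : Dec P) → P → T (does d)
T-does⁺ (yes _) _ = tt
T-does⁺ (no ¬p) p = ¬p p

unique-resp-↭ : ∀ {n m} {t u : Vec (Fin n) m} → Vec.toList t ↭ Vec.toList u → VecUnique.Unique t → VecUnique.Unique u
unique-resp-↭ {t = t} {u} t↭u t! = fromList u (resp t↭u (toList t t!))
  where
  resp : ∀ {xs ys} → xs ↭ ys → Unique xs → Unique ys
  resp p = SetoidPermutation.Unique-resp-↭ (≡.setoid _) (↭⇒↭ₛ p)
  toList : ∀ {m} (t : Vec _ m) → VecUnique.Unique t → Unique (Vec.toList t)
  toList []      []         = []
  toList (x ∷ t) (x∉t ∷ t!) = All.tabulate (λ {y} y∈t →
    let i , ti≡y = toList∈⇒lookup t y∈t in λ x≡y → VecAllProperties.lookup⁺ x∉t i (trans x≡y (sym ti≡y))) ∷ toList t t!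
  fromList : ∀ {m} (t : Vec _ m) → Unique (Vec.toList t) → VecUnique.Unique t
  fromList []      []         = []
  fromList (x ∷ t) (x∉t ∷ t!) = VecAllProperties.lookup⁻ (λ i → All.lookup x∉t (lookup∈toList t i)) ∷ fromList t t!

nonConstant-resp-↭ : ∀ {n m l} (γ : Fin n → Fin l) {t u : Vec (Fin n) m} →
                     Vec.toList t ↭ Vec.toList u → NonConstant γ t → NonConstant γ u
nonConstant-resp-↭ γ {t} {u} t↭u (i , j , ≢) =
  let i′ , eqᵢ = toList∈⇒lookup u (↭.∈-resp-↭ t↭u (lookup∈toList t i))
      j′ , eqⱼ = toList∈⇒lookup u (↭.∈-resp-↭ t↭u (lookup∈toList t j))
  in i′ , j′ , λ e → ≢ (trans (cong γ (sym eqᵢ)) (trans e (cong γ eqⱼ)))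

tuple-from : ∀ {A : Set} {xs : List A} m → Unique xs → m ≤ length xs →
             ∃[ t ] VecUnique.Unique {n = m} t × (∀ i → lookup t i ∈ xs)
tuple-from zero    _ _ = [] , [] , λ ()
tuple-from {xs = x ∷ xs} (suc m) (x∉xs ∷ xs!) (s≤s m≤) with t , t! , t⊆ ← tuple-from m xs! m≤ =
  x ∷ t , VecAllProperties.lookup⁻ (λ i → All.lookup x∉xs (t⊆ i)) ∷ t! , λ { zero → here refl ; (suc i) → there (t⊆ i) }

classSize-≥ : ∀ {l s N} (δ : Vec (Fin l) N) c (f : Fin s → Fin N) (h : Fin N → Fin s) →
              (∀ k → h (f k) ≡ k) → (∀ k → lookup δ (f k) ≡ c) → s ≤ classSize δ c
classSize-≥ {s = s} {N} δ c f h hf≡ δf≡c = begin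
  s                                  ≡⟨ trans (cong (_* 1) (length-allFin s)) (*-identityʳ s) ⟨
  length (allFin s) * 1              ≡⟨ ∑-const (allFin s) 1 ⟨
  ∑ (allFin s) (λ _ → 1)             ≤⟨ ∑-cover (≡.decSetoid Fin._≟_) (Unique.allFin⁺ s) (allFin N) h
                                          (λ k _ → f k , ∈-allFin _ , sym (hf≡ k) ,
                                                   ≤-reflexive (sym (𝟙-yes (lookup δ (f k) Fin.≟ c) (δf≡c k)))) ⟩
  classSize δ c                      ∎
  where open ≤-Reasoning

module _ {ρ : ℕ} {r : Fin ρ → ℕ} where

  -- The complete `l`-partite structure. Its tuples have distinct entries and are closed under
  -- permutation, which puts it in the class for every `I`.
  complete : ∀ {l N} → Vec (Fin l) N → Structure r N
  complete δ = structure (λ k t → does (unique? t ×-dec nonConstant? (lookup δ) t))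

  complete-valid : ∀ I {l N} (δ : Vec (Fin l) N) → Valid I (complete δ) δ
  complete-valid I δ =
    (λ k _ → (λ t h → proj₁ (from t h)) ,
             (λ t u t↭u h → T-does⁺ (unique? u ×-dec nonConstant? (lookup δ) u)
               (unique-resp-↭ t↭u (proj₁ (from t h)) , nonConstant-resp-↭ (lookup δ) t↭u (proj₂ (from t h))))) ,
    (λ k t h → proj₂ (from t h))
    where
    from : ∀ {m} (t : Vec _ m) → T (does (unique? t ×-dec nonConstant? (lookup δ) t)) →
           VecUnique.Unique t × NonConstant (lookup δ) t
    from t = T-does⁻ (unique? t ×-dec nonConstant? (lookup δ) t)

  -- In a large class Z c some colour d is taken at least r k₀ - 1 times, and then the tuples
  -- (u , z₁ , … , z_{r k₀ - 1}) show that d is not taken outside Z c.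
  module _ {l N} (δ : Vec (Fin l) N) (k₀ : Fin ρ) (q : ℕ) (arity : r k₀ ≡ suc (suc q))
           (large : ∀ c → l * q < classSize δ c)
           (ε : Fin N → Fin l) (ε-col : IsColouring l (complete δ) ε) where

    private
      inBoth? : ∀ c d x → Dec (lookup δ x ≡ c × ε x ≡ d)
      inBoth? c d x = (lookup δ x Fin.≟ c) ×-dec (ε x Fin.≟ d)

      common : Fin l → Fin l → ℕ
      common c d = ∑ (allFin N) (λ x → 𝟙 (inBoth? c d x))

      -- Pigeonhole: `l` colours taken at most `q` times each would cover at most `l * q` elements.
      -- The `suc q` elements found are one fewer than the arity, which leaves room for a point of
      -- another class.
      dominant : ∀ c → ∃[ d ] q < common c d
      dominant c with Fin.any? (λ d → q <? common c d)
      ... | yes d   = d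
      ... | no none = contradiction (large c) (≤⇒≯ (begin
        classSize δ c                                             ≤⟨ ∑-mono (allFin N) (λ x → ≤-trans
                                                                       (𝟙-mono (lookup δ x Fin.≟ c) (inBoth? c (ε x) x) (_, refl))
                                                                       (term≤∑ (λ d → 𝟙 (inBoth? c d x)) (∈-allFin (ε x)))) ⟩
        ∑ (allFin N) (λ x → ∑ (allFin l) (λ d → 𝟙 (inBoth? c d x))) ≡⟨ ∑-swap (allFin N) (allFin l) _ ⟩
        ∑ (allFin l) (common c)                                   ≤⟨ ∑-≤const (allFin l) (λ d → ≮⇒≥ (λ q< → none (d , q<))) ⟩
        length (allFin l) * q                                     ≡⟨ cong (_* q) (length-allFin l) ⟩
        l * q                                                     ∎))
        where open ≤-Reasoning

      colourOf : Fin l → Fin l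
      colourOf c = proj₁ (dominant c)

      avoids-colourOf : ∀ c u → lookup δ u ≢ c → ε u ≢ colourOf c
      avoids-colourOf c u δu≢c εu≡d =
        let t , t! , nonConst , const = tuple arity
            i , j , ≢ = ε-col k₀ t (T-does⁺ (unique? t ×-dec nonConstant? (lookup δ) t) (t! , nonConst))
        in ≢ (trans (const i) (sym (const j)))
        where
        d = colourOf c
        tuple : ∀ {m} → m ≡ suc (suc q) → Σ[ t ∈ Vec (Fin N) m ]
                VecUnique.Unique t × NonConstant (lookup δ) t × (∀ i → ε (lookup t i) ≡ d)
        tuple refl
          with z , z! , z⊆ ← tuple-from (suc q) (Unique.filter⁺ (inBoth? c d) (Unique.allFin⁺ N))
                 (subst (suc q ≤_) (sym (length-filter≡∑ (inBoth? c d) (allFin N))) (proj₂ (dominant c))) =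
          u ∷ z , VecAllProperties.lookup⁻ (λ i u≡zi → δu≢c (trans (cong (lookup δ) u≡zi) (proj₁ (both i)))) ∷ z! ,
          (zero , suc zero , λ e → δu≢c (trans e (proj₁ (both zero)))) ,
          λ { zero → εu≡d ; (suc i) → proj₂ (both i) }
          where
          both : ∀ i → lookup δ (lookup z i) ≡ c × ε (lookup z i) ≡ d
          both i = proj₂ (∈.∈-filter⁻ (inBoth? c d) {xs = allFin N} (z⊆ i))

      -- The class `c′` contains a point with its dominant colour, and this point avoids the
      -- dominant colour of any other class.
      colourOf-injective : ∀ c c′ → colourOf c ≡ colourOf c′ → c ≡ c′
      colourOf-injective c c′ eq
        with u , _ , u-pos ← ∑>0⇒∃ (allFin N) _ (≤-<-trans z≤n (proj₂ (dominant c′)))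
        with δu≡c′ , εu≡d′ ← 𝟙>0⇒ (inBoth? c′ (colourOf c′) u) u-pos =
        decidable-stable (c Fin.≟ c′) (λ c≢c′ →
          avoids-colourOf c u (λ δu≡c → c≢c′ (trans (sym δu≡c) δu≡c′)) (trans εu≡d′ (sym eq)))

      -- Among the `suc l` values `ε u` and `colourOf c`, two coincide. By injectivity one of them
      -- is `ε u`, and the colour `colourOf c` occurs only in class `c`.
      ε≡colourOf : ∀ u → ε u ≡ colourOf (lookup δ u)
      ε≡colourOf u with Fin.pigeonhole (n<1+n l) (λ { zero → ε u ; (suc c) → colourOf c })
      ... | zero  , suc c  , _   , εu≡d = trans εu≡d (cong colourOf (sym
              (decidable-stable (lookup δ u Fin.≟ c) (λ δu≢c → avoids-colourOf c u δu≢c εu≡d))))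
      ... | suc c , suc c′ , c<c′ , d≡d′ =
              contradiction (cong (toℕ ∘ suc) (colourOf-injective c c′ d≡d′)) (<⇒≢ c<c′)

    complete-colouring : ∀ u v → ε u ≡ ε v ⇔ lookup δ u ≡ lookup δ v
    complete-colouring u v = mk⇔
      (λ εu≡εv → colourOf-injective _ _ (trans (sym (ε≡colourOf u)) (trans εu≡εv (ε≡colourOf v))))
      (λ δu≡δv → trans (ε≡colourOf u) (trans (cong colourOf δu≡δv) (sym (ε≡colourOf v))))

  -- Embedding structures

  dropStructure : ∀ p {j} → Structure r (p + j) → Structure r j
  dropStructure zero    D = D
  dropStructure (suc p) D = dropStructure p (tailStructure D)

  module _ (I : Subset ρ) {l : ℕ} where

    tail-valid : ∀ {j} (D : Structure r (suc j)) (c : Fin l) δ → Valid I D (c ∷ δ) → Valid I (tailStructure D) δ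
    tail-valid D c δ (ob , col) =
      (λ k k∈I → (λ u h → unique-map⁻ u (proj₁ (ob k k∈I) _ h)) ,
                 (λ u v u↭v → proj₂ (ob k k∈I) _ _ (map-↭⁺ suc u v u↭v))) ,
      (λ k u h → Equivalence.to (nonConstant-map (lookup (c ∷ δ)) (lookup δ) suc u (λ _ → refl)) (col k _ h))

    drop-valid : ∀ {p j} (D : Structure r (p + j)) (δ : Vec (Fin l) p) η →
                 Valid I D (δ Vec.++ η) → Valid I (dropStructure p D) η
    drop-valid D []      η valid = valid
    drop-valid D (c ∷ δ) η valid = drop-valid (tailStructure D) δ η (tail-valid D c (δ Vec.++ η) valid)

    module _ {n m} (M : Structure r n) (g : Vec (Fin l) n) (ext : ExtensionProperty I m M g) where

      -- The new points are placed one at a time, from the end of `δ`, each as a one-point extension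
      -- of those already there.
      embed : ∀ {p j} → p + j ≤ m → (D : Structure r (p + j)) (δ : Vec (Fin l) p) (a : Vec (Fin n) j) →
              Valid I D (δ Vec.++ Vec.map (lookup g) a) → VecUnique.Unique a → pull M a ≈ dropStructure p D →
              Σ[ w ∈ Vec (Fin n) p ] VecUnique.Unique (w Vec.++ a) ×
                Vec.map (lookup g) (w Vec.++ a) ≡ δ Vec.++ Vec.map (lookup g) a × pull M (w Vec.++ a) ≈ D
      embed _ D [] a valid a! M≈D = [] , a! , refl , M≈D
      embed {suc p} {j} p<m D (c ∷ δ) a valid a! M≈D
        with w , wa! , colours , M≈tail ← embed (<⇒≤ p<m) (tailStructure D) δ a (tail-valid D c _ valid) a! M≈D
        with y , (gy≡c , y∉wa) , M≈D′ ← ext p<m D c (w Vec.++ a)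
               (subst (λ η → Valid I D (c ∷ η)) (sym colours) valid , wa! , M≈tail) =
        y ∷ w , y∉wa ∷ wa! , cong₂ _∷_ gy≡c colours , M≈D′

  -- This starts embeddings and partial isomorphisms: on two points of one colour, or on no points,
  -- any two coloured structures agree.
  monochromatic-empty : ∀ {n l} {M : Structure r n} {γ : Fin n → Fin l} → IsColouring l M γ →
                        (∀ x y → γ x ≡ γ y) → ∀ k t → rel M k t ≡ false
  monochromatic-empty {M = M} col const k t with rel M k t in eq
  ... | false = refl
  ... | true  with i , j , ≢ ← col k t (subst T (sym eq) tt) = contradiction (const _ _) ≢

  -- Defining formula for the colour classes

  ∃ⁿ : ∀ p {j} → Formula r (p + j) → Formula r j
  ∃ⁿ zero    φ = φ
  ∃ⁿ (suc p) φ = ∃ⁿ p (∃′ φ)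

  ⊨-∃ⁿ⁻ : ∀ {n} {M : Structure r n} p {j} {e : Vec (Fin n) j} {φ} → M , e ⊨ ∃ⁿ p φ → ∃[ w ] M , w Vec.++ e ⊨ φ
  ⊨-∃ⁿ⁻ zero    h = [] , h
  ⊨-∃ⁿ⁻ (suc p) h with w , y , h′ ← ⊨-∃ⁿ⁻ p h = y ∷ w , h′

  ⊨-∃ⁿ⁺ : ∀ {n} {M : Structure r n} {p j} {e : Vec (Fin n) j} {φ} (w : Vec (Fin n) p) → M , w Vec.++ e ⊨ φ → M , e ⊨ ∃ⁿ p φ
  ⊨-∃ⁿ⁺ []      h = h
  ⊨-∃ⁿ⁺ (y ∷ w) h = ⊨-∃ⁿ⁺ w (y , h)

  module _ {N} (D : Structure r N) (x₀ : Fin N) where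

    atoms : List (Σ (Fin ρ) (λ k → Vec (Fin N) (r k))) → Formula r N
    -- The empty conjunction; `x₀` is carried along because formulas have no constant for truth.
    atoms []             = x₀ ≐ x₀
    atoms ((k , t) ∷ ps) = if rel D k t then R k t ∧′ atoms ps else atoms ps

    -- It expresses that the variables are the image of a homomorphism from `D`, along which
    -- colourings can be pulled back.
    positiveDiagram : Formula r N
    positiveDiagram = atoms (positions r N)

    module _ {n} (M : Structure r n) (v : Vec (Fin n) N) where

      ⊨-positiveDiagram⁻ : M , v ⊨ positiveDiagram → ∀ k t → Holds D k t → Holds M k (Vec.map (lookup v) t)
      ⊨-positiveDiagram⁻ h k t Dt = go (positions r N) h (∈-positions r k t)
        where
        go : ∀ ps → M , v ⊨ atoms ps → (k , t) ∈ ps → Holds M k (Vec.map (lookup v) t)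
        go ((k′ , t′) ∷ ps) h p with rel D k′ t′ in eq | p
        ... | true  | here refl = proj₁ h
        ... | true  | there p′  = go ps (proj₂ h) p′
        ... | false | there p′  = go ps h p′
        ... | false | here refl = ⊥-elim (subst T eq Dt)

      ⊨-positiveDiagram⁺ : (∀ k t → Holds D k t → Holds M k (Vec.map (lookup v) t)) → M , v ⊨ positiveDiagram
      ⊨-positiveDiagram⁺ hom = go (positions r N)
        where
        go : ∀ ps → M , v ⊨ atoms ps
        go []             = refl
        go ((k , t) ∷ ps) with rel D k t in eq
        ... | true  = hom k t (subst T (sym eq) tt) , go ps
        ... | false = go ps

  module _ (l : ℕ) (k₀ : Fin ρ) (q : ℕ) (arity : r k₀ ≡ suc (suc q)) where

    -- `l` classes of `suc (l * q)` points each, just above the bound in `complete-colouring`.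
    N₀ : ℕ
    N₀ = suc (l * q) * l

    δ₀ : Vec (Fin l) N₀
    δ₀ = Vec.tabulate (λ x → proj₂ (remQuot {suc (l * q)} l x))

    representative : ∀ j → Fin (suc (l * q)) → Fin l → Fin (N₀ + j)
    representative j k c = combine k c Fin.↑ˡ j

    representative-colour : ∀ {j} (η : Vec (Fin l) j) k c → lookup (δ₀ Vec.++ η) (representative j k c) ≡ c
    representative-colour η k c = trans (Vec.lookup-++ˡ δ₀ η (combine k c))
      (trans (Vec.lookup∘tabulate _ (combine k c)) (cong proj₂ (Fin.remQuot-combine k c)))

    classes-large : ∀ {j} (η : Vec (Fin l) j) c → l * q < classSize (δ₀ Vec.++ η) c
    classes-large {j} η c = classSize-≥ (δ₀ Vec.++ η) c (λ k → representative j k c)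
      -- Appended points are not in the image of `representative`, so the value there is arbitrary.
      (λ y → [ proj₁ ∘ remQuot {suc (l * q)} l , (λ _ → zero) ]′ (Fin.splitAt N₀ y))
      (λ k → trans (cong [ proj₁ ∘ remQuot {suc (l * q)} l , (λ _ → zero) ]′ (Fin.splitAt-↑ˡ N₀ (combine k c) j))
                   (cong proj₁ (Fin.remQuot-combine k c)))
      (λ k → representative-colour η k c)

    module _ {n} (M : Structure r n) (γ : Fin n → Fin l) (col : IsColouring l M γ) {j} (η : Vec (Fin l) j)
             (v : Vec (Fin n) (N₀ + j))
             (hom : ∀ k t → Holds (complete (δ₀ Vec.++ η)) k t → Holds M k (Vec.map (lookup v) t)) where

      -- Composing `γ` with `v` colours the complete structure, whose colourings all have the same
      -- kernel.
      homomorphism-colouring : ∀ x y → γ (lookup v x) ≡ γ (lookup v y) ⇔ lookup (δ₀ Vec.++ η) x ≡ lookup (δ₀ Vec.++ η) y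
      homomorphism-colouring = complete-colouring (δ₀ Vec.++ η) k₀ q arity (classes-large η) (γ ∘ lookup v)
        (λ k t h → Equivalence.to (nonConstant-map γ (γ ∘ lookup v) (lookup v) t (λ _ → refl)) (col k _ (hom k t h)))

    sameColourVia : Fin l → Formula r 2
    sameColourVia c = ∃ⁿ N₀ (positiveDiagram (complete (δ₀ Vec.++ (c ∷ c ∷ []))) (N₀ Fin.↑ʳ zero))

    -- In `sameColourVia c` the two free variables are appended to class `c`. A formula cannot refer
    -- to the colour of a point, hence the disjunction over all `c`.
    sameColourAmong : List (Fin l) → Formula r 2
    -- Equal arguments get a disjunct of their own, as `embed` starts from a tuple without
    -- repetition.
    sameColourAmong []       = zero ≐ suc zero
    sameColourAmong (c ∷ cs) = sameColourVia c ∨′ sameColourAmong cs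

    sameColour : Formula r 2
    sameColour = sameColourAmong (allFin l)

    sameColour-sound : ∀ {n} (M : Structure r n) (γ : Fin n → Fin l) → IsColouring l M γ →
                       ∀ x y → M , x ∷ y ∷ [] ⊨ sameColour → γ x ≡ γ y
    sameColour-sound M γ col x y = go (allFin l)
      where
      go : ∀ cs → M , x ∷ y ∷ [] ⊨ sameColourAmong cs → γ x ≡ γ y
      go []       x≡y      = cong γ x≡y
      go (c ∷ cs) (inj₂ h) = go cs h
      go (c ∷ cs) (inj₁ h) with w , h′ ← ⊨-∃ⁿ⁻ {M = M} N₀ h =
        trans (cong γ (sym (Vec.lookup-++ʳ w xy zero)))
       (trans (Equivalence.from (homomorphism-colouring M γ col cc (w Vec.++ xy)
                 (⊨-positiveDiagram⁻ (complete (δ₀ Vec.++ cc)) (N₀ Fin.↑ʳ zero) M (w Vec.++ xy) h′)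
                 (N₀ Fin.↑ʳ zero) (N₀ Fin.↑ʳ suc zero))
                 (trans (Vec.lookup-++ʳ δ₀ cc zero) (sym (Vec.lookup-++ʳ δ₀ cc (suc zero)))))
              (cong γ (Vec.lookup-++ʳ w xy (suc zero))))
        where
        xy : Vec (Fin _) 2
        xy = x ∷ y ∷ []
        cc : Vec (Fin l) 2
        cc = c ∷ c ∷ []

    module _ (I : Subset ρ) {n m} (N₀+2≤m : N₀ + 2 ≤ m) (M : Structure r n) (g : Vec (Fin l) n)
             (valid : Valid I M g) (ext : ExtensionProperty I m M g) where

      -- Two points of one colour carry no relations between them, so they can serve as the appended
      -- points, and extension supplies the rest of the complete structure.
      sameColour-complete : ∀ x y → lookup g x ≡ lookup g y → M , x ∷ y ∷ [] ⊨ sameColour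
      sameColour-complete x y gx≡gy with x Fin.≟ y
      ... | yes x≡y = base (allFin l)
        where
        base : ∀ cs → M , x ∷ y ∷ [] ⊨ sameColourAmong cs
        base []       = x≡y
        base (c ∷ cs) = inj₂ (base cs)
      ... | no x≢y = some (allFin l) (∈-allFin c)
        where
        c = lookup g x
        a : Vec (Fin n) 2
        a = x ∷ y ∷ []
        a! : VecUnique.Unique a
        a! = (x≢y ∷ []) ∷ [] ∷ []
        cc : Vec (Fin l) 2
        cc = c ∷ c ∷ []
        cc≡ : Vec.map (lookup g) a ≡ cc
        cc≡ = cong (λ d → c ∷ d ∷ []) (sym gx≡gy)
        cc-const : ∀ i j → lookup cc i ≡ lookup cc j
        cc-const zero       zero       = refl
        cc-const zero       (suc zero) = refl
        cc-const (suc zero) zero       = refl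
        cc-const (suc zero) (suc zero) = refl
        D = complete (δ₀ Vec.++ cc)
        D-valid = complete-valid I (δ₀ Vec.++ cc)
        agree : pull M a ≈ dropStructure N₀ D
        agree k t = trans
          (monochromatic-empty {M = pull M a} (subst (λ η → IsColouring l (pull M a) (lookup η)) cc≡ (proj₂ (pull-valid I a a! g {M} valid))) cc-const k t)
          (sym (monochromatic-empty {M = dropStructure N₀ D} (proj₂ (drop-valid I D δ₀ cc D-valid)) cc-const k t))
        embedding = embed I M g ext N₀+2≤m D δ₀ a (subst (λ η → Valid I D (δ₀ Vec.++ η)) (sym cc≡) D-valid) a! agree
        w = proj₁ embedding
        via : M , a ⊨ sameColourVia c
        via = ⊨-∃ⁿ⁺ {M = M} w (⊨-positiveDiagram⁺ D (N₀ Fin.↑ʳ zero) M (w Vec.++ a)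
                (λ k t → subst T (sym (proj₂ (proj₂ (proj₂ embedding)) k t))))
        some : ∀ cs → c ∈ cs → M , a ⊨ sameColourAmong cs
        some (_ ∷ cs) (here refl) = inj₁ via
        some (_ ∷ cs) (there c∈)  = inj₂ (some cs c∈)

      -- From right to left by `sameColour`. For the converse, a copy of the complete structure
      -- meets every class of `g`, and `γ` separates its classes; each of `x` and `y` is compared
      -- with a point of the copy in its own class.
      sameColour-iff : ∀ (γ : Fin n → Fin l) → IsColouring l M γ → ∀ x y → γ x ≡ γ y ⇔ lookup g x ≡ lookup g y
      sameColour-iff γ col x y = mk⇔ reflects preserves
        where
        preserves : ∀ {x y} → lookup g x ≡ lookup g y → γ x ≡ γ y
        preserves {x} {y} gx≡gy = sameColour-sound M γ col x y (sameColour-complete x y gx≡gy)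
        D = complete (δ₀ Vec.++ [])
        embedding = embed I M g ext (≤-trans (+-monoʳ-≤ N₀ z≤n) N₀+2≤m) D δ₀ [] (complete-valid I (δ₀ Vec.++ [])) []
          (λ k t → trans (monochromatic-empty {M = pull M []} {γ = lookup []} (proj₂ (pull-valid I [] [] g {M} valid)) (λ ()) k t)
                         (sym (monochromatic-empty {M = dropStructure N₀ D} {γ = lookup []} (proj₂ (drop-valid I D δ₀ [] (complete-valid I (δ₀ Vec.++ [])))) (λ ()) k t)))
        v = proj₁ embedding Vec.++ []
        colour : ∀ c → lookup g (lookup v (representative 0 zero c)) ≡ c
        colour c = trans (sym (Vec.lookup-map (representative 0 zero c) (lookup g) v))
          (trans (cong (λ η → lookup η (representative 0 zero c)) (proj₁ (proj₂ (proj₂ embedding))))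
                 (representative-colour [] zero c))
        reflects : γ x ≡ γ y → lookup g x ≡ lookup g y
        reflects γx≡γy = trans (sym (representative-colour [] zero (lookup g x)))
          (trans (Equivalence.to (homomorphism-colouring M γ col [] v
                   (λ k t → subst T (sym (proj₂ (proj₂ (proj₂ embedding)) k t))) _ _)
                   (trans (preserves (colour (lookup g x))) (trans γx≡γy (preserves (sym (colour (lookup g y)))))))
                 (representative-colour [] zero (lookup g y)))

-- Satisfaction

module _ {ρ : ℕ} {r : Fin ρ → ℕ} where

  opaque

    _,_⊨?_ : ∀ {n p} (M : Structure r n) (e : Vec (Fin n) p) (φ : Formula r p) → Dec (M , e ⊨ φ)
    M , e ⊨? (x ≐ y)  = lookup e x Fin.≟ lookup e y
    M , e ⊨? R k t    = T? (rel M k (Vec.map (lookup e) t))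
    M , e ⊨? (¬′ φ)   = ¬? (M , e ⊨? φ)
    M , e ⊨? (φ ∧′ ψ) = (M , e ⊨? φ) ×-dec (M , e ⊨? ψ)
    M , e ⊨? (φ ∨′ ψ) = (M , e ⊨? φ) ⊎-dec (M , e ⊨? ψ)
    M , e ⊨? (φ ⇒′ ψ) = (M , e ⊨? φ) →-dec (M , e ⊨? ψ)
    M , e ⊨? (∀′ φ)   = Fin.all? (λ a → M , a ∷ e ⊨? φ)
    M , e ⊨? (∃′ φ)   = Fin.any? (λ a → M , a ∷ e ⊨? φ)

  ⊨-resp-≈ : ∀ {n p} {M N : Structure r n} → M ≈ N → (e : Vec (Fin n) p) (φ : Formula r p) → M , e ⊨ φ → N , e ⊨ φ
  ⊨-resp-≈ M≈N e (x ≐ y)  h        = h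
  ⊨-resp-≈ M≈N e (R k t)  h        = subst T (M≈N k _) h
  ⊨-resp-≈ {M = M} {N} M≈N e (¬′ φ) h h′ = h (⊨-resp-≈ {M = N} {M} (≈-sym {M = M} {N} M≈N) e φ h′)
  ⊨-resp-≈ {M = M} {N} M≈N e (φ ∧′ ψ) (h , h′) = ⊨-resp-≈ {M = M} {N} M≈N e φ h , ⊨-resp-≈ {M = M} {N} M≈N e ψ h′
  ⊨-resp-≈ {M = M} {N} M≈N e (φ ∨′ ψ) (inj₁ h) = inj₁ (⊨-resp-≈ {M = M} {N} M≈N e φ h)
  ⊨-resp-≈ {M = M} {N} M≈N e (φ ∨′ ψ) (inj₂ h) = inj₂ (⊨-resp-≈ {M = M} {N} M≈N e ψ h)
  ⊨-resp-≈ {M = M} {N} M≈N e (φ ⇒′ ψ) h h′ =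
    ⊨-resp-≈ {M = M} {N} M≈N e ψ (h (⊨-resp-≈ {M = N} {M} (≈-sym {M = M} {N} M≈N) e φ h′))
  ⊨-resp-≈ {M = M} {N} M≈N e (∀′ φ)   h        = λ a → ⊨-resp-≈ {M = M} {N} M≈N (a ∷ e) φ (h a)
  ⊨-resp-≈ {M = M} {N} M≈N e (∃′ φ)   (a , h)  = a , ⊨-resp-≈ {M = M} {N} M≈N (a ∷ e) φ h

  quantifierDepth : ∀ {p} → Formula r p → ℕ
  quantifierDepth (x ≐ y)  = 0
  quantifierDepth (R k t)  = 0
  quantifierDepth (¬′ φ)   = quantifierDepth φ
  quantifierDepth (φ ∧′ ψ) = quantifierDepth φ ⊔ quantifierDepth ψ
  quantifierDepth (φ ∨′ ψ) = quantifierDepth φ ⊔ quantifierDepth ψ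
  quantifierDepth (φ ⇒′ ψ) = quantifierDepth φ ⊔ quantifierDepth ψ
  quantifierDepth (∀′ φ)   = suc (quantifierDepth φ)
  quantifierDepth (∃′ φ)   = suc (quantifierDepth φ)

  -- Ehrenfeucht–Fraïssé transfer between coloured structures with the extension property

  module _ (I : Subset ρ) (l m : ℕ) where

    record Good : Set where
      constructor mkGood
      field
        {size}    : ℕ
        model     : Structure r size
        colours   : Vec (Fin l) size
        valid     : Valid I model colours
        extension : ExtensionProperty I m model colours

    open Good

    -- Colours are preserved literally, not just up to renaming, because the extension property
    -- realises every consistent pattern in each prescribed colour.
    record PartialIso (𝓜 𝓝 : Good) {j} (a : Vec (Fin (size 𝓜)) j) (b : Vec (Fin (size 𝓝)) j) : Set where
      constructor mkPartialIso
      field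
        a!           : VecUnique.Unique a
        b!           : VecUnique.Unique b
        same-colours : Vec.map (lookup (colours 𝓜)) a ≡ Vec.map (lookup (colours 𝓝)) b
        same-induced : pull (model 𝓜) a ≈ pull (model 𝓝) b

    swap-iso : ∀ {𝓜 𝓝 j} {a : Vec (Fin (size 𝓜)) j} {b} → PartialIso 𝓜 𝓝 a b → PartialIso 𝓝 𝓜 b a
    swap-iso (mkPartialIso a! b! c e) = mkPartialIso b! a! (sym c) (λ k u → sym (e k u))

    -- The pattern of `x` over `a` is an extension problem over `b`, consistent because of the
    -- partial isomorphism.
    forth : ∀ 𝓜 𝓝 {j} {a : Vec (Fin (size 𝓜)) j} {b} → PartialIso 𝓜 𝓝 a b → j < m → ∀ x →
            (∃[ i ] lookup a i ≡ x) ⊎ ∃[ y ] PartialIso 𝓜 𝓝 (x ∷ a) (y ∷ b)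
    forth 𝓜 𝓝 {a = a} {b} (mkPartialIso a! b! c e) j<m x with Fin.any? (λ i → lookup a i Fin.≟ x)
    ... | yes x∈a = inj₁ x∈a
    ... | no  x∉a =
      let y , (gy≡gx , y∉b) , hit = extension 𝓝 j<m D (lookup g x) b (D-valid , b! , λ k u →
            trans (sym (e k u)) (sym (tail-pull (model 𝓜) x a k u)))
      in inj₂ (y , mkPartialIso xa! (y∉b ∷ b!) (cong₂ _∷_ (sym gy≡gx) c) (λ k u → sym (hit k u)))
      where
      g = colours 𝓜
      D = pull (model 𝓜) (x ∷ a)
      xa! : VecUnique.Unique (x ∷ a)
      xa! = VecAllProperties.lookup⁻ (λ i x≡ai → x∉a (i , sym x≡ai)) ∷ a!
      D-valid : Valid I D (lookup g x ∷ Vec.map (lookup (colours 𝓝)) b)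
      D-valid = subst (λ η → Valid I D (lookup g x ∷ η)) c (pull-valid I (x ∷ a) xa! g {model 𝓜} (valid 𝓜))

    private
      shift : ∀ {n j p} x (a : Vec (Fin n) j) (σ : Vec (Fin j) p) →
              Vec.map (lookup (x ∷ a)) (zero ∷ Vec.map suc σ) ≡ x ∷ Vec.map (lookup a) σ
      shift x a σ = cong (x ∷_) (sym (Vec.map-∘ (lookup (x ∷ a)) suc σ))

    -- Variables are read through `σ`, so that they may repeat values while `a` and `b` stay free of
    -- repetition, and `j` grows only when a new element is chosen. The depth bound keeps `j` below
    -- `m` at each quantifier. Negation and implication exchange the two sides.
    transfer : ∀ 𝓜 𝓝 {j p} {a : Vec (Fin (size 𝓜)) j} {b} (σ : Vec (Fin j) p) (φ : Formula r p) →
               PartialIso 𝓜 𝓝 a b → quantifierDepth φ + j ≤ m →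
               model 𝓜 , Vec.map (lookup a) σ ⊨ φ → model 𝓝 , Vec.map (lookup b) σ ⊨ φ
    transfer 𝓜 𝓝 {a = a} {b} σ (x ≐ y) iso depth h =
      trans (Vec.lookup-map x (lookup b) σ)
     (trans (cong (lookup b) (VecUnique.lookup-injective (PartialIso.a! iso) _ _
              (trans (sym (Vec.lookup-map x (lookup a) σ)) (trans h (Vec.lookup-map y (lookup a) σ)))))
            (sym (Vec.lookup-map y (lookup b) σ)))
    transfer 𝓜 𝓝 {a = a} {b} σ (R k t) iso depth h =
      subst T (trans (cong (rel (model 𝓜) k) (indices a))
              (trans (PartialIso.same-induced iso k (Vec.map (lookup σ) t)) (sym (cong (rel (model 𝓝) k) (indices b))))) h
      where
      indices : ∀ {n} (a : Vec (Fin n) _) →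
                Vec.map (lookup (Vec.map (lookup a) σ)) t ≡ Vec.map (lookup a) (Vec.map (lookup σ) t)
      indices a = trans (Vec.map-cong (λ i → Vec.lookup-map i (lookup a) σ) t) (Vec.map-∘ (lookup a) (lookup σ) t)
    transfer 𝓜 𝓝 σ (¬′ φ) iso depth h h′ = h (transfer 𝓝 𝓜 σ φ (swap-iso iso) depth h′)
    transfer 𝓜 𝓝 σ (φ ∧′ ψ) iso depth (h , h′) =
      transfer 𝓜 𝓝 σ φ iso (≤-trans (+-monoˡ-≤ _ (m≤m⊔n (quantifierDepth φ) (quantifierDepth ψ))) depth) h ,
      transfer 𝓜 𝓝 σ ψ iso (≤-trans (+-monoˡ-≤ _ (m≤n⊔m (quantifierDepth φ) (quantifierDepth ψ))) depth) h′
    transfer 𝓜 𝓝 σ (φ ∨′ ψ) iso depth (inj₁ h) = inj₁ (transfer 𝓜 𝓝 σ φ iso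
      (≤-trans (+-monoˡ-≤ _ (m≤m⊔n (quantifierDepth φ) (quantifierDepth ψ))) depth) h)
    transfer 𝓜 𝓝 σ (φ ∨′ ψ) iso depth (inj₂ h) = inj₂ (transfer 𝓜 𝓝 σ ψ iso
      (≤-trans (+-monoˡ-≤ _ (m≤n⊔m (quantifierDepth φ) (quantifierDepth ψ))) depth) h)
    transfer 𝓜 𝓝 σ (φ ⇒′ ψ) iso depth h h′ =
      transfer 𝓜 𝓝 σ ψ iso (≤-trans (+-monoˡ-≤ _ (m≤n⊔m (quantifierDepth φ) (quantifierDepth ψ))) depth)
        (h (transfer 𝓝 𝓜 σ φ (swap-iso iso)
             (≤-trans (+-monoˡ-≤ _ (m≤m⊔n (quantifierDepth φ) (quantifierDepth ψ))) depth) h′))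
    transfer 𝓜 𝓝 {j} {a = a} {b} σ (∀′ φ) iso depth h y with forth 𝓝 𝓜 (swap-iso iso) (≤-trans (s≤s (m≤n+m j (quantifierDepth φ))) depth) y
    ... | inj₁ (i , refl) = transfer 𝓜 𝓝 (i ∷ σ) φ iso (<⇒≤ depth) (h (lookup a i))
    ... | inj₂ (x , iso′) =
      subst (λ e → model 𝓝 , e ⊨ φ) (shift y b σ)
        (transfer 𝓜 𝓝 (zero ∷ Vec.map suc σ) φ (swap-iso iso′) (≤-trans (≤-reflexive (+-suc (quantifierDepth φ) j)) depth)
          (subst (λ e → model 𝓜 , e ⊨ φ) (sym (shift x a σ)) (h x)))
    transfer 𝓜 𝓝 {j} {a = a} {b} σ (∃′ φ) iso depth (x , h) with forth 𝓜 𝓝 iso (≤-trans (s≤s (m≤n+m j (quantifierDepth φ))) depth) x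
    ... | inj₁ (i , refl) = lookup b i , transfer 𝓜 𝓝 (i ∷ σ) φ iso (<⇒≤ depth) h
    ... | inj₂ (y , iso′) = y ,
      subst (λ e → model 𝓝 , e ⊨ φ) (shift y b σ)
        (transfer 𝓜 𝓝 (zero ∷ Vec.map suc σ) φ iso′ (≤-trans (≤-reflexive (+-suc (quantifierDepth φ) j)) depth)
          (subst (λ e → model 𝓜 , e ⊨ φ) (sym (shift x a σ)) h))

    transfer-sentence : ∀ 𝓜 𝓝 (φ : Sentence r) → quantifierDepth φ ≤ m → model 𝓜 , [] ⊨ φ → model 𝓝 , [] ⊨ φ
    transfer-sentence 𝓜 𝓝 φ depth = transfer 𝓜 𝓝 [] φ
      (mkPartialIso [] [] refl (λ k u → trans (empty 𝓜 k u) (sym (empty 𝓝 k u))))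
      (≤-trans (≤-reflexive (+-identityʳ _)) depth)
      where
      -- Over no points the only tuple is the empty one, and it has no two entries of different
      -- colours.
      empty : ∀ 𝓜 k u → rel (pull (model 𝓜) []) k u ≡ false
      empty 𝓜 = monochromatic-empty {M = pull (model 𝓜) []} {γ = lookup []}
        (proj₂ (pull-valid I [] [] (colours 𝓜) {model 𝓜} (valid 𝓜))) (λ ())

-- Definability of the colour classes, unique colourability and the zero-one law

infixr 2 _⇔-dec_

_⇔-dec_ : ∀ {P Q : Set} → Dec P → Dec Q → Dec (P ⇔ Q)
d ⇔-dec e = map′ (λ (f , g) → mk⇔ f g) (λ f⇔g → Equivalence.to f⇔g , Equivalence.from f⇔g)
                 ((d →-dec e) ×-dec (e →-dec d))

module _ {ρ : ℕ} (r : Fin ρ → ℕ) (l : ℕ) (c₀ : Fin l) (k₀ : Fin ρ) (q : ℕ) (arity : r k₀ ≡ suc (suc q)) (I : Subset ρ) where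

  private
    ξ : Formula r 2
    ξ = sameColour l k₀ q arity

    m₀ : ℕ
    m₀ = N₀ {r = r} l k₀ q arity + 2

    kernels : ∀ {n m} → m₀ ≤ m → (M : Structure r n) (g : Vec (Fin l) n) → Valid I M g → ExtensionProperty I m M g →
              (γ : Fin n → Fin l) → IsColouring l M γ → ∀ x y → γ x ≡ γ y ⇔ lookup g x ≡ lookup g y
    kernels = sameColour-iff l k₀ q arity I

    refines : ∀ {m} → m₀ ≤ m → RefinesKernels {r = r} I l m
    refines m₀≤m M g g′ valid ext col x y = Equivalence.from (kernels m₀≤m M g valid ext (lookup g′) col x y)

    Defines : ∀ {n} → Structure r n → Set
    Defines {n} M = (γ : Fin n → Fin l) → IsColouring l M γ → ∀ a b → (γ a ≡ γ b) ⇔ (M , a ∷ b ∷ [] ⊨ ξ)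

    defines? : ∀ {n} (M : Structure r n) → Dec (Defines M)
    defines? M = all-functions?
      (λ {γ} {δ} γ≗δ def col a b →
        let equiv = def (colouring-resp I {M = M} {M} δ γ (λ _ _ → refl) (λ x → sym (γ≗δ x)) col) a b in
        mk⇔ (λ e → Equivalence.to equiv (trans (γ≗δ a) (trans e (sym (γ≗δ b)))))
            (λ h → trans (sym (γ≗δ a)) (trans (Equivalence.from equiv h) (γ≗δ b))))
      (λ γ → isColouring? I M γ →-dec Fin.all? (λ a → Fin.all? (λ b → (γ a Fin.≟ γ b) ⇔-dec (M , a ∷ b ∷ [] ⊨? ξ))))

    defines-resp : ∀ {n} {M N : Structure r n} → M ≈ N → Defines M → Defines N
    defines-resp {M = M} {N} M≈N def γ col a b =
      let equiv = def γ (colouring-resp I {M = N} {M} γ γ N≈M (λ _ → refl) col) a b in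
      mk⇔ (λ e → ⊨-resp-≈ {M = M} {N} M≈N (a ∷ b ∷ []) ξ (Equivalence.to equiv e))
          (λ h → Equivalence.from equiv (⊨-resp-≈ {M = N} {M} N≈M (a ∷ b ∷ []) ξ h))
      where
      N≈M : N ≈ M
      N≈M = ≈-sym {M = M} {N} M≈N

    uniquelyColourable? : ∀ {n} (M : Structure r n) → Dec (UniquelyColourable l M)
    uniquelyColourable? {n} M = colourable? ×-dec all-functions?
      (λ {γ} {δ} γ≗δ h γ′ col col′ a b →
        let equiv = h γ′ (colouring-resp I {M = M} {M} δ γ (λ _ _ → refl) (λ x → sym (γ≗δ x)) col) col′ a b in
        mk⇔ (λ e → Equivalence.to equiv (trans (γ≗δ a) (trans e (sym (γ≗δ b)))))
            (λ e → trans (sym (γ≗δ a)) (trans (Equivalence.from equiv e) (γ≗δ b))))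
      (λ γ → all-functions?
        (λ {γ′} {δ} γ′≗δ h col col′ a b →
          let equiv = h col (colouring-resp I {M = M} {M} δ γ′ (λ _ _ → refl) (λ x → sym (γ′≗δ x)) col′) a b in
          mk⇔ (λ e → trans (sym (γ′≗δ a)) (trans (Equivalence.to equiv e) (γ′≗δ b)))
              (λ e → Equivalence.from equiv (trans (γ′≗δ a) (trans e (sym (γ′≗δ b))))))
        (λ γ′ → isColouring? I M γ →-dec isColouring? I M γ′ →-dec
                Fin.all? (λ a → Fin.all? (λ b → (γ a Fin.≟ γ b) ⇔-dec (γ′ a Fin.≟ γ′ b)))))
      where
      colourable? : Dec (Colourable l M)
      colourable? = map′ (λ (g , col) → lookup g , col)
        (λ (γ , col) → Vec.tabulate γ , colouring-resp I {M = M} {M} γ (lookup (Vec.tabulate γ)) (λ _ _ → refl) (λ x → sym (Vec.lookup∘tabulate γ x)) col)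
        (any-map? (λ g → isColouring? I M (lookup g)))

    uniquelyColourable-resp : ∀ {n} {M N : Structure r n} → M ≈ N → UniquelyColourable l M → UniquelyColourable l N
    uniquelyColourable-resp {M = M} {N} M≈N ((γ₀ , col₀) , unique) =
      (γ₀ , colouring-resp I {M = M} {N} γ₀ γ₀ M≈N (λ _ → refl) col₀) ,
      (λ γ γ′ col col′ → unique γ γ′ (back γ col) (back γ′ col′))
      where
      back : ∀ γ → IsColouring l N γ → IsColouring l M γ
      back γ = colouring-resp I {M = N} {M} γ γ (≈-sym {M = M} {N} M≈N) (λ _ → refl)

  colour-classes-definable : Σ[ ξ ∈ Formula r 2 ] AlmostAll l I (λ (M : Structure r _) →
    (γ : Fin _ → Fin l) → IsColouring l M γ → ∀ a b → (γ a ≡ γ b) ⇔ (M , a ∷ b ∷ [] ⊨ ξ))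
  colour-classes-definable = ξ , almostAll (refines ≤-refl) c₀ {Defines} defines? (λ {_} {M} {N} → defines-resp {M = M} {N})
    (λ M g valid ext γ col a b →
      mk⇔ (λ e → sameColour-complete l k₀ q arity I ≤-refl M g valid ext a b
                   (Equivalence.to (kernels ≤-refl M g valid ext γ col a b) e))
          (sameColour-sound l k₀ q arity M γ col a b))

  almostAll-uniquelyColourable : AlmostAll l I (λ (M : Structure r _) → UniquelyColourable l M)
  almostAll-uniquelyColourable = almostAll (refines ≤-refl) c₀ {UniquelyColourable l} uniquelyColourable?
    (λ {_} {M} {N} → uniquelyColourable-resp {M = M} {N})
    (λ M g valid ext → (lookup g , proj₂ valid) , λ γ γ′ col col′ a b →
      mk⇔ (λ e → Equivalence.from (kernels ≤-refl M g valid ext γ′ col′ a b) (Equivalence.to (kernels ≤-refl M g valid ext γ col a b) e))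
          (λ e → Equivalence.from (kernels ≤-refl M g valid ext γ col a b) (Equivalence.to (kernels ≤-refl M g valid ext γ′ col′ a b) e)))

  zeroOneLaw : ZeroOneLaw r l I
  zeroOneLaw φ = decide (structure₀ , [] ⊨? φ)
    where
    -- `m₀` makes exceptions rare, and the quantifier depth, which is the same for `φ` and `¬′ φ`,
    -- allows transfer from `𝓜₀`.
    m = m₀ ⊔ quantifierDepth φ
    existing = goodPair-exists I l m c₀
    structure₀ = proj₁ (proj₂ existing)
    𝓜₀ : Good I l m
    𝓜₀ = mkGood structure₀ (proj₁ (proj₂ (proj₂ existing))) (proj₁ (proj₂ (proj₂ (proj₂ existing)))) (λ {j} → proj₂ (proj₂ (proj₂ (proj₂ existing))) {j})
    almost : ∀ ψ → quantifierDepth ψ ≤ m → structure₀ , [] ⊨ ψ → AlmostAll l I (λ (M : Structure r _) → M , [] ⊨ ψ)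
    almost ψ depth h = almostAll (refines (m≤m⊔n m₀ (quantifierDepth φ))) c₀ {λ M → M , [] ⊨ ψ} (λ M → M , [] ⊨? ψ)
      (λ {_} {M} {N} M≈N → ⊨-resp-≈ {M = M} {N} M≈N [] ψ)
      (λ M g valid ext → transfer-sentence I l m 𝓜₀ (mkGood M g valid (λ {j} → ext {j})) ψ depth h)
    decide : Dec (structure₀ , [] ⊨ φ) → _
    decide (yes h) = inj₁ (almost φ (m≤n⊔m m₀ (quantifierDepth φ)) h)
    decide (no ¬h) = inj₂ (almost (¬′ φ) (m≤n⊔m m₀ (quantifierDepth φ)) ¬h)

theorem10p3 : (l : ℕ) → 2 ≤ l →
    (ρ : ℕ) → 0 < ρ →
    (r : Fin ρ → ℕ) → (∀ k → 2 ≤ r k) →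
    (I : Subset ρ) →
    (Σ[ ξ ∈ Formula r 2 ] AlmostAll l I (λ (M : Structure r _) →
    (γ : Fin _ → Fin l) → IsColouring l M γ →
    ∀ a b → (γ a ≡ γ b) ⇔ (M , a ∷ b ∷ [] ⊨ ξ)))
    × AlmostAll l I (λ (M : Structure r _) → UniquelyColourable l M)
    × ZeroOneLaw r l I
theorem10p3 (suc l) _ (suc ρ) _ r 2≤r I =
  -- The complete structures are controlled through the first relation symbol; `q` is its arity
  -- minus two.
  let q , 2+q≡ = m≤n⇒∃[o]m+o≡n (2≤r zero) in
  colour-classes-definable r (suc l) zero zero q (sym 2+q≡) I ,
  almostAll-uniquelyColourable r (suc l) zero zero q (sym 2+q≡) I ,
  zeroOneLaw r (suc l) zero zero q (sym 2+q≡) I
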